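{- The following is provable in $\mathrm{BZFC}$: for all sets $A$ and $B$, 1. $A\preceq B$ iff $\mathrm{rlm}(A)\preceq\mathrm{rlm}(B)$ and $A^!\preceq B^!$ and $A^?\preceq B^?$ and $A_{\mathbf t}\preceq B_{\mathbf t}$; 2. $A\not\preceq B$ iff $A^!\not\preceq B^?$; 3. $A\cong B$ iff $A_{\mathbf t}\cong B_{\mathbf t}$ and $A_{\mathbf b}\cong B_{\mathbf b}$ and $A_{\mathbf n}\cong B_{\mathbf n}$; 4. $A\not\cong B$ iff $A^!\not\preceq B^?$ or $B^!\not\preceq A^?$ or $A_{\mathbf b}\not\preceq B_{\mathbf n}$ or $B_{\mathbf b}\not\preceq A_{\mathbf n}$.
   Context: Logic. The background logic is the four-valued first-order logic BS4 with primitives $\sim,\land,\lor,\rightarrow,\leftrightarrow,\bot,\forall,\exists$. A model has a non-empty domain $M$, the usual interpretations of constants and function symbols, and, for each $n$-ary relation symbol $R$, two independent interpretations $R^+,R^-\subseteq M^n$; $=^+$ is true identity and $=^-$ is a symmetric relation. Truth and falsity are defined simultaneously (a formula may be true, false, both, or neither): an atomic formula is true/false according to $R^+$/$R^-$; $\sim\varphi$ is true iff $\varphi$ is false, and false iff $\varphi$ is true; $\varphi\land\psi$ is true iff both are true, false iff at least one is false; $\lor$ dually; $\varphi\rightarrow\psi$ is true iff ($\varphi$ true implies $\psi$ true), false iff $\varphi$ is true and $\psi$ is false; $\varphi\leftrightarrow\psi$ is true iff ($\varphi$ true iff $\psi$ true), false iff ($\varphi$ true and $\psi$ false) or ($\varphi$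 false and $\psi$ true); $\forall$ is true iff all instances are true, false iff some instance is false; $\exists$ is true iff some instance is true, false iff all instances are false; $\bot$ is false and not true. $\Gamma\vDash\varphi$ iff $\varphi$ is true in every model in which all of $\Gamma$ is true. Asserting a formula means asserting that it is true; English "iff", "if/then", "and", "or" between formulas concern truth. Abbreviations: $\neg\varphi:=\varphi\rightarrow\bot$ (true iff $\varphi$ is not true); $!\varphi:=\sim\neg\varphi$ (two-valued, true iff $\varphi$ is true); $?\varphi:=\neg\sim\varphi$ (two-valued, true iff $\varphi$ is not false); $\circ\varphi:=\,!\varphi\leftrightarrow ?\varphi$; $\varphi\Rightarrow\psi:=(\varphi\rightarrow\psi)\land(\sim\psi\rightarrow\sim\varphi)$; $\varphi\Leftrightarrow\psi:=(\varphi\leftrightarrow\psi)\land(\sim\varphi\leftrightarrow\sim\psi)$; $\varphi\,\&\,\psi:=\,\sim(\varphi\rightarrow\sim\psi)$; $\exists x\in A\,\varphi:=\exists x(x\in A\,\&\,\varphi)$; $\forall x\in A\,\varphi:=\forall x(x\in A\rightarrow\varphi)$. A slashed relation symbol ($\neq,\notin,\not\subseteq,\not\cong,\not\preceq$) is the $\sim$-negation of the relation. Set theory. $\mathrm{BZFC}$ is a BS4-theory in the language $\{\in,=\}$ whose objects are called sets. It includes: Extensionality $\forall A\forall B(A=B\Leftrightarrow\forall x(x\in A\Leftrightarrow x\in B))$; Comprehension $\forall A\exists B\forall x(x\in B\Leftrightarrow x\in A\land\varphi(x))$; ACLA: $\exists A(A^!\not\subseteq A^?)\land\exists A(A^?\not\subseteq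 A^!)$; Choice: every classical set of non-empty sets has a choice function. Here $A=\{x:\varphi(x)\}$ means $\forall x(x\in A\Leftrightarrow\varphi(x))$; $A\subseteq B:=\forall x(x\in A\Rightarrow x\in B)$; $A$ is classical if $\forall x\,{\circ}(x\in A)$; $A^!:=\{x:{!}(x\in A)\}$ and $A^?:=\{x:{?}(x\in A)\}$. The remaining axioms are suitable analogues of those of $\mathrm{ZFC}$; available consequences are: $A^!,A^?$ are (classical) sets; $A\subseteq B\leftrightarrow(A^!\subseteq B^!\land A^?\subseteq B^?)$, $A\not\subseteq B\leftrightarrow A^!\not\subseteq B^?$, $A=B\leftrightarrow(A^!=B^!\land A^?=B^?)$, $A\neq B\leftrightarrow(A^!\not\subseteq B^?\lor B^!\not\subseteq A^?)$; for all classical sets $X,Y$ there is a unique set $\langle X|Y\rangle$ with $\langle X|Y\rangle^!=X$, $\langle X|Y\rangle^?=Y$; ordered pairs are encoded so that $(a,b)=(c,d)\Leftrightarrow(a=c\land b=d)$; usual $\mathrm{ZFC}$ set theory (including choice and von Neumann ordinals, which live in the inner $\mathrm{ZFC}$-model of hereditarily classical sets) applies to classical sets, whose elements may be arbitrary sets. Put $A_{\mathbf b}:=A^!\setminus A^?$, $A_{\mathbf t}:=A^!\cap A^?$, $A_{\mathbf n}:=A^?\setminus A^!$, $\mathrm{rlm}(A):=A^!\cup A^?$ (all classical sets). Functions and equinumerosity. A classical function is a classical set $f$ of ordered pairs with $((a,b)\in f\land(a,c)\in f)\rightarrow{!}(b=c)$; it is an injection if $((a,c)\in f\land(b,c)\in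 f)\rightarrow{!}(a=b)$. For $A\subseteq\mathrm{dom}(f)$, $f[A]:=\{y:\exists x(y=f(x)\,\&\,x\in A)\}$, so $f[A]^!=f[A^!]$ and $f[A]^?=f[A^?]$. A counting of $A$ is an injection with domain $\mathrm{rlm}(A)$; $\mathrm{Count}(A)$ is the class of countings of $A$. Define $$A\cong B:=\exists f\in\mathrm{Count}(A)\,\exists g\in\mathrm{Count}(B)\,(f[A]=g[B]),$$ $$A\preceq B:=\exists f\in\mathrm{Count}(A)\,\exists g\in\mathrm{Count}(B)\,(f[A]\subseteq g[B]).$$ Thus $A\not\cong B$ (resp. $A\not\preceq B$) is true iff $f[A]\neq g[B]$ (resp. $f[A]\not\subseteq g[B]$) is true for all $f\in\mathrm{Count}(A)$, $g\in\mathrm{Count}(B)$. For classical sets these notions agree with the usual ones of classical set theory. -}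

module Defs where

open import Level using (Level) renaming (suc to lsuc)
open import Data.Nat using (ℕ; zero; suc)
open import Data.Fin using (Fin; zero; suc)
open import Data.Vec using (Vec; []; _∷_; lookup)
open import Data.Product using (Σ; _×_)
open import Data.Sum using (_⊎_)
import Data.Empty.Polymorphic as Empty
import Data.Unit.Polymorphic as Unit
open import Relation.Binary.PropositionalEquality using (_≡_)

private
  variable
    ℓ : Level
    m n k : ℕ

------------------------------------------------------------------------
-- The logic BS4 over the language {∈ , =}

infix  20 _∈_ _≐_
infix  18 ∼_
infixr 15 _∧_
infixr 14 _∨_
infixr 12 _⟶_
infix  11 _⟷_
infix  5  ∀ᶠ_ ∃ᶠ_

-- De Bruijn indices: Formula n has its free variables among v₀ , … , vₙ₋₁,
-- and v₀ is the most recently bound one.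
data Formula (n : ℕ) : Set where
  _∈_ _≐_           : Fin n → Fin n → Formula n
  ⊥ᶠ                : Formula n
  ∼_                : Formula n → Formula n
  _∧_ _∨_ _⟶_ _⟷_ : Formula n → Formula n → Formula n
  ∀ᶠ_ ∃ᶠ_           : Formula (suc n) → Formula n

Sentence : Set
Sentence = Formula 0

pattern v₀ = zero
pattern v₁ = suc v₀
pattern v₂ = suc v₁

↑₂ : Fin n → Fin (suc (suc n))
↑₂ i = suc (suc i)

↑₃ : Fin n → Fin (suc (suc (suc n)))
↑₃ i = suc (↑₂ i)

record Model (ℓ : Level) : Set (lsuc ℓ) where
  infix 4 _∈⁺_ _∈⁻_ _=⁻_
  field
    Carrier   : Set ℓ
    inhabited : Carrier
    _∈⁺_ _∈⁻_ : Carrier → Carrier → Set ℓ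
    _=⁻_      : Carrier → Carrier → Set ℓ
    =⁻-sym    : ∀ {a b} → a =⁻ b → b =⁻ a

-- T 𝔐 φ ρ : "φ is true in 𝔐 under ρ";  F 𝔐 φ ρ : "φ is false in 𝔐 under ρ".
-- The interpretation =⁺ of equality is identity _≡_ on the domain.
module _ (𝔐 : Model ℓ) where
  open Model 𝔐

  mutual
    T : Formula n → Vec Carrier n → Set ℓ
    T (x ∈ y)   ρ = lookup ρ x ∈⁺ lookup ρ y
    T (x ≐ y)   ρ = lookup ρ x ≡ lookup ρ y
    T ⊥ᶠ        ρ = Empty.⊥
    T (∼ φ)     ρ = F φ ρ
    T (φ ∧ ψ)   ρ = T φ ρ × T ψ ρ
    T (φ ∨ ψ)   ρ = T φ ρ ⊎ T ψ ρ
    T (φ ⟶ ψ)  ρ = T φ ρ → T ψ ρ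
    T (φ ⟷ ψ)  ρ = (T φ ρ → T ψ ρ) × (T ψ ρ → T φ ρ)
    T (∀ᶠ φ)    ρ = (a : Carrier) → T φ (a ∷ ρ)
    T (∃ᶠ φ)    ρ = Σ Carrier λ a → T φ (a ∷ ρ)

    F : Formula n → Vec Carrier n → Set ℓ
    F (x ∈ y)   ρ = lookup ρ x ∈⁻ lookup ρ y
    F (x ≐ y)   ρ = lookup ρ x =⁻ lookup ρ y
    F ⊥ᶠ        ρ = Unit.⊤
    F (∼ φ)     ρ = T φ ρ
    F (φ ∧ ψ)   ρ = F φ ρ ⊎ F ψ ρ
    F (φ ∨ ψ)   ρ = F φ ρ × F ψ ρ
    F (φ ⟶ ψ)  ρ = T φ ρ × F ψ ρ
    F (φ ⟷ ψ)  ρ = (T φ ρ × F ψ ρ) ⊎ (F φ ρ × T ψ ρ)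
    F (∀ᶠ φ)    ρ = Σ Carrier λ a → F φ (a ∷ ρ)
    F (∃ᶠ φ)    ρ = (a : Carrier) → F φ (a ∷ ρ)

Theory : Set₁
Theory = Sentence → Set

infix 2 _⊨[_]_

-- The level ℓ bounds the size of the models quantified over.
_⊨[_]_ : Theory → (ℓ : Level) → Sentence → Set (lsuc ℓ)
Γ ⊨[ ℓ ] φ =
  (𝔐 : Model ℓ) → (∀ ψ → Γ ψ → T 𝔐 ψ []) → T 𝔐 φ []

------------------------------------------------------------------------
-- Defined connectives

infix  18 ¬ᶠ_ !ᶠ_ ?ᶠ_ ∘ᶠ_
infixr 15 _&_
infixr 12 _⟹_
infix  11 _⟺_

¬ᶠ_ !ᶠ_ ?ᶠ_ ∘ᶠ_ : Formula n → Formula n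
¬ᶠ φ = φ ⟶ ⊥ᶠ
!ᶠ φ = ∼ ¬ᶠ φ
?ᶠ φ = ¬ᶠ ∼ φ
∘ᶠ φ = !ᶠ φ ⟷ ?ᶠ φ

_⟹_ _⟺_ _&_ : Formula n → Formula n → Formula n
φ ⟹ ψ = (φ ⟶ ψ) ∧ (∼ ψ ⟶ ∼ φ)
φ ⟺ ψ = (φ ⟷ ψ) ∧ (∼ φ ⟷ ∼ ψ)
φ & ψ = ∼ (φ ⟶ ∼ ψ)

------------------------------------------------------------------------
-- Renaming and universal closure

lift : (Fin m → Fin n) → Fin (suc m) → Fin (suc n)
lift r zero    = zero
lift r (suc i) = suc (r i)

ren : (Fin m → Fin n) → Formula m → Formula n
ren r (x ∈ y)  = r x ∈ r y
ren r (x ≐ y)  = r x ≐ r y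
ren r ⊥ᶠ       = ⊥ᶠ
ren r (∼ φ)    = ∼ ren r φ
ren r (φ ∧ ψ)  = ren r φ ∧ ren r ψ
ren r (φ ∨ ψ)  = ren r φ ∨ ren r ψ
ren r (φ ⟶ ψ) = ren r φ ⟶ ren r ψ
ren r (φ ⟷ ψ) = ren r φ ⟷ ren r ψ
ren r (∀ᶠ φ)   = ∀ᶠ ren (lift r) φ
ren r (∃ᶠ φ)   = ∃ᶠ ren (lift r) φ

close : Formula n → Sentence
close {zero}  φ = φ
close {suc n} φ = close (∀ᶠ φ)

------------------------------------------------------------------------
-- Class abstracts

-- An inhabitant φ of Class n is the abstract {x : φ(x)}, where x is v₀.
Class : ℕ → Set
Class n = Formula (suc n)

wk : Class n → Class (suc n)
wk = ren (lift suc)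

infix 20 _≗_

-- X = {x : φ(x)}
_≗_ : Fin n → Class n → Formula n
X ≗ φ = ∀ᶠ (v₀ ∈ suc X ⟺ φ)

IsSet : Class n → Formula n
IsSet φ = ∃ᶠ (v₀ ≗ wk φ)

Relation : Set
Relation = ∀ {n} → Fin n → Fin n → Formula n

infix 19 _⟨_⟩_

-- A relation between sets, applied to two abstracts.  When both abstracts are
-- sets, this has the truth value (true and false alike) that R takes at them.
_⟨_⟩_ : Class n → Relation → Class n → Formula n
φ ⟨ R ⟩ ψ = ∃ᶠ (v₀ ≗ wk φ & (∃ᶠ (v₀ ≗ wk (wk ψ) & R v₁ v₀)))

------------------------------------------------------------------------
-- Sets

infix 20 _⊆_
infix 21 _^! _^? _𝐛 _𝐭 _𝐧

_⊆_ : Relation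
A ⊆ B = ∀ᶠ (v₀ ∈ suc A ⟹ v₀ ∈ suc B)

Classical : Fin n → Formula n
Classical A = ∀ᶠ ∘ᶠ (v₀ ∈ suc A)

∅ : Class n
∅ = ⊥ᶠ

NonEmpty : Fin n → Formula n
NonEmpty A = ∃ᶠ v₀ ∈ suc A

_^! _^? _𝐛 _𝐭 _𝐧 rlm : Fin n → Class n
A ^!  = !ᶠ (v₀ ∈ suc A)
A ^?  = ?ᶠ (v₀ ∈ suc A)
A 𝐛   = (A ^!) ∧ ∼ (A ^?)
A 𝐭   = (A ^!) ∧ (A ^?)
A 𝐧   = (A ^?) ∧ ∼ (A ^!)
rlm A = (A ^!) ∨ (A ^?)

_∩_ : Fin n → Fin n → Class n
A ∩ B = v₀ ∈ suc A ∧ v₀ ∈ suc B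

-- The classical set with elements a and b.  The "!" is needed: by extensionality
-- x ≠ a is not true as soon as x! ⊆ a? and a! ⊆ x?, so {x : x = a} is not a set.
Pair : Fin n → Fin n → Class n
Pair a b = !ᶠ (v₀ ≐ suc a) ∨ !ᶠ (v₀ ≐ suc b)

------------------------------------------------------------------------
-- Ordered pairs and functions

-- w = {{x} , ∅}
Tag₀ : Fin n → Fin n → Formula n
Tag₀ w x = ∃ᶠ (v₀ ≗ Pair (suc x) (suc x) &
           (∃ᶠ (v₀ ≗ ∅ & ↑₂ w ≗ Pair v₁ v₀)))

-- w = {{x}}
Tag₁ : Fin n → Fin n → Formula n
Tag₁ w x = ∃ᶠ (v₀ ≗ Pair (suc x) (suc x) & suc w ≗ Pair v₀ v₀)

-- The ordered pair (a , b) is the tagged union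
--   {{{x} , ∅} : x ∈ a} ∪ {{{x}} : x ∈ b},
-- for which (a , b) = (c , d) ⇔ (a = c ∧ b = d) also as regards falsity.
-- Pairs built from {a} and {b} would be unequal as soon as a and c are distinct,
-- although a ≠ c need not be true then.
OrdPair : Fin n → Fin n → Class n
OrdPair a b = (∃ᶠ (Tag₀ v₁ v₀ & v₀ ∈ ↑₂ a)) ∨ (∃ᶠ (Tag₁ v₁ v₀ & v₀ ∈ ↑₂ b))

infix 20 ⟪_,_⟫∈_

-- (a , b) ∈ f
⟪_,_⟫∈_ : Fin n → Fin n → Fin n → Formula n
⟪ a , b ⟫∈ f = ∃ᶠ (v₀ ≗ OrdPair (suc a) (suc b) & v₀ ∈ suc f)

ClassicalFunction : Fin n → Formula n
ClassicalFunction f =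
  Classical f
  ∧ (∀ᶠ (v₀ ∈ suc f ⟶ (∃ᶠ ∃ᶠ v₂ ≗ OrdPair v₁ v₀)))
  ∧ (∀ᶠ ∀ᶠ ∀ᶠ (⟪ v₂ , v₁ ⟫∈ ↑₃ f ∧ ⟪ v₂ , v₀ ⟫∈ ↑₃ f ⟶ !ᶠ (v₁ ≐ v₀)))

Injection : Fin n → Formula n
Injection f =
  ClassicalFunction f
  ∧ (∀ᶠ ∀ᶠ ∀ᶠ (⟪ v₂ , v₀ ⟫∈ ↑₃ f ∧ ⟪ v₁ , v₀ ⟫∈ ↑₃ f ⟶ !ᶠ (v₂ ≐ v₁)))

dom : Fin n → Class n
dom f = ∃ᶠ ⟪ v₁ , v₀ ⟫∈ ↑₂ f

infix 21 _[_]

-- {y : ∃x (y = f(x) & x ∈ A)}; the value of "&" depends on the truth of its left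
-- argument only, so y = f(x) may be read as (x , y) ∈ f.
_[_] : Fin n → Fin n → Class n
f [ A ] = ∃ᶠ (⟪ v₀ , v₁ ⟫∈ ↑₂ f & v₀ ∈ ↑₂ A)

Counting : Fin n → Fin n → Formula n
Counting f A = Injection f ∧ (dom f ⟨ _≐_ ⟩ rlm A)

infix 20 _≅_ _≼_

-- v₁ and v₀ are the countings f of A and g of B.
_≅_ _≼_ : Relation
A ≅ B = ∃ᶠ (Counting v₀ (suc A) & (∃ᶠ (Counting v₀ (↑₂ B) &
          (v₁ [ ↑₂ A ] ⟨ _≐_ ⟩ v₀ [ ↑₂ B ]))))
A ≼ B = ∃ᶠ (Counting v₀ (suc A) & (∃ᶠ (Counting v₀ (↑₂ B) &
          (v₁ [ ↑₂ A ] ⟨ _⊆_ ⟩ v₀ [ ↑₂ B ]))))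

------------------------------------------------------------------------
-- The theory BZFC

-- φ(x , y , p₀ , p₁ , …), where r locates the parameters pᵢ in the new context.
_at_,_above_ : Formula (suc (suc k)) → (x y : Fin n) → (Fin k → Fin n) → Formula n
_at_,_above_ {k} {n} φ x y r = ren s φ
  where
  s : Fin (suc (suc k)) → Fin n
  s zero          = x
  s (suc zero)    = y
  s (suc (suc i)) = r i

-- In both schemes φ may have the set A among its parameters p₀ , p₁ , ….
data BZFC : Theory where

  extensionality : BZFC
    (∀ᶠ ∀ᶠ (v₁ ≐ v₀ ⟺ (∀ᶠ (v₀ ∈ v₂ ⟺ v₀ ∈ v₁))))

  -- φ(x , A , p₁ , …)
  comprehension : (φ : Class (suc k)) → BZFC
    (close (∀ᶠ IsSet (v₀ ∈ v₁ ∧ φ)))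

  classicalSuperset : BZFC
    (∀ᶠ ∃ᶠ (Classical v₀ ∧ v₁ ⊆ v₀))

  pairing : BZFC
    (∀ᶠ ∀ᶠ IsSet (Pair v₁ v₀))

  union : BZFC
    (∀ᶠ IsSet (∃ᶠ (v₁ ∈ v₀ ∧ v₀ ∈ v₂)))

  -- {x : x ⊆ A} without "!" would be a proper class, for the reason given at Pair.
  powerSet : BZFC
    (∀ᶠ IsSet (!ᶠ (v₀ ⊆ v₁)))

  -- φ(x , y , A , p₁ , …), single-valued in y for x ∈ A
  replacement : (φ : Formula (suc (suc (suc k)))) → BZFC
    (close (∀ᶠ
      (Classical v₀
       ∧ (∀ᶠ (v₀ ∈ v₁ ⟶ (∀ᶠ ∀ᶠ
           ((φ at v₂ , v₁ above ↑₃) ∧ (φ at v₂ , v₀ above ↑₃)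
             ⟶ !ᶠ (v₁ ≐ v₀)))))
       ⟶ IsSet (∃ᶠ (v₀ ∈ v₂ & !ᶠ (φ at v₀ , v₁ above ↑₂))))))

  infinity : BZFC
    (∃ᶠ ((∃ᶠ (v₀ ≗ ∅ & v₀ ∈ v₁))
         ∧ (∀ᶠ (v₀ ∈ v₁ ⟶ (∃ᶠ (v₀ ≗ (v₀ ∈ v₂ ∨ !ᶠ (v₀ ≐ v₂)) & v₀ ∈ v₂))))))

  foundation : BZFC
    (∀ᶠ (Classical v₀ ∧ NonEmpty v₀
         ⟶ (∃ᶠ (v₀ ∈ v₁ ∧ ((v₀ ∩ v₁) ⟨ _≐_ ⟩ ∅)))))

  choice : BZFC
    (∀ᶠ (Classical v₀ ∧ (∀ᶠ (v₀ ∈ v₁ ⟶ NonEmpty v₀))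
         ⟶ (∃ᶠ (ClassicalFunction v₀ ∧ v₁ ≗ dom v₀
                ∧ (∀ᶠ (v₀ ∈ v₂ ⟶ (∃ᶠ (⟪ v₁ , v₀ ⟫∈ v₂ ∧ v₀ ∈ v₁))))))))

  acla : BZFC
    ((∃ᶠ ∼ (v₀ ^! ⟨ _⊆_ ⟩ v₀ ^?)) ∧ (∃ᶠ ∼ (v₀ ^? ⟨ _⊆_ ⟩ v₀ ^!)))

module Submission where

-- Countings f of A and g of B matter only through the partial matching x ~ y iff
-- f(x) = g(y) between rlm(A) and rlm(B), and every partial matching arises in this
-- way.  This turns each of the four claims into one about matchings between the parts
-- of the classical sets rlm(A) and rlm(B).  The implications from cardinal inequalities
-- to matchings rest on three facts about classical sets X, Y: one of X, Y embeds into
-- the other; if X embeds into Y, then Y = X + Z for some Z; and either X + X embeds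
-- into X, or A + X ≤ B + X implies A ≤ B.  For the last, split off from X a maximal
-- disjoint family of copies of (ℕ , suc), which doubles into itself; if there is no
-- such copy in X, following an injection A + X → B + X until it leaves X embeds A
-- into B.  For the failure of A ≅ B, two injections are joined to one matching as in
-- the Cantor–Bernstein theorem.

open import Level using (Level; _⊔_; lower) renaming (suc to lsuc)
open import Data.Nat using (ℕ; zero; suc; _+_)
open import Data.Fin using (Fin; zero; suc; _↑ˡ_; _↑ʳ_)
open import Data.Vec using (Vec; []; _∷_; _++_; lookup; map)
open import Data.Vec.Properties using (lookup-++ˡ; lookup-++ʳ)
open import Data.Product using (Σ; _×_; _,_; proj₁; proj₂; swap)
open import Data.Sum using (_⊎_; inj₁; inj₂)
open import Data.Empty using (⊥; ⊥-elim)
open import Data.Unit.Polymorphic using (tt)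
open import Relation.Nullary using (¬_; yes; no)
open import Relation.Binary.PropositionalEquality using (_≡_; refl; sym; trans; cong; subst)
open import Axiom.ExcludedMiddle using (ExcludedMiddle)
open import Axiom.DoubleNegationElimination using (em⇒dne)

-- Comprehension is a first-order scheme, so a set, a relation or an induction hypothesis cannot
-- come from an arbitrary predicate of the metatheory: each needs a formula. Hence the cardinal
-- arithmetic is developed over the formulas `Fm`, which one translation carries into BS4. It also
-- proceeds without recursion: inductive sets are least fixed points, maximality arguments are about
-- cliques, and ℕ occurs only as a ray.
--
-- The obstacle in claim 1 is that the four embeddings need not be compatible with each other.
-- Points of the parts t, b, n of A may be matched only into t, into t or b, into t or n of B,
-- respectively. The four inequalities amount to Hall's conditions for this problem; turning them
-- into a matching would be subtraction, which infinite sets do not allow. In claim 4 a point of the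
-- b-part of A can be matched only into the n-part of B, since a partner in B! would in turn need
-- its partner in A?.
--
-- Falsity of `≼` and `≅` quantifies over all countings, so the negative claims are also proved as
-- criteria for the existence of a matching, and then negated.

infix 1 _⇔_

_⇔_ : ∀ {a b} → Set a → Set b → Set (a ⊔ b)
A ⇔ B = (A → B) × (B → A)

⇔-refl : ∀ {a} {A : Set a} → A ⇔ A
⇔-refl = (λ p → p) , (λ p → p)

⇔-sym : ∀ {a b} {A : Set a} {B : Set b} → A ⇔ B → B ⇔ A
⇔-sym = swap

⇔-trans : ∀ {a b c} {A : Set a} {B : Set b} {C : Set c} → A ⇔ B → B ⇔ C → A ⇔ C
⇔-trans (f , f′) (g , g′) = (λ a → g (f a)) , (λ c → f′ (g′ c))

_⇔-×_ : ∀ {a b c d} {A : Set a} {B : Set b} {C : Set c} {D : Set d} → A ⇔ B → C ⇔ D → (A × C) ⇔ (B × D)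
(f , f′) ⇔-× (g , g′) = (λ (a , c) → f a , g c) , (λ (b , d) → f′ b , g′ d)

_⇔-⊎_ : ∀ {a b c d} {A : Set a} {B : Set b} {C : Set c} {D : Set d} → A ⇔ B → C ⇔ D → (A ⊎ C) ⇔ (B ⊎ D)
(f , f′) ⇔-⊎ (g , g′) =
  (λ { (inj₁ a) → inj₁ (f a) ; (inj₂ c) → inj₂ (g c) }) , (λ { (inj₁ b) → inj₁ (f′ b) ; (inj₂ d) → inj₂ (g′ d) })

_⇔-→_ : ∀ {a b c d} {A : Set a} {B : Set b} {C : Set c} {D : Set d} → A ⇔ B → C ⇔ D → (A → C) ⇔ (B → D)
(f , f′) ⇔-→ (g , g′) = (λ h b → g (h (f′ b))) , (λ h a → g′ (h (f a)))

⇔-¬ : ∀ {a b} {A : Set a} {B : Set b} → A ⇔ B → (¬ A) ⇔ (¬ B)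
⇔-¬ e = e ⇔-→ ⇔-refl

⇔-cong : ∀ {a b c} {A : Set a} {B : Set b} {C : Set c} → B ⇔ C → (A ⇔ B) ⇔ (A ⇔ C)
⇔-cong e = (λ f → ⇔-trans f e) , λ f → ⇔-trans f (⇔-sym e)

⇔-Π : ∀ {a b c} {A : Set a} {B : A → Set b} {C : A → Set c} → (∀ x → B x ⇔ C x) → (∀ x → B x) ⇔ (∀ x → C x)
⇔-Π e = (λ h x → proj₁ (e x) (h x)) , (λ h x → proj₂ (e x) (h x))

⇔-Σ : ∀ {a b c} {A : Set a} {B : A → Set b} {C : A → Set c} → (∀ x → B x ⇔ C x) → Σ A B ⇔ Σ A C
⇔-Σ e = (λ (x , b) → x , proj₁ (e x) b) , (λ (x , c) → x , proj₂ (e x) c)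

-- Classical sets: a two-valued language and its axioms

record Structure (ℓ : Level) : Set (lsuc ℓ) where
  infix 4 _ε_
  field
    V    : Set ℓ
    _ε_  : V → V → Set ℓ
    Cla  : V → Set ℓ
    pair : V → V → V

  infix 4 _⊂_ _[_,_]

  _⊂_ : V → V → Set ℓ
  A ⊂ B = ∀ x → x ε A → x ε B

  _[_,_] : V → V → V → Set ℓ
  R [ x , y ] = pair x y ε R

module Language {ℓ : Level} (𝒮 : Structure ℓ) where
  open Structure 𝒮

  infix  30 #_
  infix  20 _ε′_ _≡′_ _≡⟨_,_⟩′ _[_,_]′ Cla′
  infix  18 ¬′_
  infixr 15 _∧′_
  infixr 14 _∨′_
  infixr 12 _⇒′_
  infix  11 _⇔′_
  infix  5  ∀′_ ∃′_

  data Tm (n : ℕ) : Set ℓ where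
    var : Fin n → Tm n
    #_  : V → Tm n

  pattern x₀ = var zero
  pattern x₁ = var (suc zero)
  pattern x₂ = var (suc (suc zero))
  pattern x₃ = var (suc (suc (suc zero)))
  pattern x₄ = var (suc (suc (suc (suc zero))))
  pattern x₅ = var (suc (suc (suc (suc (suc zero)))))

  -- Formulas about the classical sets of a model of BZFC.  They are two-valued, name
  -- elements of V directly instead of by parameters, and are translated into BS4 below.
  -- φ ⟨ is ⟩′ is an explicit substitution of variables, so that φ can be reused
  -- in a larger context and its interpretation still computes to that of φ.
  data Fm : ℕ → Set ℓ where
    _ε′_ _≡′_       : ∀ {n} → Tm n → Tm n → Fm n
    _≡⟨_,_⟩′ _[_,_]′ : ∀ {n} → Tm n → Tm n → Tm n → Fm n
    Cla′            : ∀ {n} → Tm n → Fm n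
    ¬′_             : ∀ {n} → Fm n → Fm n
    _∧′_ _∨′_ _⇒′_  : ∀ {n} → Fm n → Fm n → Fm n
    ∀′_ ∃′_         : ∀ {n} → Fm (suc n) → Fm n
    _⟨_⟩′           : ∀ {m n} → Fm m → Vec (Fin n) m → Fm n

  _⇔′_ : ∀ {n} → Fm n → Fm n → Fm n
  φ ⇔′ ψ = (φ ⇒′ ψ) ∧′ (ψ ⇒′ φ)

  value : ∀ {n} → Vec V n → Tm n → V
  value ρ (var i) = lookup ρ i
  value ρ (# c)   = c

  ⟦_⟧ : ∀ {n} → Fm n → Vec V n → Set ℓ
  ⟦ s ε′ t ⟧         ρ = value ρ s ε value ρ t
  ⟦ s ≡′ t ⟧         ρ = value ρ s ≡ value ρ t
  ⟦ s ≡⟨ t , u ⟩′ ⟧  ρ = value ρ s ≡ pair (value ρ t) (value ρ u)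
  ⟦ s [ t , u ]′ ⟧   ρ = value ρ s [ value ρ t , value ρ u ]
  ⟦ Cla′ s ⟧         ρ = Cla (value ρ s)
  ⟦ ¬′ φ ⟧           ρ = ¬ ⟦ φ ⟧ ρ
  ⟦ φ ∧′ ψ ⟧         ρ = ⟦ φ ⟧ ρ × ⟦ ψ ⟧ ρ
  ⟦ φ ∨′ ψ ⟧         ρ = ⟦ φ ⟧ ρ ⊎ ⟦ ψ ⟧ ρ
  ⟦ φ ⇒′ ψ ⟧         ρ = ⟦ φ ⟧ ρ → ⟦ ψ ⟧ ρ
  ⟦ ∀′ φ ⟧           ρ = ∀ a → ⟦ φ ⟧ (a ∷ ρ)
  ⟦ ∃′ φ ⟧           ρ = Σ V λ a → ⟦ φ ⟧ (a ∷ ρ)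
  ⟦ φ ⟨ is ⟩′ ⟧      ρ = ⟦ φ ⟧ (map (lookup ρ) is)

-- Quantifiers in `φ` range over all of `V`, so the elements of classical sets stay arbitrary. `ext`
-- is confined to classical sets because equality of other sets also compares where membership is
-- false. `relation` is separation inside a product, which keeps products themselves out of the
-- interface.
record ZFC {ℓ : Level} (𝒮 : Structure ℓ) : Set (lsuc ℓ) where
  open Structure 𝒮
  open Language 𝒮
  field
    em             : ExcludedMiddle ℓ
    ext            : ∀ {A B} → Cla A → Cla B → (∀ x → x ε A ⇔ x ε B) → A ≡ B
    pair-injective : ∀ {a b c d} → pair a b ≡ pair c d → a ≡ c × b ≡ d
    separation     : ∀ A (φ : Fm 1) → Σ V λ B → Cla B × (∀ x → x ε B ⇔ (x ε A × ⟦ φ ⟧ (x ∷ [])))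
    relation       : ∀ A B (φ : Fm 2) → Σ V λ R → Cla R × (∀ p → p ε R → Σ V λ x → Σ V λ y → p ≡ pair x y)
                       × (∀ x y → R [ x , y ] ⇔ (x ε A × y ε B × ⟦ φ ⟧ (x ∷ y ∷ [])))
    empty          : Σ V λ A → ∀ x → ¬ x ε A
    unordered      : ∀ a b → Σ V λ A → ∀ x → x ε A ⇔ (x ≡ a ⊎ x ≡ b)
    cup            : ∀ A B → Σ V λ C → ∀ x → x ε C ⇔ (x ε A ⊎ x ε B)
    power          : ∀ A → Σ V λ P → ∀ x → x ε P ⇔ (Cla x × x ⊂ A)
    choice         : ∀ A → Cla A → (∀ x → x ε A → Σ V λ y → y ε x) →
                       Σ V λ c → (∀ x → x ε A → Σ V λ y → c [ x , y ] × y ε x)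
                               × (∀ x y y′ → c [ x , y ] → c [ x , y′ ] → y ≡ y′)

-- Matchings, injections and disjoint sums

module SetTheory {ℓ : Level} (𝒮 : Structure ℓ) (zfc : ZFC 𝒮) where
  open Structure 𝒮
  open Language 𝒮
  open ZFC zfc

  byContradiction : {P : Set ℓ} → ¬ ¬ P → P
  byContradiction = em⇒dne em

  sep : V → Fm 1 → V
  sep A φ = proj₁ (separation A φ)

  sep-Cla : ∀ {A φ} → Cla (sep A φ)
  sep-Cla {A} {φ} = proj₁ (proj₂ (separation A φ))

  sep⁺ : ∀ {A φ x} → x ε A → ⟦ φ ⟧ (x ∷ []) → x ε sep A φ
  sep⁺ {A} {φ} {x} a p = proj₂ (proj₂ (proj₂ (separation A φ)) x) (a , p)

  sep⁻ : ∀ {A φ x} → x ε sep A φ → x ε A × ⟦ φ ⟧ (x ∷ [])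
  sep⁻ {A} {φ} {x} = proj₁ (proj₂ (proj₂ (separation A φ)) x)

  rel : V → V → Fm 2 → V
  rel A B φ = proj₁ (relation A B φ)

  rel-Cla : ∀ {A B φ} → Cla (rel A B φ)
  rel-Cla {A} {B} {φ} = proj₁ (proj₂ (relation A B φ))

  rel-pair : ∀ {A B φ p} → p ε rel A B φ → Σ V λ x → Σ V λ y → p ≡ pair x y
  rel-pair {A} {B} {φ} {p} = proj₁ (proj₂ (proj₂ (relation A B φ))) p

  rel⁺ : ∀ {A B φ x y} → x ε A → y ε B → ⟦ φ ⟧ (x ∷ y ∷ []) → rel A B φ [ x , y ]
  rel⁺ {A} {B} {φ} {x} {y} a b p = proj₂ (proj₂ (proj₂ (proj₂ (relation A B φ))) x y) (a , b , p)

  rel⁻ : ∀ {A B φ x y} → rel A B φ [ x , y ] → x ε A × y ε B × ⟦ φ ⟧ (x ∷ y ∷ [])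
  rel⁻ {A} {B} {φ} {x} {y} = proj₁ (proj₂ (proj₂ (proj₂ (relation A B φ))) x y)

  ⊤′ : ∀ {n} → Fm (suc n)
  ⊤′ = x₀ ≡′ x₀

  _⊗_ : V → V → V
  A ⊗ B = rel A B ⊤′

  𝒫 : V → V
  𝒫 A = proj₁ (power A)

  𝒫⁺ : ∀ {A x} → Cla x → x ⊂ A → x ε 𝒫 A
  𝒫⁺ {A} {x} c s = proj₂ (proj₂ (power A) x) (c , s)

  𝒫⁻ : ∀ {A x} → x ε 𝒫 A → Cla x × x ⊂ A
  𝒫⁻ {A} {x} = proj₁ (proj₂ (power A) x)

  record Matching (A B : V) : Set ℓ where
    field
      graph      : V
      source     : ∀ {x y} → graph [ x , y ] → x ε A
      target     : ∀ {x y} → graph [ x , y ] → y ε B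
      functional : ∀ {x y y′} → graph [ x , y ] → graph [ x , y′ ] → y ≡ y′
      injective  : ∀ {x x′ y} → graph [ x , y ] → graph [ x′ , y ] → x ≡ x′

  infix 4 _↣_
  record _↣_ (A B : V) : Set ℓ where
    field
      matching : Matching A B
    open Matching matching public
    field
      total : ∀ {x} → x ε A → Σ V λ y → graph [ x , y ]

  open _↣_ using (graph; source; target; functional; injective; total)

  matchingBy : ∀ {A B} (φ : Fm 2) →
    (∀ {x y y′} → x ε A → y ε B → y′ ε B → ⟦ φ ⟧ (x ∷ y ∷ []) → ⟦ φ ⟧ (x ∷ y′ ∷ []) → y ≡ y′) →
    (∀ {x x′ y} → x ε A → x′ ε A → y ε B → ⟦ φ ⟧ (x ∷ y ∷ []) → ⟦ φ ⟧ (x′ ∷ y ∷ []) → x ≡ x′) →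
    Matching A B
  matchingBy {A} {B} φ fun inj = record
    { graph      = rel A B φ
    ; source     = λ r → proj₁ (rel⁻ r)
    ; target     = λ r → proj₁ (proj₂ (rel⁻ r))
    ; functional = λ r r′ → let (a , b , p) = rel⁻ r ; (_ , b′ , p′) = rel⁻ r′ in fun a b b′ p p′
    ; injective  = λ r r′ → let (a , b , p) = rel⁻ r ; (a′ , _ , p′) = rel⁻ r′ in inj a a′ b p p′
    }

  injectionBy : ∀ {A B} (φ : Fm 2) →
    (∀ {x} → x ε A → Σ V λ y → y ε B × ⟦ φ ⟧ (x ∷ y ∷ [])) →
    (∀ {x y y′} → x ε A → y ε B → y′ ε B → ⟦ φ ⟧ (x ∷ y ∷ []) → ⟦ φ ⟧ (x ∷ y′ ∷ []) → y ≡ y′) →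
    (∀ {x x′ y} → x ε A → x′ ε A → y ε B → ⟦ φ ⟧ (x ∷ y ∷ []) → ⟦ φ ⟧ (x′ ∷ y ∷ []) → x ≡ x′) →
    A ↣ B
  injectionBy φ tot fun inj = record
    { matching = matchingBy φ fun inj
    ; total    = λ a → let (y , b , p) = tot a in y , rel⁺ a b p
    }

  abstract
    inclusion : ∀ {A B} → A ⊂ B → A ↣ B
    inclusion A⊂B = injectionBy (x₀ ≡′ x₁)
      (λ {x} a → x , A⊂B x a , refl)
      (λ _ _ _ p q → trans (sym p) q)
      (λ _ _ _ p q → trans p (sym q))

    inclusion⁺ : ∀ {A B x} (A⊂B : A ⊂ B) → x ε A → graph (inclusion A⊂B) [ x , x ]
    inclusion⁺ A⊂B a = rel⁺ a (A⊂B _ a) refl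

    inclusion⁻ : ∀ {A B x y} (A⊂B : A ⊂ B) → graph (inclusion A⊂B) [ x , y ] → x ≡ y
    inclusion⁻ A⊂B p = proj₂ (proj₂ (rel⁻ p))

  ↣-refl : ∀ {A} → A ↣ A
  ↣-refl = inclusion λ _ a → a

  infixr 9 _∘↣_
  abstract
    _∘↣_ : ∀ {A B C} → B ↣ C → A ↣ B → A ↣ C
    g ∘↣ f = injectionBy (∃′ (# graph f [ x₁ , x₀ ]′ ∧′ # graph g [ x₀ , x₂ ]′))
      (λ a → let (y , p) = total f a ; (z , q) = total g (target f p) in z , target g q , y , p , q)
      (λ { _ _ _ (y , p , q) (y′ , p′ , q′) → functional g q (subst (λ w → graph g [ w , _ ]) (functional f p′ p) q′) })
      (λ { _ _ _ (y , p , q) (y′ , p′ , q′) → injective f p (subst (λ w → graph f [ _ , w ]) (injective g q′ q) p′) })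

    ∘-graph⁻ : ∀ {A B C} (g : B ↣ C) (f : A ↣ B) {x z} →
      graph (g ∘↣ f) [ x , z ] → Σ V λ y → graph f [ x , y ] × graph g [ y , z ]
    ∘-graph⁻ g f r = proj₂ (proj₂ (rel⁻ r))

  o i : V
  o = proj₁ empty
  i = proj₁ (unordered o o)

  o≢i : ¬ o ≡ i
  o≢i o≡i = proj₂ empty o (subst (o ε_) (sym o≡i) (proj₂ (proj₂ (unordered o o) o) (inj₁ refl)))

  tags : V
  tags = proj₁ (unordered o i)

  _∪_ : V → V → V
  A ∪ B = proj₁ (cup A B)

  ∪⁺ˡ : ∀ {A B x} → x ε A → x ε A ∪ B
  ∪⁺ˡ {A} {B} {x} a = proj₂ (proj₂ (cup A B) x) (inj₁ a)

  ∪⁺ʳ : ∀ {A B x} → x ε B → x ε A ∪ B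
  ∪⁺ʳ {A} {B} {x} b = proj₂ (proj₂ (cup A B) x) (inj₂ b)

  ∪⁻ : ∀ {A B x} → x ε A ∪ B → x ε A ⊎ x ε B
  ∪⁻ {A} {B} {x} = proj₁ (proj₂ (cup A B) x)

  inl inr : V → V
  inl = pair o
  inr = pair i

  inl≢inr : ∀ {x y} → ¬ inl x ≡ inr y
  inl≢inr e = o≢i (proj₁ (pair-injective e))

  -- Both A ∪ B and the formula mention A and B, so transparent nested sums would
  -- unfold to terms of exponential size.
  infixr 6 _⊕_
  abstract
    _⊕_ : V → V → V
    A ⊕ B = rel tags (A ∪ B) ((x₀ ≡′ # o ∧′ x₁ ε′ # A) ∨′ (x₀ ≡′ # i ∧′ x₁ ε′ # B))

    inl∈ : ∀ {A B x} → x ε A → inl x ε A ⊕ B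
    inl∈ a = rel⁺ (proj₂ (proj₂ (unordered o i) o) (inj₁ refl)) (∪⁺ˡ a) (inj₁ (refl , a))

    inr∈ : ∀ {A B x} → x ε B → inr x ε A ⊕ B
    inr∈ b = rel⁺ (proj₂ (proj₂ (unordered o i) i) (inj₂ refl)) (∪⁺ʳ b) (inj₂ (refl , b))

    ⊕⁻ : ∀ {A B z} → z ε A ⊕ B → (Σ V λ x → x ε A × z ≡ inl x) ⊎ (Σ V λ y → y ε B × z ≡ inr y)
    ⊕⁻ z∈ with rel-pair z∈
    ... | t , x , refl with proj₂ (proj₂ (rel⁻ z∈))
    ...   | inj₁ (refl , a) = inj₁ (x , a , refl)
    ...   | inj₂ (refl , b) = inj₂ (x , b , refl)

  inl-injective : ∀ {x y} → inl x ≡ inl y → x ≡ y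
  inl-injective e = proj₂ (pair-injective e)

  inr-injective : ∀ {x y} → inr x ≡ inr y → x ≡ y
  inr-injective e = proj₂ (pair-injective e)

  abstract
    ι₁ : ∀ {A B} → A ↣ A ⊕ B
    ι₁ = injectionBy (x₁ ≡⟨ # o , x₀ ⟩′)
      (λ {x} a → inl x , inl∈ a , refl)
      (λ _ _ _ p q → trans p (sym q))
      (λ _ _ _ p q → inl-injective (trans (sym p) q))

    ι₂ : ∀ {A B} → B ↣ A ⊕ B
    ι₂ = injectionBy (x₁ ≡⟨ # i , x₀ ⟩′)
      (λ {x} a → inr x , inr∈ a , refl)
      (λ _ _ _ p q → trans p (sym q))
      (λ _ _ _ p q → inr-injective (trans (sym p) q))

    ι₁⁻ : ∀ {A B x z} → graph (ι₁ {A} {B}) [ x , z ] → z ≡ inl x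
    ι₁⁻ p = proj₂ (proj₂ (rel⁻ p))

    ι₂⁻ : ∀ {A B x z} → graph (ι₂ {A} {B}) [ x , z ] → z ≡ inr x
    ι₂⁻ p = proj₂ (proj₂ (rel⁻ p))

  Disjoint : ∀ {A B C D} → A ↣ C → B ↣ D → Set ℓ
  Disjoint f g = ∀ {x y z} → graph f [ x , z ] → graph g [ y , z ] → ⊥

  abstract
    copair : ∀ {A B C} (f : A ↣ C) (g : B ↣ C) → Disjoint f g → A ⊕ B ↣ C
    copair {A} {B} {C} f g dis = injectionBy
      (∃′ ((x₁ ≡⟨ # o , x₀ ⟩′ ∧′ # graph f [ x₀ , x₂ ]′) ∨′ (x₁ ≡⟨ # i , x₀ ⟩′ ∧′ # graph g [ x₀ , x₂ ]′)))
      tot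
      (λ _ _ _ → fun)
      (λ _ _ _ → inj)
      where
      P : V → V → Set ℓ
      P z c = Σ V λ x → (z ≡ inl x × graph f [ x , c ]) ⊎ (z ≡ inr x × graph g [ x , c ])
      tot : ∀ {z} → z ε A ⊕ B → Σ V λ c → c ε C × P z c
      tot z∈ with ⊕⁻ z∈
      ... | inj₁ (x , a , e) = let (c , p) = total f a in c , target f p , x , inj₁ (e , p)
      ... | inj₂ (x , b , e) = let (c , p) = total g b in c , target g p , x , inj₂ (e , p)
      fun : ∀ {z c c′} → P z c → P z c′ → c ≡ c′
      fun (x , inj₁ (refl , p)) (y , inj₁ (e , q)) with inl-injective e
      ... | refl = functional f p q
      fun (x , inj₁ (refl , p)) (y , inj₂ (e , q)) = ⊥-elim (inl≢inr e)
      fun (x , inj₂ (refl , p)) (y , inj₁ (e , q)) = ⊥-elim (inl≢inr (sym e))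
      fun (x , inj₂ (refl , p)) (y , inj₂ (e , q)) with inr-injective e
      ... | refl = functional g p q
      inj : ∀ {z z′ c} → P z c → P z′ c → z ≡ z′
      inj (x , inj₁ (refl , p)) (y , inj₁ (refl , q)) = cong inl (injective f p q)
      inj (x , inj₁ (refl , p)) (y , inj₂ (refl , q)) = ⊥-elim (dis p q)
      inj (x , inj₂ (refl , p)) (y , inj₁ (refl , q)) = ⊥-elim (dis q p)
      inj (x , inj₂ (refl , p)) (y , inj₂ (refl , q)) = cong inr (injective g p q)

    copair⁻ : ∀ {A B C} (f : A ↣ C) (g : B ↣ C) (d : Disjoint f g) {z c} → graph (copair f g d) [ z , c ] →
      (Σ V λ x → z ≡ inl x × graph f [ x , c ]) ⊎ (Σ V λ x → z ≡ inr x × graph g [ x , c ])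
    copair⁻ f g d p with proj₂ (proj₂ (rel⁻ p))
    ... | x , inj₁ q = inj₁ (x , q)
    ... | x , inj₂ q = inj₂ (x , q)

    copair-disjoint : ∀ {A B C D E} (f : A ↣ C) (g : B ↣ C) (d : Disjoint f g) (h : E ↣ D) →
      Disjoint f h → Disjoint g h → Disjoint (copair f g d) h
    copair-disjoint f g d h df dg p q with proj₂ (proj₂ (rel⁻ p))
    ... | _ , inj₁ (_ , p′) = df p′ q
    ... | _ , inj₂ (_ , p′) = dg p′ q

  ι₁-ι₂ : ∀ {A B C D E F} (f : A ↣ C) (g : B ↣ D) (j₁ : C ↣ E) (j₂ : D ↣ F) →
    Disjoint j₁ j₂ → Disjoint (j₁ ∘↣ f) (j₂ ∘↣ g)
  ι₁-ι₂ f g j₁ j₂ d p q = d (proj₂ (proj₂ (∘-graph⁻ j₁ f p))) (proj₂ (proj₂ (∘-graph⁻ j₂ g q)))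

  ι-disjoint : ∀ {A B} → Disjoint (ι₁ {A} {B}) (ι₂ {A} {B})
  ι-disjoint p q = inl≢inr (trans (sym (ι₁⁻ p)) (ι₂⁻ q))

-- Least fixed points and induction

module Induction {ℓ : Level} (𝒮 : Structure ℓ) (zfc : ZFC 𝒮) where
  open Structure 𝒮
  open Language 𝒮
  open SetTheory 𝒮 zfc

  -- The least fixed point is the intersection of all closed sets `Q`, where `Q` ranges over all of
  -- `V`; monotonicity makes this intersection closed itself.
  module Least (A : V) (Φ : Fm 2)
    (mono : ∀ {Q Q′ x} → Q ⊂ Q′ → ⟦ Φ ⟧ (x ∷ Q ∷ []) → ⟦ Φ ⟧ (x ∷ Q′ ∷ [])) where

    μ : V
    μ = sep A (∀′ ((∀′ (x₀ ε′ # A ⇒′ Φ ⟨ zero ∷ suc zero ∷ [] ⟩′ ⇒′ x₀ ε′ x₁)) ⇒′ x₁ ε′ x₀))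

    least : ∀ {Q} → (∀ y → y ε A → ⟦ Φ ⟧ (y ∷ Q ∷ []) → y ε Q) → μ ⊂ Q
    least {Q} closed x x∈ = proj₂ (sep⁻ x∈) Q closed

    μ-fold : ∀ {x} → x ε A → ⟦ Φ ⟧ (x ∷ μ ∷ []) → x ε μ
    μ-fold a p = sep⁺ a λ Q closed → closed _ a (mono (least closed) p)

    -- The property is a formula because `least` is applied to the set of elements that have it.
    -- Since `Q` may be assumed to lie inside `μ`, facts already known about members of `μ` are
    -- available in the step.
    μ-ind : (φ : Fm 1) →
      (∀ {Q x} → Q ⊂ μ → (∀ {y} → y ε Q → ⟦ φ ⟧ (y ∷ [])) → x ε A → ⟦ Φ ⟧ (x ∷ Q ∷ []) → ⟦ φ ⟧ (x ∷ [])) →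
      ∀ {x} → x ε μ → ⟦ φ ⟧ (x ∷ [])
    μ-ind φ step x∈ = proj₂ (sep⁻ (least {sep μ φ}
      (λ y a p → sep⁺ (μ-fold a (mono (λ _ q → proj₁ (sep⁻ q)) p))
                      (step (λ _ q → proj₁ (sep⁻ q)) (λ q → proj₂ (sep⁻ q)) a p)) _ x∈))

  module LeastRelation (A B : V) (Φ : Fm 3)
    (mono : ∀ {Q Q′ x y} → (∀ x y → Q [ x , y ] → Q′ [ x , y ]) →
      ⟦ Φ ⟧ (x ∷ y ∷ Q ∷ []) → ⟦ Φ ⟧ (x ∷ y ∷ Q′ ∷ [])) where

    μ : V
    μ = rel A B (∀′ ((∀′ ∀′ (x₁ ε′ # A ⇒′ x₀ ε′ # B ⇒′ Φ ⟨ suc zero ∷ zero ∷ suc (suc zero) ∷ [] ⟩′ ⇒′ x₂ [ x₁ , x₀ ]′))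
                     ⇒′ x₀ [ x₁ , x₂ ]′))

    least : ∀ {Q} → (∀ x y → x ε A → y ε B → ⟦ Φ ⟧ (x ∷ y ∷ Q ∷ []) → Q [ x , y ]) →
      ∀ x y → μ [ x , y ] → Q [ x , y ]
    least {Q} closed x y r = proj₂ (proj₂ (rel⁻ r)) Q closed

    μ-fold : ∀ {x y} → x ε A → y ε B → ⟦ Φ ⟧ (x ∷ y ∷ μ ∷ []) → μ [ x , y ]
    μ-fold a b p = rel⁺ a b λ Q closed → closed _ _ a b (mono (least closed) p)

    μ-ind : (φ : Fm 2) →
      (∀ {Q x y} → (∀ x y → Q [ x , y ] → μ [ x , y ]) → (∀ {x y} → Q [ x , y ] → ⟦ φ ⟧ (x ∷ y ∷ [])) →
        x ε A → y ε B → ⟦ Φ ⟧ (x ∷ y ∷ Q ∷ []) → ⟦ φ ⟧ (x ∷ y ∷ [])) →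
      ∀ {x y} → μ [ x , y ] → ⟦ φ ⟧ (x ∷ y ∷ [])
    μ-ind φ step r = proj₂ (proj₂ (proj₂ (rel⁻ (least {Q} closed _ _ r))))
      where
      Q : V
      Q = rel A B (# μ [ x₀ , x₁ ]′ ∧′ φ)
      Q⊂μ : ∀ x y → Q [ x , y ] → μ [ x , y ]
      Q⊂μ _ _ q = proj₁ (proj₂ (proj₂ (rel⁻ q)))
      closed : ∀ x y → x ε A → y ε B → ⟦ Φ ⟧ (x ∷ y ∷ Q ∷ []) → Q [ x , y ]
      closed x y a b p = rel⁺ a b (μ-fold a b (mono Q⊂μ p) , step Q⊂μ (λ q → proj₂ (proj₂ (proj₂ (rel⁻ q)))) a b p)

    μ-unfold : ∀ {x y} → μ [ x , y ] → ⟦ Φ ⟧ (x ∷ y ∷ μ ∷ [])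
    -- Substitution replaces variables by variables only, so the constant `μ` is passed to `Φ`
    -- through a quantified variable equal to it.
    μ-unfold r with μ-ind (∃′ (x₀ ≡′ # μ ∧′ Φ ⟨ suc zero ∷ suc (suc zero) ∷ zero ∷ [] ⟩′))
                          (λ Q⊂μ _ _ _ p → μ , refl , mono Q⊂μ p) r
    ... | _ , refl , p = p

-- Choice, maximal cliques and comparability

module Maximality {ℓ : Level} (𝒮 : Structure ℓ) (zfc : ZFC 𝒮) where
  open Structure 𝒮
  open Language 𝒮
  open ZFC zfc
  open SetTheory 𝒮 zfc
  open Induction 𝒮 zfc
  open _↣_ using (graph; source; target; functional; injective; total)

  abstract
    -- Choice is applied once, to all inhabited classical subsets of `B`, and `g` evaluates the
    -- choice function at the fibre of `x`. The fibre is not a term of `Fm`, so the formula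
    -- quantifies over a classical set with the same elements; `ext` makes that set unique.
    uniformization : ∀ A B R → (∀ {x y} → R [ x , y ] → x ε A × y ε B) →
      Σ V λ g → (∀ {x y} → g [ x , y ] → R [ x , y ])
              × (∀ {x y y′} → g [ x , y ] → g [ x , y′ ] → y ≡ y′)
              × (∀ {x y} → R [ x , y ] → Σ V λ y′ → g [ x , y′ ])
    uniformization A B R R⊂ = g , (λ p → sub (proj₂ (proj₂ (rel⁻ p)))) , fun , tot
      where
      𝒱 : V
      𝒱 = sep (𝒫 B) (∃′ (x₀ ε′ x₁))
      chosen : Σ V λ c → (∀ x → x ε 𝒱 → Σ V λ y → c [ x , y ] × y ε x)
                       × (∀ x y y′ → c [ x , y ] → c [ x , y′ ] → y ≡ y′)
      chosen = choice 𝒱 sep-Cla (λ _ v → proj₂ (sep⁻ v))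
      c : V
      c = proj₁ chosen
      fibre : V → V
      fibre x = sep B (# R [ # x , x₀ ]′)
      fibre∈ : ∀ {x y} → R [ x , y ] → fibre x ε 𝒱
      fibre∈ r = sep⁺ (𝒫⁺ sep-Cla (λ _ p → proj₁ (sep⁻ p))) (_ , sep⁺ (proj₂ (R⊂ r)) r)
      g : V
      g = rel A B (∃′ (Cla′ x₀ ∧′ (∀′ (x₀ ε′ x₁ ⇔′ # R [ x₂ , x₀ ]′)) ∧′ (∃′ (x₀ ε′ x₁)) ∧′ # c [ x₀ , x₂ ]′))
      P : V → V → Set ℓ
      P x y = Σ V λ v → Cla v × (∀ z → z ε v ⇔ R [ x , z ]) × (Σ V λ z → z ε v) × c [ v , y ]
      sub : ∀ {x y} → P x y → R [ x , y ]
      sub {x} {y} (v , cla , v≗ , (z , z∈) , p) with proj₁ (proj₂ chosen) v v∈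
        where
        v∈ : v ε 𝒱
        v∈ = sep⁺ (𝒫⁺ cla (λ w w∈ → proj₂ (R⊂ (proj₁ (v≗ w) w∈)))) (z , z∈)
      ... | y′ , p′ , y′∈ with proj₂ (proj₂ chosen) v y y′ p p′
      ...   | refl = proj₁ (v≗ y) y′∈
      fun : ∀ {x y y′} → g [ x , y ] → g [ x , y′ ] → y ≡ y′
      fun q q′ with proj₂ (proj₂ (rel⁻ q)) | proj₂ (proj₂ (rel⁻ q′))
      ... | v , cla , v≗ , _ , p | v′ , cla′ , v′≗ , _ , p′
        with ext cla cla′ (λ z → (λ m → proj₂ (v′≗ z) (proj₁ (v≗ z) m)) , (λ m → proj₂ (v≗ z) (proj₁ (v′≗ z) m)))
      ...   | refl = proj₂ (proj₂ chosen) v _ _ p p′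
      tot : ∀ {x y} → R [ x , y ] → Σ V λ y′ → g [ x , y′ ]
      tot {x} {y} r with proj₁ (proj₂ chosen) (fibre x) (fibre∈ r)
      ... | y′ , p , y′∈ = y′ , rel⁺ (proj₁ (R⊂ r)) (proj₁ (sep⁻ y′∈))
        (fibre x , sep-Cla , (λ z → (λ m → proj₂ (sep⁻ m)) , (λ m → sep⁺ (proj₂ (R⊂ m)) m)) , (y′ , y′∈) , p)

  -- The argument of Bourbaki and Witt: the family 𝒯 generated by the greedy
  -- extension step and by unions is a chain, so its union is a maximal clique.
  module Clique (U K : V) (K-sym : ∀ {x y} → K [ x , y ] → K [ y , x ]) where

    private
      -- The clique condition includes equal points and `K` need not be reflexive; hence the last
      -- conjunct.
      Candidate : Fm 2
      Candidate = (¬′ (x₁ ε′ x₀)) ∧′ (∀′ (x₀ ε′ x₁ ⇒′ # K [ x₂ , x₀ ]′)) ∧′ # K [ x₁ , x₁ ]′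

      greedy : Σ V λ g → (∀ {x y} → g [ x , y ] → rel (𝒫 U) U Candidate [ x , y ])
            × (∀ {x y y′} → g [ x , y ] → g [ x , y′ ] → y ≡ y′)
            × (∀ {x y} → rel (𝒫 U) U Candidate [ x , y ] → Σ V λ y′ → g [ x , y′ ])
      greedy = uniformization (𝒫 U) U (rel (𝒫 U) U Candidate)
        (λ r → proj₁ (rel⁻ r) , proj₁ (proj₂ (rel⁻ r)))

      g : V
      g = proj₁ greedy

      g-candidate : ∀ {S u} → g [ S , u ] → u ε U × ⟦ Candidate ⟧ (S ∷ u ∷ [])
      g-candidate p = proj₂ (rel⁻ (proj₁ (proj₂ greedy) p))

      g-functional : ∀ {S u u′} → g [ S , u ] → g [ S , u′ ] → u ≡ u′
      g-functional = proj₁ (proj₂ (proj₂ greedy))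

      -- When no point can be added, `g` has no value and the first clause returns `S` itself, so
      -- the greedy step is defined everywhere.
      Φ : Fm 2
      Φ = (∃′ (x₀ ε′ x₂ ∧′ (∀′ (x₀ ε′ x₂ ⇔′ (x₀ ε′ x₁ ∨′ # g [ x₁ , x₀ ]′)))))
        ∨′ (∃′ ((∀′ (x₀ ε′ x₁ ⇒′ x₀ ε′ x₃)) ∧′ (∀′ (x₀ ε′ x₂ ⇔′ (∃′ (x₀ ε′ x₂ ∧′ x₁ ε′ x₀))))))

      Φ-mono : ∀ {Q Q′ x} → Q ⊂ Q′ → ⟦ Φ ⟧ (x ∷ Q ∷ []) → ⟦ Φ ⟧ (x ∷ Q′ ∷ [])
      Φ-mono Q⊂Q′ (inj₁ (S , S∈ , e)) = inj₁ (S , Q⊂Q′ S S∈ , e)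
      Φ-mono Q⊂Q′ (inj₂ (q , q⊂ , e)) = inj₂ (q , (λ S S∈ → Q⊂Q′ S (q⊂ S S∈)) , e)

      open Least (𝒫 U) Φ Φ-mono renaming (μ to 𝒯)

      𝒯-Cla : ∀ {S} → S ε 𝒯 → Cla S
      𝒯-Cla S∈ = proj₁ (𝒫⁻ (proj₁ (sep⁻ S∈)))

      𝒯-⊂ : ∀ {S} → S ε 𝒯 → S ⊂ U
      𝒯-⊂ S∈ = proj₂ (𝒫⁻ (proj₁ (sep⁻ S∈)))

      next : V → V
      next S = sep U (x₀ ε′ # S ∨′ # g [ # S , x₀ ]′)

      next⁺ : ∀ {S x} → S ε 𝒯 → x ε S ⊎ g [ S , x ] → x ε next S
      next⁺ S∈ (inj₁ p) = sep⁺ (𝒯-⊂ S∈ _ p) (inj₁ p)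
      next⁺ S∈ (inj₂ p) = sep⁺ (proj₁ (g-candidate p)) (inj₂ p)

      next∈ : ∀ {S} → S ε 𝒯 → next S ε 𝒯
      next∈ {S} S∈ = μ-fold (𝒫⁺ sep-Cla (λ _ p → proj₁ (sep⁻ p)))
        (inj₁ (S , S∈ , λ x → (λ p → proj₂ (sep⁻ p)) , next⁺ S∈))

      IsComparable : V → Set ℓ
      IsComparable C = ∀ S → S ε 𝒯 → S ⊂ C ⊎ C ⊂ S

      ⊂-antisym : ∀ {S S′} → S ε 𝒯 → S′ ε 𝒯 → S ⊂ S′ → S′ ⊂ S → S ≡ S′
      ⊂-antisym S∈ S′∈ p q = ext (𝒯-Cla S∈) (𝒯-Cla S′∈) (λ x → p x , q x)

      Below : V → V → Set ℓ
      Below C S = S ⊂ C ⊎ next C ⊂ S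

      -- No member of `𝒯` lies strictly between `C` and `next C`, because these differ by at most
      -- one point.
      below : ∀ {C} → C ε 𝒯 → IsComparable C → ∀ {S} → S ε 𝒯 → Below C S
      below {C} C∈ cmp = μ-ind
        ((∀′ (x₀ ε′ x₁ ⇒′ x₀ ε′ # C)) ∨′ (∀′ (x₀ ε′ # next C ⇒′ x₀ ε′ x₁))) step
        where
        step : ∀ {Q S} → Q ⊂ 𝒯 → (∀ {S} → S ε Q → Below C S) → S ε 𝒫 U → ⟦ Φ ⟧ (S ∷ Q ∷ []) → Below C S
        step {Q} {S} Q⊂ ih S∈P φ@(inj₁ (S₀ , S₀∈ , e)) with ih S₀∈
        ... | inj₂ nC⊂ = inj₂ λ x p → proj₂ (e x) (inj₁ (nC⊂ x p))
        ... | inj₁ S₀⊂C with em {C ⊂ S₀}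
        ...   | yes C⊂S₀ with ⊂-antisym (Q⊂ _ S₀∈) C∈ S₀⊂C C⊂S₀
        ...     | refl = inj₂ λ x p → proj₂ (e x) (proj₂ (sep⁻ p))
        step {Q} {S} Q⊂ ih S∈P φ@(inj₁ (S₀ , S₀∈ , e)) | inj₁ S₀⊂C | no C⊄S₀
          with cmp S (μ-fold S∈P (Φ-mono Q⊂ φ))
        ...     | inj₁ S⊂C = inj₁ S⊂C
        ...     | inj₂ C⊂S = inj₁ S⊂C
          where
          S⊂C : S ⊂ C
          S⊂C x x∈S with proj₁ (e x) x∈S
          ... | inj₁ x∈S₀ = S₀⊂C x x∈S₀
          -- `S` adds a single point to `S₀`. If `C ⊂ S` missed that point, all of `C` would lie in
          -- `S₀`.
          ... | inj₂ gx = byContradiction λ x∉C → C⊄S₀ λ c c∈C → new x∉C c c∈C (proj₁ (e c) (C⊂S c c∈C))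
            where
            new : ¬ x ε C → ∀ c → c ε C → c ε S₀ ⊎ g [ S₀ , c ] → c ε S₀
            new x∉C c c∈C (inj₁ p) = p
            new x∉C c c∈C (inj₂ gc) = ⊥-elim (x∉C (subst (_ε C) (g-functional gc gx) c∈C))
        step {Q} {S} Q⊂ ih S∈P (inj₂ (q , q⊂ , e)) with em {Σ V λ S₀ → S₀ ε q × next C ⊂ S₀}
        ... | yes (S₀ , S₀∈ , nC⊂) = inj₂ λ x p → proj₂ (e x) (S₀ , S₀∈ , nC⊂ x p)
        ... | no none = inj₁ λ x p → let (S₀ , S₀∈ , x∈) = proj₁ (e x) p in small S₀ S₀∈ x x∈
          where
          small : ∀ S₀ → S₀ ε q → S₀ ⊂ C
          small S₀ S₀∈ with ih (q⊂ S₀ S₀∈)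
          ... | inj₁ p = p
          ... | inj₂ p = ⊥-elim (none (S₀ , S₀∈ , p))

      chain : ∀ {C} → C ε 𝒯 → IsComparable C
      chain = μ-ind (∀′ (x₀ ε′ # 𝒯 ⇒′ ((∀′ (x₀ ε′ x₁ ⇒′ x₀ ε′ x₂)) ∨′ (∀′ (x₀ ε′ x₂ ⇒′ x₀ ε′ x₁))))) step
        where
        step : ∀ {Q C} → Q ⊂ 𝒯 → (∀ {C} → C ε Q → IsComparable C) → C ε 𝒫 U → ⟦ Φ ⟧ (C ∷ Q ∷ []) → IsComparable C
        step Q⊂ ih _ (inj₁ (C₀ , C₀∈ , e)) S S∈ with below (Q⊂ _ C₀∈) (ih C₀∈) S∈
        ... | inj₁ S⊂C₀ = inj₁ λ x p → proj₂ (e x) (inj₁ (S⊂C₀ x p))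
        ... | inj₂ nC₀⊂S = inj₂ λ x p → nC₀⊂S x (next⁺ (Q⊂ _ C₀∈) (proj₁ (e x) p))
        step Q⊂ ih _ (inj₂ (q , q⊂ , e)) S S∈ with em {Σ V λ C₀ → C₀ ε q × S ⊂ C₀}
        ... | yes (C₀ , C₀∈ , S⊂C₀) = inj₁ λ x p → proj₂ (e x) (C₀ , C₀∈ , S⊂C₀ x p)
        ... | no none = inj₂ λ x p → let (C₀ , C₀∈ , x∈) = proj₁ (e x) p in large C₀ C₀∈ x x∈
          where
          large : ∀ C₀ → C₀ ε q → C₀ ⊂ S
          large C₀ C₀∈ with ih (q⊂ C₀ C₀∈) S S∈
          ... | inj₁ p = ⊥-elim (none (C₀ , C₀∈ , p))
          ... | inj₂ p = p

      IsClique : V → Set ℓ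
      IsClique S = ∀ x y → x ε S → y ε S → K [ x , y ]

      cliques : ∀ {S} → S ε 𝒯 → IsClique S
      cliques = μ-ind (∀′ ∀′ (x₁ ε′ x₂ ⇒′ x₀ ε′ x₂ ⇒′ # K [ x₁ , x₀ ]′)) step
        where
        step : ∀ {Q S} → Q ⊂ 𝒯 → (∀ {S} → S ε Q → IsClique S) → S ε 𝒫 U → ⟦ Φ ⟧ (S ∷ Q ∷ []) → IsClique S
        step Q⊂ ih _ (inj₁ (S₀ , S₀∈ , e)) x y x∈ y∈ with proj₁ (e x) x∈ | proj₁ (e y) y∈
        ... | inj₁ p | inj₁ q = ih S₀∈ x y p q
        ... | inj₁ p | inj₂ q = K-sym (proj₁ (proj₂ (proj₂ (g-candidate q))) x p)
        ... | inj₂ p | inj₁ q = proj₁ (proj₂ (proj₂ (g-candidate p))) y q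
        ... | inj₂ p | inj₂ q with g-functional p q
        ...   | refl = proj₂ (proj₂ (proj₂ (g-candidate p)))
        step Q⊂ ih _ (inj₂ (q , q⊂ , e)) x y x∈ y∈ with proj₁ (e x) x∈ | proj₁ (e y) y∈
        ... | S , S∈ , p | S′ , S′∈ , p′ with chain (Q⊂ _ (q⊂ _ S∈)) S′ (Q⊂ _ (q⊂ _ S′∈))
        ...   | inj₁ S′⊂S = ih (q⊂ _ S∈) x y p (S′⊂S y p′)
        ...   | inj₂ S⊂S′ = ih (q⊂ _ S′∈) x y (S⊂S′ x p) p′

    ⋃𝒯 : V
    ⋃𝒯 = sep U (∃′ (x₀ ε′ # 𝒯 ∧′ x₁ ε′ x₀))

    private
      ⋃𝒯∈ : ⋃𝒯 ε 𝒯
      ⋃𝒯∈ = μ-fold (𝒫⁺ sep-Cla (λ _ p → proj₁ (sep⁻ p)))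
        (inj₂ (𝒯 , (λ _ p → p) , λ x → (λ p → proj₂ (sep⁻ p)) , λ { (S , S∈ , p) → sep⁺ (𝒯-⊂ S∈ x p) (S , S∈ , p) }))

    abstract
      maximalClique : Σ V λ S → S ⊂ U × (∀ x y → x ε S → y ε S → K [ x , y ])
        × (∀ {u} → u ε U → K [ u , u ] → (∀ x → x ε S → K [ u , x ]) → u ε S)
      -- The greedy step need not choose `u`, but some `v` is chosen. It lies in `next ⋃𝒯`, a member
      -- of `𝒯` and thus part of `⋃𝒯`, although a candidate lies outside.
      maximalClique = ⋃𝒯 , 𝒯-⊂ ⋃𝒯∈ , cliques ⋃𝒯∈ , λ {u} u∈ uu ux → byContradiction λ u∉ →
        let (v , gv) = proj₂ (proj₂ (proj₂ greedy)) (rel⁺ (proj₁ (sep⁻ ⋃𝒯∈)) u∈ (u∉ , ux , uu))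
        in proj₁ (proj₂ (g-candidate gv))
             (sep⁺ (proj₁ (g-candidate gv)) (next ⋃𝒯 , next∈ ⋃𝒯∈ , next⁺ ⋃𝒯∈ (inj₂ gv)))

  abstract
    inverse : ∀ {A B} (f : Matching A B) → (∀ {y} → y ε B → Σ V λ x → Matching.graph f [ x , y ]) → B ↣ A
    inverse f onto = injectionBy (# Matching.graph f [ x₁ , x₀ ]′)
      (λ b → let (x , p) = onto b in x , Matching.source f p , p)
      (λ _ _ _ → Matching.injective f)
      (λ _ _ _ → Matching.functional f)

    -- Partial injections are the cliques of `A ⊗ B` when two pairs are related iff they agree in
    -- both coordinates or in neither. A maximal one cannot miss both a point of `A` and a point of
    -- `B`, since the pair of the two could be added.
    comparability : ∀ A B → A ↣ B ⊎ B ↣ A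
    comparability A B = compare
      where
      K : V
      K = rel (A ⊗ B) (A ⊗ B) (∀′ ∀′ ∀′ ∀′ (x₄ ≡⟨ x₃ , x₂ ⟩′ ⇒′ x₅ ≡⟨ x₁ , x₀ ⟩′ ⇒′ (x₃ ≡′ x₁ ⇔′ x₂ ≡′ x₀)))
      K-sym : ∀ {p q} → K [ p , q ] → K [ q , p ]
      K-sym r = let (a , b , k) = rel⁻ r in
        rel⁺ b a λ x y x′ y′ e e′ → (λ d → sym (proj₁ (k x′ y′ x y e′ e) (sym d)))
                                   , (λ d → sym (proj₂ (k x′ y′ x y e′ e) (sym d)))
      open Clique (A ⊗ B) K K-sym
      S : V
      S = proj₁ maximalClique
      S⊂ : S ⊂ A ⊗ B
      S⊂ = proj₁ (proj₂ maximalClique)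
      compatible : ∀ {x y x′ y′} → S [ x , y ] → S [ x′ , y′ ] → x ≡ x′ ⇔ y ≡ y′
      compatible p q = proj₂ (proj₂ (rel⁻ (proj₁ (proj₂ (proj₂ maximalClique)) _ _ p q))) _ _ _ _ refl refl
      f : Matching A B
      f = record
        { graph      = S
        ; source     = λ p → proj₁ (rel⁻ (S⊂ _ p))
        ; target     = λ p → proj₁ (proj₂ (rel⁻ (S⊂ _ p)))
        ; functional = λ p q → proj₁ (compatible p q) refl
        ; injective  = λ p q → proj₂ (compatible p q) refl
        }
      compare : A ↣ B ⊎ B ↣ A
      compare with em {Σ V λ a → a ε A × ¬ Σ V λ b → S [ a , b ]}
      ... | no none = inj₁ (record { matching = f ; total = λ {x} a → byContradiction λ n → none (x , a , n) })
      ... | yes (a , a∈ , a-free) = inj₂ (inverse f λ {b} b∈ → byContradiction λ b-free → a-free (b , new b∈ b-free))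
        where
        new : ∀ {b} → b ε B → ¬ (Σ V λ x → S [ x , b ]) → S [ a , b ]
        new {b} b∈ b-free = proj₂ (proj₂ (proj₂ maximalClique)) ab∈
          (rel⁺ ab∈ ab∈ λ x y x′ y′ e e′ → let (p , q) = pair-injective (trans (sym e) e′) in (λ _ → q) , (λ _ → p))
          other
          where
          ab∈ : pair a b ε A ⊗ B
          ab∈ = rel⁺ a∈ b∈ refl
          other : ∀ p → p ε S → K [ pair a b , p ]
          other p p∈ with rel-pair (S⊂ p p∈)
          ... | u , v , refl = rel⁺ ab∈ (S⊂ _ p∈) λ x y x′ y′ e e′ → both (pair-injective e) (pair-injective e′)
            where
            both : ∀ {x y x′ y′} → a ≡ x × b ≡ y → u ≡ x′ × v ≡ y′ → x ≡ x′ ⇔ y ≡ y′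
            both (refl , refl) (refl , refl) =
              (λ { refl → ⊥-elim (a-free (_ , p∈)) }) , (λ { refl → ⊥-elim (b-free (_ , p∈)) })

-- Ray systems: idempotent versus cancellable sets

module Cancellation {ℓ : Level} (𝒮 : Structure ℓ) (zfc : ZFC 𝒮) where
  open Structure 𝒮
  open Language 𝒮
  open ZFC zfc
  open SetTheory 𝒮 zfc
  open Induction 𝒮 zfc
  open Maximality 𝒮 zfc
  open _↣_ using (graph; source; target; functional; injective; total)

  module _ {A B : V} (f : A ↣ B) where

    complement : V
    complement = sep B (¬′ (∃′ (# graph f [ x₀ , x₁ ]′)))

    abstract
      -- Together with `⊕-complement` this says that `B` is the sum of `A` and a rest. Two
      -- injections serve as well as a bijection, as the later estimates only compare by `↣`.
      complement-⊕ : A ⊕ complement ↣ B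
      complement-⊕ = copair f (inclusion λ _ p → proj₁ (sep⁻ p)) dis
        where
        dis : Disjoint f (inclusion {complement} {B} λ _ p → proj₁ (sep⁻ p))
        dis p q with inclusion⁻ (λ _ p → proj₁ (sep⁻ p)) q
        ... | refl = proj₂ (sep⁻ (source (inclusion _) q)) (_ , p)

      ⊕-complement : B ↣ A ⊕ complement
      ⊕-complement = injectionBy
        ((∃′ (x₂ ≡⟨ # o , x₀ ⟩′ ∧′ # graph f [ x₀ , x₁ ]′)) ∨′ (x₁ ≡⟨ # i , x₀ ⟩′ ∧′ x₀ ε′ # complement))
        tot (λ _ _ _ → fun) (λ _ _ _ → inj)
        where
        P : V → V → Set ℓ
        P y z = (Σ V λ x → z ≡ inl x × graph f [ x , y ]) ⊎ (z ≡ inr y × y ε complement)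
        tot : ∀ {y} → y ε B → Σ V λ z → z ε A ⊕ complement × P y z
        tot {y} y∈ with em {Σ V λ x → graph f [ x , y ]}
        ... | yes (x , p) = inl x , inl∈ (source f p) , inj₁ (x , refl , p)
        ... | no none = inr y , inr∈ (sep⁺ y∈ none) , inj₂ (refl , sep⁺ y∈ none)
        fun : ∀ {y z z′} → P y z → P y z′ → z ≡ z′
        fun (inj₁ (x , refl , p)) (inj₁ (x′ , refl , p′)) = cong inl (injective f p p′)
        fun (inj₁ (x , _ , p)) (inj₂ (_ , y∈)) = ⊥-elim (proj₂ (sep⁻ y∈) (x , p))
        fun (inj₂ (_ , y∈)) (inj₁ (x , _ , p)) = ⊥-elim (proj₂ (sep⁻ y∈) (x , p))
        fun (inj₂ (refl , _)) (inj₂ (refl , _)) = refl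
        inj : ∀ {y y′ z} → P y z → P y′ z → y ≡ y′
        inj (inj₁ (x , refl , p)) (inj₁ (x′ , e , p′)) with inl-injective e
        ... | refl = functional f p p′
        inj (inj₁ (x , refl , p)) (inj₂ (e , _)) = ⊥-elim (inl≢inr e)
        inj (inj₂ (refl , _)) (inj₁ (x , e , p)) = ⊥-elim (inl≢inr (sym e))
        inj (inj₂ (refl , _)) (inj₂ (e , _)) = inr-injective e

  infixr 6 _⊕↣_
  abstract
    _⊕↣_ : ∀ {A B C D} → A ↣ C → B ↣ D → A ⊕ B ↣ C ⊕ D
    f ⊕↣ g = copair (ι₁ ∘↣ f) (ι₂ ∘↣ g) (ι₁-ι₂ f g ι₁ ι₂ ι-disjoint)

  -- A ray system is an injection s of its field into itself whose field is
  -- generated by the points outside the range: a disjoint union of copies of (ℕ , suc).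
  RayForm : Fm 1
  RayForm = (∀′ ∀′ ∀′ (x₃ [ x₂ , x₁ ]′ ⇒′ x₃ [ x₂ , x₀ ]′ ⇒′ x₁ ≡′ x₀))
         ∧′ (∀′ ∀′ ∀′ (x₃ [ x₂ , x₀ ]′ ⇒′ x₃ [ x₁ , x₀ ]′ ⇒′ x₂ ≡′ x₁))
         ∧′ (∀′ ∀′ (x₂ [ x₁ , x₀ ]′ ⇒′ (∃′ x₃ [ x₁ , x₀ ]′)))
         ∧′ (∀′ ((∀′ ∀′ (x₃ [ x₁ , x₀ ]′ ⇒′ (¬′ (∃′ x₄ [ x₀ , x₂ ]′)) ⇒′ x₁ ε′ x₂))
              ⇒′ (∀′ ∀′ (x₃ [ x₁ , x₀ ]′ ⇒′ x₁ ε′ x₂ ⇒′ x₀ ε′ x₂))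
              ⇒′ (∀′ ∀′ (x₃ [ x₁ , x₀ ]′ ⇒′ x₁ ε′ x₂))))

  Root : V → V → Set ℓ
  Root s x = ¬ Σ V λ w → s [ w , x ]

  -- By `go` every end point is also a starting point, so an `x` with some `s [ x , y ]` is an
  -- arbitrary point of the field; `gen` is induction along the rays. `RayForm` says the same as a
  -- formula, so that ray systems can be separated from a power set.
  record RaySystem (s : V) : Set ℓ where
    field
      fun  : ∀ x y y′ → s [ x , y ] → s [ x , y′ ] → y ≡ y′
      inj  : ∀ x x′ y → s [ x , y ] → s [ x′ , y ] → x ≡ x′
      go   : ∀ x y → s [ x , y ] → Σ V λ z → s [ y , z ]
      gen  : ∀ Q → (∀ x y → s [ x , y ] → Root s x → x ε Q) →
             (∀ x y → s [ x , y ] → x ε Q → y ε Q) → ∀ x y → s [ x , y ] → x ε Q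

  ray⁺ : ∀ {s} → RaySystem s → ⟦ RayForm ⟧ (s ∷ [])
  ray⁺ r = fun , inj , go , gen
    where open RaySystem r

  ray⁻ : ∀ {s} → ⟦ RayForm ⟧ (s ∷ []) → RaySystem s
  ray⁻ (f , j , g , h) = record { fun = f ; inj = j ; go = g ; gen = h }

  support : V → V → V
  support X s = sep X (∃′ # s [ x₁ , x₀ ]′)

  -- n ↦ 2n and n ↦ 2n + 1 along every ray
  module Doubling {X s : V} (s⊂ : s ⊂ X ⊗ X) (rays : RaySystem s) where
    open RaySystem rays

    S : V
    S = support X s

    S∋ : ∀ {x y} → s [ x , y ] → x ε S
    S∋ p = sep⁺ (proj₁ (rel⁻ (s⊂ _ p))) (_ , p)

    private
      -- The recursion for doubling: a root is its own value, and the value at the successor of `a`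
      -- lies two steps beyond the value at `a`.
      Φ : Fm 3
      Φ = (x₀ ≡′ x₁ ∧′ (¬′ (∃′ # s [ x₀ , x₁ ]′)))
       ∨′ (∃′ ∃′ ∃′ (x₅ [ x₂ , x₁ ]′ ∧′ # s [ x₂ , x₃ ]′ ∧′ # s [ x₁ , x₀ ]′ ∧′ # s [ x₀ , x₄ ]′))

      Φ-mono : ∀ {Q Q′ x y} → (∀ x y → Q [ x , y ] → Q′ [ x , y ]) →
        ⟦ Φ ⟧ (x ∷ y ∷ Q ∷ []) → ⟦ Φ ⟧ (x ∷ y ∷ Q′ ∷ [])
      Φ-mono m (inj₁ p) = inj₁ p
      Φ-mono m (inj₂ (a , b , c , q , p)) = inj₂ (a , b , c , m _ _ q , p)

      open LeastRelation S S Φ Φ-mono renaming (μ to D)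

      D-functional : ∀ {x y} → D [ x , y ] → ∀ y′ → D [ x , y′ ] → y ≡ y′
      D-functional = μ-ind (∀′ (# D [ x₁ , x₀ ]′ ⇒′ x₂ ≡′ x₀)) step
        where
        step : ∀ {Q x y} → (∀ x y → Q [ x , y ] → D [ x , y ]) →
          (∀ {x y} → Q [ x , y ] → ∀ y′ → D [ x , y′ ] → y ≡ y′) →
          x ε S → y ε S → ⟦ Φ ⟧ (x ∷ y ∷ Q ∷ []) → ∀ y′ → D [ x , y′ ] → y ≡ y′
        step _ ih _ _ p y′ q with p | μ-unfold q
        ... | inj₁ (refl , _) | inj₁ (refl , _) = refl
        ... | inj₁ (_ , root) | inj₂ (_ , _ , _ , _ , r , _) = ⊥-elim (root (_ , r))
        ... | inj₂ (_ , _ , _ , _ , r , _) | inj₁ (_ , root) = ⊥-elim (root (_ , r))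
        ... | inj₂ (a , b , c , d , r , r₁ , r₂) | inj₂ (a′ , b′ , c′ , d′ , r′ , r₁′ , r₂′)
          with inj _ _ _ r r′
        ...   | refl with ih d _ d′
        ...     | refl with fun _ _ _ r₁ r₁′
        ...       | refl = fun _ _ _ r₂ r₂′

      D-injective : ∀ {x y} → D [ x , y ] → ∀ x′ → D [ x′ , y ] → x ≡ x′
      D-injective = μ-ind (∀′ (# D [ x₀ , x₂ ]′ ⇒′ x₁ ≡′ x₀)) step
        where
        step : ∀ {Q x y} → (∀ x y → Q [ x , y ] → D [ x , y ]) →
          (∀ {x y} → Q [ x , y ] → ∀ x′ → D [ x′ , y ] → x ≡ x′) →
          x ε S → y ε S → ⟦ Φ ⟧ (x ∷ y ∷ Q ∷ []) → ∀ x′ → D [ x′ , y ] → x ≡ x′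
        step _ ih _ _ p x′ q with p | μ-unfold q
        ... | inj₁ (refl , _) | inj₁ (refl , _) = refl
        ... | inj₁ (refl , root) | inj₂ (_ , _ , _ , _ , _ , _ , r) = ⊥-elim (root (_ , r))
        ... | inj₂ (_ , _ , _ , _ , _ , _ , r) | inj₁ (refl , root) = ⊥-elim (root (_ , r))
        ... | inj₂ (a , b , c , d , r , r₁ , r₂) | inj₂ (a′ , b′ , c′ , d′ , r′ , r₁′ , r₂′)
          with inj _ _ _ r₂ r₂′
        ...   | refl with inj _ _ _ r₁ r₁′
        ...     | refl with ih d _ d′
        ...       | refl = fun _ _ _ r r′

      -- Odd positions are not even, by descent: if `z` and its successor `y` were both values,
      -- going back two steps from each would give values in the same relation.
      D-even : ∀ {x y} → D [ x , y ] → ∀ x′ z → D [ x′ , z ] → ¬ s [ z , y ]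
      D-even = μ-ind (∀′ ∀′ (# D [ x₁ , x₀ ]′ ⇒′ ¬′ # s [ x₀ , x₃ ]′)) step
        where
        step : ∀ {Q x y} → (∀ x y → Q [ x , y ] → D [ x , y ]) →
          (∀ {x y} → Q [ x , y ] → ∀ x′ z → D [ x′ , z ] → ¬ s [ z , y ]) →
          x ε S → y ε S → ⟦ Φ ⟧ (x ∷ y ∷ Q ∷ []) → ∀ x′ z → D [ x′ , z ] → ¬ s [ z , y ]
        step _ ih _ _ (inj₁ (refl , root)) x′ z q sz = root (z , sz)
        step _ ih _ _ (inj₂ (a , b , c , d , r , r₁ , r₂)) x′ z q sz with inj _ _ _ r₂ sz | μ-unfold q
        ... | refl | inj₁ (refl , root) = root (_ , r₁)
        ... | refl | inj₂ (a′ , b′ , c′ , d′ , _ , r₁′ , r₂′) with inj _ _ _ r₁ r₂′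
        ...   | refl = ih d _ _ d′ r₁′

      D-total : ∀ {x} → x ε S → Σ V λ y → D [ x , y ]
      D-total {x} x∈ = proj₂ (sep⁻ {S} {∃′ # D [ x₁ , x₀ ]′} (gen _
        (λ x y p root → sep⁺ (S∋ p) (x , μ-fold (S∋ p) (S∋ p) (inj₁ (refl , root))))
        step x _ (proj₂ (proj₂ (sep⁻ x∈)))))
        where
        step : ∀ x y → s [ x , y ] → x ε sep S (∃′ # D [ x₁ , x₀ ]′) → y ε sep S (∃′ # D [ x₁ , x₀ ]′)
        step x y p x∈ =
          let (z , d) = proj₂ (sep⁻ x∈)
              (z₁ , p₁) = proj₂ (sep⁻ (proj₁ (proj₂ (rel⁻ d))))
              (z₂ , p₂) = go _ _ p₁
              (z₃ , p₃) = go _ _ p₂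
              (y₁ , q) = go _ _ p
          in sep⁺ (S∋ q) (z₂ , μ-fold (S∋ q) (S∋ p₃) (inj₂ (x , z , z₁ , d , p , p₁ , p₂)))

      even : S ↣ S
      even = record
        { matching = record
          { graph = D ; source = λ d → proj₁ (rel⁻ d) ; target = λ d → proj₁ (proj₂ (rel⁻ d))
          ; functional = λ d d′ → D-functional d _ d′ ; injective = λ d d′ → D-injective d _ d′ }
        ; total = D-total }

      shift : S ↣ S
      shift = record
        { matching = record
          { graph = s ; source = S∋ ; target = λ p → S∋ (proj₂ (go _ _ p))
          ; functional = fun _ _ _ ; injective = inj _ _ _ }
        ; total = λ x∈ → proj₂ (sep⁻ x∈) }

    abstract
      doubling : S ⊕ S ↣ S
      doubling = copair even (shift ∘↣ even) λ d p →
        let (z , d′ , q) = ∘-graph⁻ shift even p in D-even d _ z d′ q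

  NoRays : V → Set ℓ
  NoRays X = ∀ s → s ⊂ X ⊗ X → RaySystem s → ∀ {x y} → ¬ s [ x , y ]

  -- Its first use moves the rays of a maximal family into the part of `X` that the family misses.
  -- Its second, along the identity, replaces a ray system by a classical one.
  transport : ∀ {X Y s} → s ⊂ X ⊗ X → RaySystem s → (f : X ↣ Y) →
    Σ V λ t → Cla t × t ⊂ Y ⊗ Y × RaySystem t
            × (∀ {u v} → s [ u , v ] → Σ V λ x → Σ V λ y → t [ x , y ] × graph f [ u , x ])
  transport {X} {Y} {s} s⊂ rays f =
    t , rel-Cla , t⊂ , record { fun = t-fun ; inj = t-inj ; go = t-go ; gen = t-gen } , image
    where
    open RaySystem rays
    T : Fm 2
    T = ∃′ ∃′ (# s [ x₁ , x₀ ]′ ∧′ # graph f [ x₁ , x₂ ]′ ∧′ # graph f [ x₀ , x₃ ]′)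
    t : V
    t = rel Y Y T
    t⁻ : ∀ {x y} → t [ x , y ] → ⟦ T ⟧ (x ∷ y ∷ [])
    t⁻ p = proj₂ (proj₂ (rel⁻ p))
    t⁺ : ∀ {u v x y} → s [ u , v ] → graph f [ u , x ] → graph f [ v , y ] → t [ x , y ]
    t⁺ p a b = rel⁺ (target f a) (target f b) (_ , _ , p , a , b)
    t⊂ : t ⊂ Y ⊗ Y
    t⊂ p p∈ with rel-pair p∈
    ... | x , y , refl = rel⁺ (proj₁ (rel⁻ p∈)) (proj₁ (proj₂ (rel⁻ p∈))) refl
    image : ∀ {u v} → s [ u , v ] → Σ V λ x → Σ V λ y → t [ x , y ] × graph f [ u , x ]
    image p = let (x , a) = total f (proj₁ (rel⁻ (s⊂ _ p)))
                  (y , b) = total f (proj₁ (proj₂ (rel⁻ (s⊂ _ p))))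
              in x , y , t⁺ p a b , a
    t-fun : ∀ x y y′ → t [ x , y ] → t [ x , y′ ] → y ≡ y′
    t-fun x y y′ p p′ with t⁻ p | t⁻ p′
    ... | u , v , q , a , b | u′ , v′ , q′ , a′ , b′ with injective f a a′
    ...   | refl with fun _ _ _ q q′
    ...     | refl = functional f b b′
    t-inj : ∀ x x′ y → t [ x , y ] → t [ x′ , y ] → x ≡ x′
    t-inj x x′ y p p′ with t⁻ p | t⁻ p′
    ... | u , v , q , a , b | u′ , v′ , q′ , a′ , b′ with injective f b b′
    ...   | refl with inj _ _ _ q q′
    ...     | refl = functional f a a′
    t-go : ∀ x y → t [ x , y ] → Σ V λ z → t [ y , z ]
    t-go x y p with t⁻ p
    ... | u , v , q , a , b with go _ _ q
    ...   | w , q′ with image q′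
    ...     | y′ , z , r , b′ with functional f b b′
    ...       | refl = z , r
    t-gen : ∀ Q → (∀ x y → t [ x , y ] → Root t x → x ε Q) →
      (∀ x y → t [ x , y ] → x ε Q → y ε Q) → ∀ x y → t [ x , y ] → x ε Q
    t-gen Q roots closed x y p with t⁻ p
    ... | u , v , q , a , b
      with proj₂ (sep⁻ {X} {∃′ (# graph f [ x₁ , x₀ ]′ ∧′ x₀ ε′ # Q)} (gen _ roots′ closed′ u v q))
      where
      Q′ : V
      Q′ = sep X (∃′ (# graph f [ x₁ , x₀ ]′ ∧′ x₀ ε′ # Q))
      roots′ : ∀ u v → s [ u , v ] → Root s u → u ε Q′
      roots′ u v q root with image q
      ... | x , y , p , a = sep⁺ (source f a) (x , a , roots x y p root′)
        where
        root′ : Root t x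
        root′ (w , r) with t⁻ r
        ... | w′ , u′ , q′ , _ , a′ with injective f a a′
        ...   | refl = root (w′ , q′)
      closed′ : ∀ u v → s [ u , v ] → u ε Q′ → v ε Q′
      closed′ u v q u∈ with proj₂ (sep⁻ u∈) | total f (proj₁ (proj₂ (rel⁻ (s⊂ _ q))))
      ... | x , a , x∈ | y , b = sep⁺ (source f b) (y , b , closed x y (t⁺ q a b) x∈)
    ...   | x′ , a′ , x∈ with functional f a a′
    ...     | refl = x∈

  -- A maximal family of pairwise disjoint ray systems exhausts X up to a part F
  -- without rays; F embeds into the union of the family, as that union cannot
  -- embed into F.
  rays⇒idempotent : ∀ {X s x y} → s ⊂ X ⊗ X → Cla s → RaySystem s → s [ x , y ] → X ⊕ X ↣ X
  rays⇒idempotent {X} {s₀} s₀⊂ s₀-Cla rays₀ s₀xy = conclude (comparability S F)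
    where
    𝒰 K : V
    𝒰 = sep (𝒫 (X ⊗ X)) RayForm
    -- Distinct related systems share no starting point. As end points are starting points too,
    -- their fields are then disjoint.
    K = rel 𝒰 𝒰 ((x₀ ≡′ x₁) ∨′ (∀′ ∀′ ∀′ (x₃ [ x₂ , x₁ ]′ ⇒′ ¬′ x₄ [ x₂ , x₀ ]′)))
    K-sym : ∀ {s t} → K [ s , t ] → K [ t , s ]
    K-sym r with rel⁻ r
    ... | a , b , inj₁ e = rel⁺ b a (inj₁ (sym e))
    ... | a , b , inj₂ d = rel⁺ b a (inj₂ λ x y y′ p q → d x y′ y q p)
    open Clique 𝒰 K K-sym
    𝒞 : V
    𝒞 = proj₁ maximalClique
    𝒞-rays : ∀ {s} → s ε 𝒞 → RaySystem s
    𝒞-rays s∈ = ray⁻ (proj₂ (sep⁻ (proj₁ (proj₂ maximalClique) _ s∈)))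
    𝒞-⊂ : ∀ {s} → s ε 𝒞 → s ⊂ X ⊗ X
    𝒞-⊂ s∈ = proj₂ (𝒫⁻ (proj₁ (sep⁻ (proj₁ (proj₂ maximalClique) _ s∈))))
    same : ∀ {s t x y y′} → s ε 𝒞 → t ε 𝒞 → s [ x , y ] → t [ x , y′ ] → s ≡ t
    same s∈ t∈ p q with proj₂ (proj₂ (rel⁻ (proj₁ (proj₂ (proj₂ maximalClique)) _ _ s∈ t∈)))
    ... | inj₁ e = e
    ... | inj₂ d = ⊥-elim (d _ _ _ p q)
    maximal : ∀ {t} → Cla t → t ⊂ X ⊗ X → RaySystem t →
      (∀ s → s ε 𝒞 → ∀ x y y′ → t [ x , y ] → ¬ s [ x , y′ ]) → t ε 𝒞
    maximal c t⊂ rays d = proj₂ (proj₂ (proj₂ maximalClique)) t∈ (rel⁺ t∈ t∈ (inj₁ refl))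
      λ s s∈ → rel⁺ t∈ (proj₁ (proj₂ maximalClique) s s∈) (inj₂ (d s s∈))
      where
      t∈ : _ ε 𝒰
      t∈ = sep⁺ (𝒫⁺ c t⊂) (ray⁺ rays)
    u : V
    u = sep (X ⊗ X) (∃′ (x₀ ε′ # 𝒞 ∧′ x₁ ε′ x₀))
    u⊂ : u ⊂ X ⊗ X
    u⊂ p p∈ = proj₁ (sep⁻ p∈)
    u⁺ : ∀ {s x y} → s ε 𝒞 → s [ x , y ] → u [ x , y ]
    u⁺ s∈ p = sep⁺ (𝒞-⊂ s∈ _ p) (_ , s∈ , p)
    u⁻ : ∀ {x y} → u [ x , y ] → Σ V λ s → s ε 𝒞 × s [ x , y ]
    u⁻ p = proj₂ (sep⁻ p)
    u-rays : RaySystem u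
    u-rays = record { fun = u-fun ; inj = u-inj ; go = u-go ; gen = u-gen }
      where
      u-fun : ∀ x y y′ → u [ x , y ] → u [ x , y′ ] → y ≡ y′
      u-fun x y y′ p q with u⁻ p | u⁻ q
      ... | s , s∈ , p′ | t , t∈ , q′ with same s∈ t∈ p′ q′
      ...   | refl = RaySystem.fun (𝒞-rays s∈) _ _ _ p′ q′
      u-inj : ∀ x x′ y → u [ x , y ] → u [ x′ , y ] → x ≡ x′
      u-inj x x′ y p q with u⁻ p | u⁻ q
      ... | s , s∈ , p′ | t , t∈ , q′
        -- The two pairs share only their end `y`, and `same` compares starting points; by `go`, `y`
        -- starts a pair in either system.
        with same s∈ t∈ (proj₂ (RaySystem.go (𝒞-rays s∈) _ _ p′)) (proj₂ (RaySystem.go (𝒞-rays t∈) _ _ q′))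
      ...   | refl = RaySystem.inj (𝒞-rays s∈) _ _ _ p′ q′
      u-go : ∀ x y → u [ x , y ] → Σ V λ z → u [ y , z ]
      u-go x y p with u⁻ p
      ... | s , s∈ , p′ = let (z , q) = RaySystem.go (𝒞-rays s∈) _ _ p′ in z , u⁺ s∈ q
      u-gen : ∀ Q → (∀ x y → u [ x , y ] → Root u x → x ε Q) →
        (∀ x y → u [ x , y ] → x ε Q → y ε Q) → ∀ x y → u [ x , y ] → x ε Q
      u-gen Q roots closed x y p with u⁻ p
      ... | s , s∈ , p′ = RaySystem.gen (𝒞-rays s∈) Q roots′ (λ x y q → closed x y (u⁺ s∈ q)) x y p′
        where
        roots′ : ∀ x y → s [ x , y ] → Root s x → x ε Q
        roots′ x y q root = roots x y (u⁺ s∈ q) root′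
          where
          root′ : Root u x
          root′ (w , r) with u⁻ r
          ... | t , t∈ , r′ with same s∈ t∈ q (proj₂ (RaySystem.go (𝒞-rays t∈) _ _ r′))
          ...   | refl = root (w , r′)
    open Doubling u⊂ u-rays
    S⊂X : S ⊂ X
    S⊂X _ p = proj₁ (sep⁻ p)
    F : V
    F = complement (inclusion S⊂X)
    F⊂X : F ⊂ X
    F⊂X _ p = proj₁ (sep⁻ p)
    F∌ : ∀ {x y} → x ε F → ¬ u [ x , y ]
    F∌ x∈ p = proj₂ (sep⁻ x∈) (_ , inclusion⁺ S⊂X (S∋ p))
    -- This excludes an empty `S`, which would embed into `F` without contradiction: if the union
    -- were empty, `s₀` would be disjoint from the family and so belong to it.
    nonempty : ¬ ¬ (Σ V λ x → Σ V λ y → u [ x , y ])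
    nonempty none = none (_ , _ , u⁺ (maximal s₀-Cla s₀⊂ rays₀ λ s s∈ x y y′ _ q → none (_ , _ , u⁺ s∈ q)) s₀xy)
    conclude : S ↣ F ⊎ F ↣ S → X ⊕ X ↣ X
    conclude (inj₂ f) = inclusion S⊂X ∘↣ doubling ∘↣ (X↣S ⊕↣ X↣S)
      where
      X↣S : X ↣ S
      X↣S = doubling ∘↣ (↣-refl ⊕↣ f) ∘↣ ⊕-complement (inclusion S⊂X)
    conclude (inj₁ f) = ⊥-elim (nonempty λ { (x , y , p) → absurd p })
      where
      u⊂S : u ⊂ S ⊗ S
      u⊂S p p∈ with rel-pair (u⊂ p p∈)
      ... | x , y , refl = rel⁺ (S∋ p∈) (S∋ (proj₂ (RaySystem.go u-rays _ _ p∈))) refl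
      moved : Σ V λ t → Cla t × t ⊂ F ⊗ F × RaySystem t
            × (∀ {u₁ v} → u [ u₁ , v ] → Σ V λ x → Σ V λ y → t [ x , y ] × graph f [ u₁ , x ])
      moved = transport u⊂S u-rays f
      t : V
      t = proj₁ moved
      tF : ∀ {x y} → t [ x , y ] → x ε F
      tF p = proj₁ (rel⁻ (proj₁ (proj₂ (proj₂ moved)) _ p))
      t⊂X : t ⊂ X ⊗ X
      t⊂X p p∈ with rel-pair (proj₁ (proj₂ (proj₂ moved)) p p∈)
      ... | x , y , refl = let (a , b , _) = rel⁻ (proj₁ (proj₂ (proj₂ moved)) p p∈) in rel⁺ (F⊂X _ a) (F⊂X _ b) refl
      t∈𝒞 : t ε 𝒞
      -- The moved system lives on `F`, away from every member of the family, so maximality forces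
      -- it into the family; but no point of `F` starts a pair of `u`.
      t∈𝒞 = maximal (proj₁ (proj₂ moved)) t⊂X (proj₁ (proj₂ (proj₂ (proj₂ moved))))
        λ s s∈ x y y′ p q → F∌ (tF p) (u⁺ s∈ q)
      absurd : ∀ {x y} → ¬ u [ x , y ]
      absurd p with proj₂ (proj₂ (proj₂ (proj₂ moved))) p
      ... | x , y , q , _ = F∌ (tF q) (u⁺ t∈𝒞 q)

  converse : ∀ {A B} → Matching A B → Matching B A
  converse J = matchingBy (# Matching.graph J [ x₁ , x₀ ]′)
    (λ _ _ _ → Matching.injective J)
    (λ _ _ _ → Matching.functional J)

  converse⁺ : ∀ {A B x y} (J : Matching A B) → Matching.graph J [ x , y ] → Matching.graph (converse J) [ y , x ]
  converse⁺ J p = rel⁺ (Matching.target J p) (Matching.source J p) p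

  -- G [ z , w ]: iterating J from z, as long as the values are in F, ends at w ∉ F.
  module Chase (E₁ E₂ F : V) (J : Matching E₁ E₂) where
    open Matching J using () renaming (graph to Jg; functional to Jfun)

    Φ : Fm 3
    Φ = (# Jg [ x₀ , x₁ ]′ ∧′ ¬′ (x₁ ε′ # F)) ∨′ (∃′ (x₀ ε′ # F ∧′ # Jg [ x₁ , x₀ ]′ ∧′ x₃ [ x₀ , x₂ ]′))

    Φ-mono : ∀ {Q Q′ x y} → (∀ x y → Q [ x , y ] → Q′ [ x , y ]) →
      ⟦ Φ ⟧ (x ∷ y ∷ Q ∷ []) → ⟦ Φ ⟧ (x ∷ y ∷ Q′ ∷ [])
    Φ-mono m (inj₁ p) = inj₁ p
    Φ-mono m (inj₂ (w , w∈ , p , q)) = inj₂ (w , w∈ , p , m _ _ q)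

    open LeastRelation E₁ E₂ Φ Φ-mono public renaming (μ to G)

    G-functional : ∀ {z w} → G [ z , w ] → ∀ w′ → G [ z , w′ ] → w ≡ w′
    G-functional = μ-ind (∀′ (# G [ x₁ , x₀ ]′ ⇒′ x₂ ≡′ x₀)) step
      where
      step : ∀ {Q z w} → (∀ x y → Q [ x , y ] → G [ x , y ]) →
        (∀ {z w} → Q [ z , w ] → ∀ w′ → G [ z , w′ ] → w ≡ w′) →
        z ε E₁ → w ε E₂ → ⟦ Φ ⟧ (z ∷ w ∷ Q ∷ []) → ∀ w′ → G [ z , w′ ] → w ≡ w′
      step _ ih _ _ p w′ q with p | μ-unfold q
      ... | inj₁ (r , _) | inj₁ (r′ , _) = Jfun r r′
      ... | inj₁ (r , w∉) | inj₂ (v , v∈ , r′ , _) = ⊥-elim (w∉ (subst (_ε F) (Jfun r′ r) v∈))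
      ... | inj₂ (v , v∈ , r , _) | inj₁ (r′ , w∉) = ⊥-elim (w∉ (subst (_ε F) (Jfun r r′) v∈))
      ... | inj₂ (v , v∈ , r , d) | inj₂ (v′ , v′∈ , r′ , d′) with Jfun r r′
      ...   | refl = ih d _ d′

    G-exit : ∀ {z w} → G [ z , w ] → ¬ w ε F
    G-exit = μ-ind (¬′ (x₁ ε′ # F)) step
      where
      step : ∀ {Q z w} → (∀ x y → Q [ x , y ] → G [ x , y ]) → (∀ {z w} → Q [ z , w ] → ¬ w ε F) →
        z ε E₁ → w ε E₂ → ⟦ Φ ⟧ (z ∷ w ∷ Q ∷ []) → ¬ w ε F
      step _ ih _ _ (inj₁ (_ , w∉)) = w∉
      step _ ih _ _ (inj₂ (_ , _ , _ , d)) = ih d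

  -- Chasing back along the converse of J recovers the starting point, so a chase
  -- is injective on starting points outside F.
  module _ (E₁ E₂ F : V) (J : Matching E₁ E₂) where
    open Chase E₁ E₂ F J
    private
      module Back = Chase E₂ E₁ F (converse J)

    G-reverse : ∀ {z w} → G [ z , w ] → ¬ z ε F → Back.G [ w , z ]
    -- The induction moves along the chase, so the claim is generalised to any intermediate `z`:
    -- either `z` is the start `a` itself, or the backward chase from `z` already leads to `a`.
    G-reverse {z} r z∉ = μ-ind
      (∀′ (((x₁ ≡′ x₀ ∧′ ¬′ (x₀ ε′ # F)) ∨′ (x₁ ε′ # F ∧′ # Back.G [ x₁ , x₀ ]′)) ⇒′ # Back.G [ x₂ , x₀ ]′))
      step r z (inj₁ (refl , z∉))
      where
      Start : V → V → Set ℓ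
      Start z a = (z ≡ a × ¬ a ε F) ⊎ (z ε F × Back.G [ z , a ])
      back : ∀ {z w a} → z ε E₁ → w ε E₂ → Matching.graph J [ z , w ] → Start z a → Back.G [ w , a ]
      back z∈ w∈ j (inj₁ (refl , a∉)) = Back.μ-fold w∈ z∈ (inj₁ (converse⁺ J j , a∉))
      back z∈ w∈ j (inj₂ (z∈F , d)) = Back.μ-fold w∈ (proj₁ (proj₂ (rel⁻ d))) (inj₂ (_ , z∈F , converse⁺ J j , d))
      step : ∀ {Q z w} → (∀ x y → Q [ x , y ] → G [ x , y ]) →
        (∀ {z w} → Q [ z , w ] → ∀ a → Start z a → Back.G [ w , a ]) →
        z ε E₁ → w ε E₂ → ⟦ Φ ⟧ (z ∷ w ∷ Q ∷ []) → ∀ a → Start z a → Back.G [ w , a ]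
      step _ ih z∈ w∈ (inj₁ (j , _)) a st = back z∈ w∈ j st
      step Q⊂ ih z∈ w∈ (inj₂ (v , v∈F , j , d)) a st =
        ih d a (inj₂ (v∈F , back z∈ (Matching.target J j) j st))

    G-injective : ∀ {z z′ w} → ¬ z ε F → ¬ z′ ε F → G [ z , w ] → G [ z′ , w ] → z ≡ z′
    G-injective z∉ z′∉ p q = Back.G-functional (G-reverse p z∉) _ (G-reverse q z′∉)

  -- If the chase from `inl a` never ended, the points it visits would form a ray in `X`. So each
  -- chase ends, and outside `F` it can only end in the copy of `B`.
  noRays⇒cancellable : ∀ {X A B} → NoRays X → A ⊕ X ↣ B ⊕ X → A ↣ B
  noRays⇒cancellable {X} {A} {B} noRays f = injectionBy
    (∃′ ∃′ (x₁ ≡⟨ # o , x₂ ⟩′ ∧′ x₀ ≡⟨ # o , x₃ ⟩′ ∧′ # G [ x₁ , x₀ ]′))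
    tot
    (λ { _ _ _ (_ , _ , refl , refl , p) (_ , _ , refl , refl , q) → inl-injective (G-functional p _ q) })
    (λ { _ _ _ (_ , _ , refl , refl , p) (_ , _ , refl , refl , q) →
      inl-injective (G-injective E₁ E₂ F J inl∉ inl∉ p q) })
    where
    E₁ E₂ F : V
    E₁ = A ⊕ X
    E₂ = B ⊕ X
    -- Both sums tag `X` by `i`, so `F` is the copy of `X` in the domain and in the codomain alike,
    -- and a value in `F` can be fed into `J` again.
    F = sep E₁ (∃′ (x₁ ≡⟨ # i , x₀ ⟩′))
    J : Matching E₁ E₂
    J = _↣_.matching f
    j : V
    j = graph f
    open Chase E₁ E₂ F J
    inl∉ : ∀ {x} → ¬ inl x ε F
    inl∉ p = inl≢inr (proj₂ (proj₂ (sep⁻ p)))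
    inr∈F : ∀ {x} → x ε X → inr x ε F
    inr∈F x∈ = sep⁺ (inr∈ x∈) (_ , refl)

    module Orbit {a : V} (a∈ : a ε A) (stuck : ∀ w → ¬ G [ inl a , w ]) where
      link : Fm 2
      link = ∃′ ∃′ (x₁ ≡⟨ # i , x₂ ⟩′ ∧′ x₀ ≡⟨ # i , x₃ ⟩′ ∧′ # j [ x₁ , x₀ ]′)
      Ψ : Fm 2
      Ψ = (∃′ (x₀ ≡⟨ # i , x₁ ⟩′ ∧′ # j [ # inl a , x₀ ]′)) ∨′ (∃′ (x₀ ε′ x₂ ∧′ link ⟨ zero ∷ suc zero ∷ [] ⟩′))
      Ψ-mono : ∀ {Q Q′ x} → Q ⊂ Q′ → ⟦ Ψ ⟧ (x ∷ Q ∷ []) → ⟦ Ψ ⟧ (x ∷ Q′ ∷ [])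
      Ψ-mono Q⊂ (inj₁ p)            = inj₁ p
      Ψ-mono Q⊂ (inj₂ (x , x∈ , p)) = inj₂ (x , Q⊂ x x∈ , p)
      open Least X Ψ Ψ-mono
        using () renaming (μ to N; μ-fold to N-fold; μ-ind to N-ind)
      N⊂X : ∀ {x} → x ε N → x ε X
      N⊂X p = proj₁ (sep⁻ p)
      N-stuck : ∀ {x} → x ε N → ∀ w → ¬ G [ inr x , w ]
      N-stuck p w = N-ind (∀′ ∀′ (x₀ ≡⟨ # i , x₂ ⟩′ ⇒′ ¬′ # G [ x₀ , x₁ ]′)) step p w _ refl
        where
        step : ∀ {Q x} → Q ⊂ N → (∀ {x} → x ε Q → ∀ w z → z ≡ inr x → ¬ G [ z , w ]) →
          x ε X → ⟦ Ψ ⟧ (x ∷ Q ∷ []) → ∀ w z → z ≡ inr x → ¬ G [ z , w ]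
        step _ ih x∈ (inj₁ (_ , refl , p)) w z refl q =
          stuck w (μ-fold (inl∈ a∈) (proj₁ (proj₂ (rel⁻ q))) (inj₂ (_ , inr∈F x∈ , p , q)))
        step Q⊂ ih x∈ (inj₂ (x′ , x′∈ , _ , _ , refl , refl , p)) w z refl q =
          ih x′∈ w _ refl (μ-fold (source f p) (proj₁ (proj₂ (rel⁻ q))) (inj₂ (_ , inr∈F x∈ , p , q)))
      onward : ∀ {z} → z ε E₁ → (∀ w → ¬ G [ z , w ]) → Σ V λ y → y ε X × j [ z , inr y ]
      onward z∈ z-stuck with total f z∈
      ... | w , p with ⊕⁻ (target f p)
      ...   | inj₁ (b , b∈ , refl) = ⊥-elim (z-stuck _ (μ-fold z∈ (target f p) (inj₁ (p , inl∉))))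
      ...   | inj₂ (y , y∈ , refl) = y , y∈ , p
      s : V
      s = rel X X (x₀ ε′ # N ∧′ link)
      s⁺ : ∀ {x y} → x ε N → y ε X → j [ inr x , inr y ] → s [ x , y ]
      s⁺ x∈ y∈ p = rel⁺ (N⊂X x∈) y∈ (x∈ , _ , _ , refl , refl , p)
      s⁻ : ∀ {x y} → s [ x , y ] → x ε N × y ε X × j [ inr x , inr y ]
      s⁻ p with rel⁻ p
      ... | _ , y∈ , x∈ , _ , _ , refl , refl , q = x∈ , y∈ , q
      advance : ∀ {x} → x ε N → Σ V λ y → s [ x , y ]
      advance x∈ = let (y , y∈ , p) = onward (inr∈ (N⊂X x∈)) (N-stuck x∈) in y , s⁺ x∈ y∈ p
      s-N : ∀ {x y} → s [ x , y ] → y ε N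
      s-N p = let (x∈ , y∈ , q) = s⁻ p in N-fold y∈ (inj₂ (_ , x∈ , _ , _ , refl , refl , q))
      s⊂ : s ⊂ X ⊗ X
      s⊂ p p∈ with rel-pair p∈
      ... | x , y , refl = let (a , b , _) = rel⁻ p∈ in rel⁺ a b refl
      s-gen : ∀ Q → (∀ x y → s [ x , y ] → Root s x → x ε Q) →
        (∀ x y → s [ x , y ] → x ε Q → y ε Q) → ∀ x y → s [ x , y ] → x ε Q
      s-gen Q roots closed x y p = N-ind (x₀ ε′ # Q) step (proj₁ (s⁻ p))
        where
        step : ∀ {R x} → R ⊂ N → (∀ {x} → x ε R → x ε Q) → x ε X → ⟦ Ψ ⟧ (x ∷ R ∷ []) → x ε Q
        -- The first point of the orbit is the value at `inl a`. By injectivity it is not the value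
        -- at any `inr w`, so it is a root.
        step _ ih x∈ (inj₁ (_ , refl , q)) = roots _ _ (proj₂ (advance (N-fold x∈ (inj₁ (_ , refl , q)))))
          λ { (w , r) → inl≢inr (injective f q (proj₂ (proj₂ (s⁻ r)))) }
        step R⊂ ih x∈ (inj₂ (x′ , x′∈ , _ , _ , refl , refl , q)) =
          closed _ _ (s⁺ (R⊂ _ x′∈) x∈ q) (ih x′∈)
      s-rays : RaySystem s
      s-rays = record
        { fun = λ _ _ _ p q → inr-injective (functional f (proj₂ (proj₂ (s⁻ p))) (proj₂ (proj₂ (s⁻ q))))
        ; inj = λ _ _ _ p q → inr-injective (injective f (proj₂ (proj₂ (s⁻ p))) (proj₂ (proj₂ (s⁻ q))))
        ; go  = λ _ _ p → advance (s-N p)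
        ; gen = s-gen }
      absurd : ⊥
      absurd = let (y , y∈ , p) = onward (inl∈ a∈) stuck
               in noRays s s⊂ s-rays (proj₂ (advance (N-fold y∈ (inj₁ (_ , refl , p)))))

    tot : ∀ {a} → a ε A → Σ V λ b → b ε B × (Σ V λ z → Σ V λ w → z ≡ inl a × w ≡ inl b × G [ z , w ])
    tot {a} a∈ with em {Σ V λ w → G [ inl a , w ]}
    ... | no none = ⊥-elim (Orbit.absurd a∈ λ w p → none (w , p))
    ... | yes (w , p) with ⊕⁻ (proj₁ (proj₂ (rel⁻ p)))
    ...   | inj₁ (b , b∈ , refl) = b , b∈ , _ , _ , refl , refl , p
    ...   | inj₂ (x , x∈ , refl) = ⊥-elim (G-exit p (inr∈F x∈))

  Idempotent Cancellable : V → Set ℓ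
  Idempotent X = X ⊕ X ↣ X
  Cancellable X = ∀ {A B} → A ⊕ X ↣ B ⊕ X → A ↣ B

  abstract
    dichotomy : ∀ X → Idempotent X ⊎ Cancellable X
    dichotomy X with em {Σ V λ s → Cla s × s ⊂ X ⊗ X × RaySystem s × (Σ V λ x → Σ V λ y → s [ x , y ])}
    ... | yes (s , c , s⊂ , rays , _ , _ , p) = inj₁ (rays⇒idempotent s⊂ c rays p)
    ... | no none = inj₂ (noRays⇒cancellable noRays)
      where
      noRays : NoRays X
      -- The case distinction concerned classical `s` only; transport along the identity supplies
      -- one.
      noRays s s⊂ rays {x} {y} p with transport s⊂ rays ↣-refl
      ... | t , c , t⊂ , rays′ , image = none (t , c , t⊂ , rays′ , let (x′ , y′ , q , _) = image p in x′ , y′ , q)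

-- Distributing surpluses among sums

module Cardinals {ℓ : Level} (𝒮 : Structure ℓ) (zfc : ZFC 𝒮) where
  open Structure 𝒮
  open ZFC zfc
  open SetTheory 𝒮 zfc
  open Maximality 𝒮 zfc
  open Cancellation 𝒮 zfc
  open _↣_ using (graph; source; target; functional; injective; total)

  abstract
    ⊕-comm↣ : ∀ A B → A ⊕ B ↣ B ⊕ A
    ⊕-comm↣ A B = copair ι₂ ι₁ λ p q → ι-disjoint q p

    ⊕-assoc↣ : ∀ A B C → (A ⊕ B) ⊕ C ↣ A ⊕ (B ⊕ C)
    ⊕-assoc↣ A B C = copair (copair ι₁ (ι₂ ∘↣ ι₁) (outer ι₁)) (ι₂ ∘↣ ι₂)
      (copair-disjoint ι₁ (ι₂ ∘↣ ι₁) (outer ι₁) (ι₂ ∘↣ ι₂) (outer ι₂) inner)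
      where
      outer : ∀ {D} (g : D ↣ B ⊕ C) → Disjoint (ι₁ {A} {B ⊕ C}) (ι₂ {A} {B ⊕ C} ∘↣ g)
      outer g p q = ι-disjoint p (proj₂ (proj₂ (∘-graph⁻ ι₂ g q)))
      inner : Disjoint (ι₂ {A} {B ⊕ C} ∘↣ ι₁ {B} {C}) (ι₂ {A} {B ⊕ C} ∘↣ ι₂ {B} {C})
      inner p q with ∘-graph⁻ ι₂ ι₁ p | ∘-graph⁻ ι₂ ι₂ q
      ... | _ , p₁ , p₂ | _ , q₁ , q₂ with injective ι₂ p₂ q₂
      ...   | refl = ι-disjoint p₁ q₁

    ⊕-assoc↢ : ∀ A B C → A ⊕ (B ⊕ C) ↣ (A ⊕ B) ⊕ C
    ⊕-assoc↢ A B C = ⊕-comm↣ C (A ⊕ B) ∘↣ ⊕-assoc↣ C A B ∘↣ ⊕-comm↣ B (C ⊕ A)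
      ∘↣ ⊕-assoc↣ B C A ∘↣ ⊕-comm↣ A (B ⊕ C)

    o↣ : ∀ {A} → o ↣ A
    o↣ = inclusion λ x p → ⊥-elim (proj₂ empty x p)

    ⊕-identityˡ↣ : ∀ A → o ⊕ A ↣ A
    ⊕-identityˡ↣ A = copair o↣ ↣-refl λ p _ → proj₂ empty _ (source (o↣ {A}) p)

    rotate : ∀ A B C → A ⊕ (B ⊕ C) ↣ (A ⊕ C) ⊕ B
    rotate A B C = ⊕-assoc↢ A C B ∘↣ (↣-refl ⊕↣ ⊕-comm↣ B C)

    ⊕o : ∀ {A} → A ⊕ o ↣ A
    ⊕o {A} = ⊕-identityˡ↣ A ∘↣ ⊕-comm↣ A o

    -- `B` is `A` plus a rest, and the copy of `A` inside `B` swallows the other one.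
    absorb : ∀ {A B} → Idempotent A → A ↣ B → A ⊕ B ↣ B
    absorb {A} idem f = complement-⊕ f ∘↣ (idem ⊕↣ ↣-refl) ∘↣ ⊕-assoc↢ A A (complement f) ∘↣ (↣-refl ⊕↣ ⊕-complement f)

    -- An idempotent `A` inside `B` is absorbed by `B`; cancelling `B` then embeds `A` into the
    -- empty set, and an empty set is cancelled trivially.
    cancellable-↣ : ∀ {A B} → Cancellable B → A ↣ B → Cancellable A
    cancellable-↣ {A} {B} cancelB f with dichotomy A
    ... | inj₂ cancelA = cancelA
    ... | inj₁ idem = λ h → ⊕o ∘↣ (↣-refl ⊕↣ A↣o) ∘↣ h ∘↣ ι₁
      where
      A↣o : A ↣ o
      A↣o = cancelB (ι₂ ∘↣ absorb idem f)

  -- `t` fits only into `T`, while `b` may use `T` or `B`, and `n` may use `T` or `N`; `b₁` and `n₁`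
  -- are the portions that compete with `t` for room in `T`. The hypotheses of `assignment` are the
  -- corresponding Hall conditions.
  record Assignment (t b n T B N : V) : Set ℓ where
    field
      {b₁ b₂ n₁ n₂} : V
      split-b : b ↣ b₁ ⊕ b₂
      split-n : n ↣ n₁ ⊕ n₂
      into-T  : t ⊕ (b₁ ⊕ n₁) ↣ T
      into-B  : b₂ ↣ B
      into-N  : n₂ ↣ N

  -- If T is idempotent, it has room for t and for whatever does not fit into B or N.
  -- Otherwise T is cancellable, and so is every set that embeds into T: subtract t
  -- from T and, unless b embeds into B or n into N, also B from b and N from n.
  abstract
    assignment : ∀ {t b n T B N} → t ↣ T → t ⊕ b ↣ T ⊕ B → t ⊕ n ↣ T ⊕ N → t ⊕ (b ⊕ n) ↣ T ⊕ (B ⊕ N) →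
      Assignment t b n T B N
    assignment {t} {b} {n} {T} {B} {N} f fb fn fbn with dichotomy T
    ... | inj₁ idem = combine (part fb) (part fn)
      where
      Part : V → V → Set ℓ
      Part x X = Σ V λ x₁ → Σ V λ x₂ → (x ↣ x₁ ⊕ x₂) × (x₁ ↣ T) × (x₂ ↣ X)
      part : ∀ {x X} → t ⊕ x ↣ T ⊕ X → Part x X
      -- Nothing has to be split here: if `T` embeds into `X`, then `X` absorbs `T` and holds all of
      -- `x`; otherwise `T` absorbs `X` and holds all of `x`.
      part {x} {X} h with comparability T X
      ... | inj₁ T↣X = o , x , ι₂ , o↣ , absorb idem T↣X ∘↣ h ∘↣ ι₂
      ... | inj₂ X↣T = x , o , ι₁ , (idem ∘↣ (↣-refl ⊕↣ X↣T) ∘↣ h ∘↣ ι₂) , o↣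
      combine : Part b B → Part n N → Assignment t b n T B N
      combine (_ , _ , sb , b₁↣T , b₂↣B) (_ , _ , sn , n₁↣T , n₂↣N) = record
        { split-b = sb ; split-n = sn ; into-T = idem ∘↣ (f ⊕↣ (idem ∘↣ (b₁↣T ⊕↣ n₁↣T)))
        ; into-B = b₂↣B ; into-N = n₂↣N }
    ... | inj₂ cancelT = cases (comparability b B) (comparability n N)
      where
      -- `r` is the room that `t` leaves in `T`. With `t` cancelled, the hypotheses become b ≤ r +
      -- B, n ≤ r + N and b + n ≤ r + (B + N).
      r : V
      r = complement f
      cancel-t : ∀ {x X} → t ⊕ x ↣ T ⊕ X → x ↣ r ⊕ X
      cancel-t {x} {X} h = cancellable-↣ cancelT f
        (⊕-comm↣ t (r ⊕ X) ∘↣ ⊕-assoc↣ t r X ∘↣ (⊕-complement f ⊕↣ ↣-refl) ∘↣ h ∘↣ ⊕-comm↣ x t)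
      r↣T : r ↣ T
      r↣T = complement-⊕ f ∘↣ ι₂
      gb : b ↣ r ⊕ B
      gb = cancel-t fb
      gn : n ↣ r ⊕ N
      gn = cancel-t fn
      gbn : b ⊕ n ↣ r ⊕ (B ⊕ N)
      gbn = cancel-t fbn
      all-b : b ↣ B → Assignment t b n T B N
      all-b h = record { split-b = ι₂ ; split-n = gn
                       ; into-T = complement-⊕ f ∘↣ (↣-refl ⊕↣ ⊕-identityˡ↣ r) ; into-B = h ; into-N = ↣-refl }
      all-n : n ↣ N → Assignment t b n T B N
      all-n h = record { split-b = gb ; split-n = ι₂
                       ; into-T = complement-⊕ f ∘↣ (↣-refl ⊕↣ ⊕o) ; into-B = ↣-refl ; into-N = h }
      -- An idempotent `X` either absorbs `r`, and then `x` fits into `X`, or embeds into `r` and so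
      -- into `T`, whose subsets are all cancellable.
      cancels : ∀ {x X} → x ↣ r ⊕ X → x ↣ X ⊎ Cancellable X
      cancels {x} {X} h with dichotomy X
      ... | inj₂ c = inj₂ c
      ... | inj₁ idem with comparability r X
      ...   | inj₁ r↣X = inj₁ (idem ∘↣ (r↣X ⊕↣ ↣-refl) ∘↣ h)
      ...   | inj₂ X↣r = inj₂ (cancellable-↣ cancelT (r↣T ∘↣ X↣r))
      cases : b ↣ B ⊎ B ↣ b → n ↣ N ⊎ N ↣ n → Assignment t b n T B N
      cases (inj₁ h) _ = all-b h
      cases (inj₂ _) (inj₁ h) = all-n h
      cases (inj₂ k) (inj₂ l) with cancels gb | cancels gn
      ... | inj₁ h | _ = all-b h
      ... | inj₂ _ | inj₁ h = all-n h
      -- Now b = B + x and n = N + y, and cancelling `B` and `N` from b + n ≤ r + (B + N) leaves x +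
      -- y ≤ r.
      ... | inj₂ cancelB | inj₂ cancelN = record
        { split-b = ⊕-comm↣ B x ∘↣ ⊕-complement k ; split-n = ⊕-comm↣ N y ∘↣ ⊕-complement l
        ; into-T = complement-⊕ f ∘↣ (↣-refl ⊕↣ xy↣r) ; into-B = ↣-refl ; into-N = ↣-refl }
        where
        x y : V
        x = complement k
        y = complement l
        shuffle : ((x ⊕ y) ⊕ N) ⊕ B ↣ (B ⊕ x) ⊕ (N ⊕ y)
        shuffle = (↣-refl ⊕↣ ⊕-comm↣ y N) ∘↣ ⊕-assoc↢ B x (y ⊕ N)
          ∘↣ ⊕-comm↣ (x ⊕ (y ⊕ N)) B ∘↣ (⊕-assoc↣ x y N ⊕↣ ↣-refl)
        xy↣r : x ⊕ y ↣ r
        xy↣r = cancelN (cancelB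
          (rotate r B N ∘↣ gbn ∘↣ (complement-⊕ k ⊕↣ complement-⊕ l) ∘↣ shuffle))

  -- The analogous problem behind the failure of `≅`: `b` must go into `N`, and `t` may use `T` or
  -- whatever room is left in `N`.
  record Overflow (t b T N : V) : Set ℓ where
    field
      {t₁ t₂} : V
      split-t : t ↣ t₁ ⊕ t₂
      into-T  : t₁ ↣ T
      into-N  : t₂ ⊕ b ↣ N

  -- If b is cancellable, t embeds into T and the part of N not needed for b;
  -- if b is idempotent, it absorbs t unless t already embeds there.
  abstract
    overflow : ∀ {t b T N} → b ↣ N → t ⊕ b ↣ T ⊕ N → Overflow t b T N
    overflow {t} {b} {T} {N} f h = go (dichotomy b)
      where
      c : V
      c = complement f
      rest : t ↣ T ⊕ c → Overflow t b T N
      rest k = record { split-t = k ; into-T = ↣-refl ; into-N = complement-⊕ f ∘↣ ⊕-comm↣ c b }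
      h′ : t ⊕ b ↣ (T ⊕ c) ⊕ b
      h′ = rotate T b c ∘↣ (↣-refl ⊕↣ ⊕-complement f) ∘↣ h
      go : Idempotent b ⊎ Cancellable b → Overflow t b T N
      go (inj₂ cancel-b) = rest (cancel-b h′)
      go (inj₁ idem) with comparability (T ⊕ c) b
      ... | inj₁ k = record
        { split-t = ι₂ ; into-T = o↣
        ; into-N = f ∘↣ idem ∘↣ ((idem ∘↣ (k ⊕↣ ↣-refl) ∘↣ h′ ∘↣ ι₁) ⊕↣ ↣-refl) }
      ... | inj₂ k = rest (absorb idem k ∘↣ ⊕-comm↣ (T ⊕ c) b ∘↣ h′ ∘↣ ι₁)

-- Matchings between parts of two sets

module Matchings {ℓ : Level} (𝒮 : Structure ℓ) (zfc : ZFC 𝒮) where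
  open Structure 𝒮
  open Language 𝒮
  open ZFC zfc
  open SetTheory 𝒮 zfc
  open Induction 𝒮 zfc
  open Maximality 𝒮 zfc
  open Cancellation 𝒮 zfc
  open Cardinals 𝒮 zfc
  open _↣_ using (graph; source; target; functional; injective; total)

  Apart : V → V → Set ℓ
  Apart A B = ∀ x → x ε A → ¬ x ε B

  abstract
    cover : ∀ {X A B} → (∀ x → x ε X → x ε A ⊎ x ε B) → X ↣ A ⊕ B
    cover {X} {A} {B} c = injectionBy
      ((x₀ ε′ # A ∧′ x₁ ≡⟨ # o , x₀ ⟩′) ∨′ (¬′ (x₀ ε′ # A) ∧′ x₀ ε′ # B ∧′ x₁ ≡⟨ # i , x₀ ⟩′))
      tot (λ _ _ _ → fun) (λ _ _ _ → inj)
      where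
      P : V → V → Set ℓ
      P x z = (x ε A × z ≡ inl x) ⊎ (¬ x ε A × x ε B × z ≡ inr x)
      tot : ∀ {x} → x ε X → Σ V λ z → z ε A ⊕ B × P x z
      tot {x} x∈ with em {x ε A} | c x x∈
      ... | yes a | _ = inl x , inl∈ a , inj₁ (a , refl)
      ... | no ¬a | inj₁ a = ⊥-elim (¬a a)
      ... | no ¬a | inj₂ b = inr x , inr∈ b , inj₂ (¬a , b , refl)
      fun : ∀ {x z z′} → P x z → P x z′ → z ≡ z′
      fun (inj₁ (_ , refl)) (inj₁ (_ , refl)) = refl
      fun (inj₁ (a , _)) (inj₂ (¬a , _)) = ⊥-elim (¬a a)
      fun (inj₂ (¬a , _)) (inj₁ (a , _)) = ⊥-elim (¬a a)
      fun (inj₂ (_ , _ , refl)) (inj₂ (_ , _ , refl)) = refl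
      inj : ∀ {x x′ z} → P x z → P x′ z → x ≡ x′
      inj (inj₁ (_ , refl)) (inj₁ (_ , e)) = inl-injective e
      inj (inj₁ (_ , refl)) (inj₂ (_ , _ , e)) = ⊥-elim (inl≢inr e)
      inj (inj₂ (_ , _ , refl)) (inj₁ (_ , e)) = ⊥-elim (inl≢inr (sym e))
      inj (inj₂ (_ , _ , refl)) (inj₂ (_ , _ , e)) = inr-injective e

    cover⁻ : ∀ {X A B x z} (c : ∀ x → x ε X → x ε A ⊎ x ε B) → graph (cover {X} {A} {B} c) [ x , z ] →
      z ≡ inl x ⊎ z ≡ inr x
    cover⁻ c p with proj₂ (proj₂ (rel⁻ p))
    ... | inj₁ (_ , e) = inj₁ e
    ... | inj₂ (_ , _ , e) = inj₂ e

  abstract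
    merge : ∀ {A B X} → A ⊂ X → B ⊂ X → Apart A B → A ⊕ B ↣ X
    merge A⊂X B⊂X apart = copair (inclusion A⊂X) (inclusion B⊂X) λ p q →
      apart _ (source (inclusion A⊂X) p)
        (subst (_ε _) (trans (inclusion⁻ B⊂X q) (sym (inclusion⁻ A⊂X p))) (source (inclusion B⊂X) q))

  abstract
    glue : ∀ {X A B C} → (∀ x → x ε X → x ε A ⊎ x ε B) → (f : A ↣ C) (g : B ↣ C) → Disjoint f g → X ↣ C
    glue c f g d = copair f g d ∘↣ cover c

    glue⁻ : ∀ {X A B C x y} (c : ∀ x → x ε X → x ε A ⊎ x ε B) (f : A ↣ C) (g : B ↣ C) (d : Disjoint f g) →
      graph (glue c f g d) [ x , y ] → graph f [ x , y ] ⊎ graph g [ x , y ]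
    glue⁻ c f g d p with ∘-graph⁻ (copair f g d) (cover c) p
    ... | z , q , r with cover⁻ c q | copair⁻ f g d r
    ...   | inj₁ refl | inj₁ (x′ , e , s) = inj₁ (subst (λ v → graph f [ v , _ ]) (sym (inl-injective e)) s)
    ...   | inj₁ refl | inj₂ (_ , e , _) = ⊥-elim (inl≢inr e)
    ...   | inj₂ refl | inj₁ (_ , e , _) = ⊥-elim (inl≢inr (sym e))
    ...   | inj₂ refl | inj₂ (x′ , e , s) = inj₂ (subst (λ v → graph g [ v , _ ]) (sym (inr-injective e)) s)

  Disjoint-glue : ∀ {X A B C D} (c : ∀ x → x ε X → x ε A ⊎ x ε B) (f : A ↣ C) (g : B ↣ C) (d : Disjoint f g)
    (h : D ↣ C) → Disjoint h f → Disjoint h g → Disjoint h (glue c f g d)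
  Disjoint-glue c f g d h df dg p q with glue⁻ c f g d q
  ... | inj₁ r = df p r
  ... | inj₂ r = dg p r

  Disjoint-copair∘ : ∀ {A B C D E} (f : A ↣ C) (g : B ↣ C) (d : Disjoint f g) (s : E ↣ A ⊕ B)
    (h : D ↣ C) → Disjoint h f → Disjoint h g → Disjoint h (copair f g d ∘↣ s)
  Disjoint-copair∘ f g d s h df dg p q =
    copair-disjoint f g d h (λ x y → df y x) (λ x y → dg y x) (proj₂ (proj₂ (∘-graph⁻ (copair f g d) s q))) p

  ∘-disjoint : ∀ {A B C D} (f : A ↣ C) (g : B ↣ C) (k : C ↣ D) → Disjoint f g → Disjoint (k ∘↣ f) (k ∘↣ g)
  ∘-disjoint f g k d p q with ∘-graph⁻ k f p | ∘-graph⁻ k g q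
  ... | _ , p₁ , p₂ | _ , q₁ , q₂ with injective k p₂ q₂
  ...   | refl = d p₁ q₁

  inclusion∘⁻ : ∀ {A B C} (B⊂C : B ⊂ C) (f : A ↣ B) {x y} → graph (inclusion B⊂C ∘↣ f) [ x , y ] → graph f [ x , y ]
  inclusion∘⁻ B⊂C f p with ∘-graph⁻ (inclusion B⊂C) f p
  ... | _ , q , r = subst (λ v → graph f [ _ , v ]) (inclusion⁻ B⊂C r) q

  inclusion-target : ∀ {A B C} (B⊂C : B ⊂ C) (f : A ↣ B) {x y} → graph (inclusion B⊂C ∘↣ f) [ x , y ] → y ε B
  inclusion-target B⊂C f p = target f (inclusion∘⁻ B⊂C f p)

  apart-disjoint : ∀ {A B C D E} (C⊂E : C ⊂ E) (D⊂E : D ⊂ E) (f : A ↣ C) (g : B ↣ D) → Apart C D →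
    Disjoint (inclusion C⊂E ∘↣ f) (inclusion D⊂E ∘↣ g)
  apart-disjoint C⊂E D⊂E f g apart p q = apart _ (inclusion-target C⊂E f p) (inclusion-target D⊂E g q)

  restrict : ∀ {X Y A B} (θ : Matching X Y) → (∀ x → x ε A → Σ V λ y → y ε B × Matching.graph θ [ x , y ]) → A ↣ B
  restrict θ t = injectionBy (# Matching.graph θ [ x₀ , x₁ ]′)
    (t _)
    (λ _ _ _ → Matching.functional θ)
    (λ _ _ _ → Matching.injective θ)

  restrict⁺ : ∀ {X Y A B x y} (θ : Matching X Y) (m : ∀ x → x ε A → Σ V λ y → y ε B × Matching.graph θ [ x , y ]) →
    x ε A → y ε B → Matching.graph θ [ x , y ] → graph (restrict θ m) [ x , y ]
  restrict⁺ θ m = rel⁺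

  Bijection : V → V → Set ℓ
  Bijection A B = Σ (A ↣ B) λ f → ∀ y → y ε B → Σ V λ x → graph f [ x , y ]

  widen : ∀ {A B X Y} → A ⊂ X → B ⊂ Y → Matching A B → Matching X Y
  widen A⊂X B⊂Y f = record
    { graph = Matching.graph f
    ; source = λ p → A⊂X _ (Matching.source f p) ; target = λ p → B⊂Y _ (Matching.target f p)
    ; functional = Matching.functional f ; injective = Matching.injective f }

  -- Simultaneous matching of A₁ into B and of B₁ into A, as in the proof of the
  -- Cantor–Bernstein theorem: S is a fixed point of S ↦ A₁ ∖ k[B₁ ∖ h[S]].
  module _ {A₁ B₁ A₂ B₂ A B : V} (A₁⊂A : A₁ ⊂ A) (B₁⊂B : B₁ ⊂ B) (A₂⊂A : A₂ ⊂ A) (B₂⊂B : B₂ ⊂ B)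
    (h : A₁ ↣ B₂) (k : B₁ ↣ A₂) where

    private
      Unhit : Fm 2
      Unhit = x₀ ε′ # B₁ ∧′ ¬′ (∃′ (x₀ ε′ x₂ ∧′ # graph h [ x₀ , x₁ ]′))

      Φ : Fm 2
      Φ = ¬′ (∃′ (Unhit ⟨ zero ∷ suc (suc zero) ∷ [] ⟩′ ∧′ # graph k [ x₀ , x₁ ]′))

      Φ-mono : ∀ {Q Q′ x} → Q ⊂ Q′ → ⟦ Φ ⟧ (x ∷ Q ∷ []) → ⟦ Φ ⟧ (x ∷ Q′ ∷ [])
      Φ-mono Q⊂Q′ p (y , (y∈ , unhit) , r) = p (y , (y∈ , λ (x , x∈ , q) → unhit (x , Q⊂Q′ x x∈ , q)) , r)

      open Least A₁ Φ Φ-mono renaming (μ to S)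

      Θ : V → V → Set ℓ
      Θ x y = (x ε S × graph h [ x , y ]) ⊎ (⟦ Unhit ⟧ (y ∷ S ∷ []) × graph k [ y , x ])

      S-unfold : ∀ {x} → x ε S → ⟦ Φ ⟧ (x ∷ S ∷ [])
      S-unfold x∈ (y , (y∈ , unhit) , r) = μ-ind
        (¬′ (∃′ (x₀ ε′ # B₁ ∧′ (¬′ (∃′ (x₀ ε′ # S ∧′ # graph h [ x₀ , x₁ ]′))) ∧′ # graph k [ x₀ , x₁ ]′)))
        (λ Q⊂S _ _ p (y , y∈ , unhit , r) → p (y , (y∈ , λ (x , x∈ , q) → unhit (x , Q⊂S x x∈ , q)) , r))
        x∈ (y , y∈ , unhit , r)

      Θ-functional : ∀ {x y y′} → Θ x y → Θ x y′ → y ≡ y′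
      Θ-functional (inj₁ (_ , p)) (inj₁ (_ , q)) = functional h p q
      Θ-functional (inj₁ (x∈ , _)) (inj₂ (u , q)) = ⊥-elim (S-unfold x∈ (_ , u , q))
      Θ-functional (inj₂ (u , q)) (inj₁ (x∈ , _)) = ⊥-elim (S-unfold x∈ (_ , u , q))
      Θ-functional (inj₂ (_ , p)) (inj₂ (_ , q)) = injective k p q

      Θ-injective : ∀ {x x′ y} → Θ x y → Θ x′ y → x ≡ x′
      Θ-injective (inj₁ (_ , p)) (inj₁ (_ , q)) = injective h p q
      Θ-injective (inj₁ (x∈ , p)) (inj₂ ((_ , unhit) , _)) = ⊥-elim (unhit (_ , x∈ , p))
      Θ-injective (inj₂ ((_ , unhit) , _)) (inj₁ (x∈ , p)) = ⊥-elim (unhit (_ , x∈ , p))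
      Θ-injective (inj₂ (_ , p)) (inj₂ (_ , q)) = functional k p q

      form : Fm 2
      form = (x₀ ε′ # S ∧′ # graph h [ x₀ , x₁ ]′)
           ∨′ ((x₁ ε′ # B₁ ∧′ ¬′ (∃′ (x₀ ε′ # S ∧′ # graph h [ x₀ , x₂ ]′))) ∧′ # graph k [ x₁ , x₀ ]′)

    bernstein : Σ (Matching A B) λ θ →
        (∀ x → x ε A₁ → Σ V λ y → Matching.graph θ [ x , y ])
      × (∀ y → y ε B₁ → Σ V λ x → Matching.graph θ [ x , y ])
      × (∀ {x y} → Matching.graph θ [ x , y ] → graph h [ x , y ] ⊎ graph k [ y , x ])
    bernstein = θ , left , right , λ p → narrow (proj₂ (proj₂ (rel⁻ p)))
      where
      θ : Matching A B
      θ = matchingBy form (λ _ _ _ → Θ-functional) (λ _ _ _ → Θ-injective)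
      narrow : ∀ {x y} → Θ x y → graph h [ x , y ] ⊎ graph k [ y , x ]
      narrow (inj₁ (_ , p)) = inj₁ p
      narrow (inj₂ (_ , p)) = inj₂ p
      θ⁺ : ∀ {x y} → Θ x y → Matching.graph θ [ x , y ]
      θ⁺ (inj₁ (x∈ , p)) = rel⁺ (A₁⊂A _ (source h p)) (B₂⊂B _ (target h p)) (inj₁ (x∈ , p))
      θ⁺ (inj₂ (u , p)) = rel⁺ (A₂⊂A _ (target k p)) (B₁⊂B _ (source k p)) (inj₂ (u , p))
      left : ∀ x → x ε A₁ → Σ V λ y → Matching.graph θ [ x , y ]
      left x x∈ with em {Σ V λ y → ⟦ Unhit ⟧ (y ∷ S ∷ []) × graph k [ y , x ]}
      ... | yes (y , u , p) = y , θ⁺ (inj₂ (u , p))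
      -- `none` says that `x` is not the `k`-image of an unhit point. This is `Φ` at `S`, so folding
      -- puts `x` into `S`.
      ... | no none = let (y , p) = total h x∈ in y , θ⁺ (inj₁ (μ-fold x∈ none , p))
      right : ∀ y → y ε B₁ → Σ V λ x → Matching.graph θ [ x , y ]
      right y y∈ with em {Σ V λ x → x ε S × graph h [ x , y ]}
      ... | yes (x , x∈ , p) = x , θ⁺ (inj₁ (x∈ , p))
      ... | no none = let (x , p) = total k y∈ in x , θ⁺ (inj₂ ((y∈ , none) , p))

  -- P and Q play the roles of A! and A?.
  module Parts (P Q : V) where
    X t b n : V
    -- `cup` specifies only the elements; separation by a trivial condition makes the union
    -- classical.
    X = sep (P ∪ Q) ⊤′
    t = sep P (x₀ ε′ # Q)
    b = sep P (¬′ (x₀ ε′ # Q))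
    n = sep Q (¬′ (x₀ ε′ # P))

    P⊂X : P ⊂ X
    P⊂X x p = sep⁺ (∪⁺ˡ p) refl
    Q⊂X : Q ⊂ X
    Q⊂X x p = sep⁺ (∪⁺ʳ p) refl
    X⁻ : ∀ {x} → x ε X → x ε P ⊎ x ε Q
    X⁻ x∈ = ∪⁻ (proj₁ (sep⁻ x∈))
    t⊂P : t ⊂ P
    t⊂P x p = proj₁ (sep⁻ p)
    t⊂Q : t ⊂ Q
    t⊂Q x p = proj₂ (sep⁻ p)
    b⊂P : b ⊂ P
    b⊂P x p = proj₁ (sep⁻ p)
    n⊂Q : n ⊂ Q
    n⊂Q x p = proj₁ (sep⁻ p)
    t⊂X : t ⊂ X
    t⊂X x p = P⊂X x (t⊂P x p)
    b⊂X : b ⊂ X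
    b⊂X x p = P⊂X x (b⊂P x p)
    n⊂X : n ⊂ X
    n⊂X x p = Q⊂X x (n⊂Q x p)
    t∥b : Apart t b
    t∥b x p q = proj₂ (sep⁻ q) (t⊂Q x p)
    t∥n : Apart t n
    t∥n x p q = proj₂ (sep⁻ q) (t⊂P x p)
    b∥n : Apart b n
    b∥n x p q = proj₂ (sep⁻ p) (n⊂Q x q)
    splitP : ∀ x → x ε P → x ε t ⊎ x ε b
    splitP x p with em {x ε Q}
    ... | yes q = inj₁ (sep⁺ p q)
    ... | no ¬q = inj₂ (sep⁺ p ¬q)
    splitQ : ∀ x → x ε Q → x ε t ⊎ x ε n
    splitQ x q with em {x ε P}
    ... | yes p = inj₁ (sep⁺ p q)
    ... | no ¬p = inj₂ (sep⁺ q ¬p)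
    splitX : ∀ x → x ε X → x ε t ⊎ x ε b ∪ n
    splitX x x∈ with X⁻ x∈
    ... | inj₁ p with splitP x p
    ...   | inj₁ e = inj₁ e
    ...   | inj₂ e = inj₂ (∪⁺ˡ e)
    splitX x x∈ | inj₂ q with splitQ x q
    ...   | inj₁ e = inj₁ e
    ...   | inj₂ e = inj₂ (∪⁺ʳ e)

  module _ (P Q P′ Q′ : V) where
    open Parts P Q
    open Parts P′ Q′ using () renaming
      (X to X′; t to t′; b to b′; n to n′; P⊂X to P′⊂X′; Q⊂X to Q′⊂X′; t⊂P to t′⊂P′; t⊂Q to t′⊂Q′;
       b⊂P to b′⊂P′; n⊂Q to n′⊂Q′; t⊂X to t′⊂X′; b⊂X to b′⊂X′; n⊂X to n′⊂X′; t∥b to t′∥b′;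
       t∥n to t′∥n′; b∥n to b′∥n′; splitP to splitP′; splitQ to splitQ′; splitX to splitX′)

    Maps : Matching X X′ → V → V → Set ℓ
    Maps θ A B = ∀ x → x ε A → Σ V λ y → y ε B × Matching.graph θ [ x , y ]

    Covers : Matching X X′ → V → V → Set ℓ
    Covers θ A B = ∀ y → y ε B → Σ V λ x → x ε A × Matching.graph θ [ x , y ]

    Maps-∩ : ∀ {θ} → Maps θ P P′ → Maps θ Q Q′ → Maps θ t t′
    Maps-∩ {θ} p q x x∈ with p x (t⊂P x x∈) | q x (t⊂Q x x∈)
    ... | y , y∈ , r | y′ , y′∈ , r′ with Matching.functional θ r r′
    ...   | refl = y , sep⁺ y∈ y′∈ , r

    private
      -- The pieces `t`, `b₁`, `n₁` share `t′` and are kept apart by the sum in `into-T`; `b₂` and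
      -- `n₂` land in `b′` and `n′`, which are apart from `t′` and from each other. So the five
      -- pieces glue to one injection that respects the parts.
      module Assigned (𝒜 : Assignment t b n t′ b′ n′) where
        open Assignment 𝒜
        et : t ↣ X′
        et = inclusion t′⊂X′ ∘↣ (into-T ∘↣ ι₁)
        eb₁ : b₁ ↣ X′
        eb₁ = inclusion t′⊂X′ ∘↣ (into-T ∘↣ (ι₂ ∘↣ ι₁))
        en₁ : n₁ ↣ X′
        en₁ = inclusion t′⊂X′ ∘↣ (into-T ∘↣ (ι₂ ∘↣ ι₂))
        eb₂ : b₂ ↣ X′
        eb₂ = inclusion b′⊂X′ ∘↣ into-B
        en₂ : n₂ ↣ X′
        en₂ = inclusion n′⊂X′ ∘↣ into-N
        outer : ∀ {A B C} (g : A ↣ C) → Disjoint (ι₁ {B} {C}) (ι₂ ∘↣ g)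
        outer g p q = ι-disjoint p (proj₂ (proj₂ (∘-graph⁻ ι₂ g q)))
        within : ∀ {A B} (f : A ↣ t ⊕ (b₁ ⊕ n₁)) (g : B ↣ t ⊕ (b₁ ⊕ n₁)) → Disjoint f g →
          Disjoint (inclusion t′⊂X′ ∘↣ (into-T ∘↣ f)) (inclusion t′⊂X′ ∘↣ (into-T ∘↣ g))
        within f g d = ∘-disjoint (into-T ∘↣ f) (into-T ∘↣ g) (inclusion t′⊂X′) (∘-disjoint f g into-T d)
        t-b₁ : Disjoint et eb₁
        t-b₁ = within ι₁ (ι₂ ∘↣ ι₁) (outer ι₁)
        t-n₁ : Disjoint et en₁
        t-n₁ = within ι₁ (ι₂ ∘↣ ι₂) (outer ι₂)
        b₁-n₁ : Disjoint eb₁ en₁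
        b₁-n₁ = within (ι₂ ∘↣ ι₁) (ι₂ ∘↣ ι₂) (∘-disjoint ι₁ ι₂ ι₂ ι-disjoint)
        t-b₂ : ∀ {A} (f : A ↣ t′) → Disjoint (inclusion t′⊂X′ ∘↣ f) eb₂
        t-b₂ f = apart-disjoint t′⊂X′ b′⊂X′ f into-B t′∥b′
        t-n₂ : ∀ {A} (f : A ↣ t′) → Disjoint (inclusion t′⊂X′ ∘↣ f) en₂
        t-n₂ f = apart-disjoint t′⊂X′ n′⊂X′ f into-N t′∥n′
        b₁-b₂ : Disjoint eb₁ eb₂
        b₁-b₂ = t-b₂ (into-T ∘↣ (ι₂ ∘↣ ι₁))
        n₁-n₂ : Disjoint en₁ en₂
        n₁-n₂ = t-n₂ (into-T ∘↣ (ι₂ ∘↣ ι₂))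
        eb : b ↣ X′
        eb = copair eb₁ eb₂ b₁-b₂ ∘↣ split-b
        en : n ↣ X′
        en = copair en₁ en₂ n₁-n₂ ∘↣ split-n
        en-b₁ : Disjoint eb₁ en
        en-b₁ = Disjoint-copair∘ en₁ en₂ n₁-n₂ split-n eb₁ b₁-n₁ (t-n₂ (into-T ∘↣ (ι₂ ∘↣ ι₁)))
        en-b₂ : Disjoint eb₂ en
        en-b₂ = Disjoint-copair∘ en₁ en₂ n₁-n₂ split-n eb₂ (λ p q → t-b₂ (into-T ∘↣ (ι₂ ∘↣ ι₂)) q p)
          (apart-disjoint b′⊂X′ n′⊂X′ into-B into-N b′∥n′)
        b-n : Disjoint eb en
        b-n p q = Disjoint-copair∘ eb₁ eb₂ b₁-b₂ split-b en (λ x y → en-b₁ y x) (λ x y → en-b₂ y x) q p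
        t-b : Disjoint et eb
        t-b = Disjoint-copair∘ eb₁ eb₂ b₁-b₂ split-b et t-b₁ (t-b₂ (into-T ∘↣ ι₁))
        t-n : Disjoint et en
        t-n = Disjoint-copair∘ en₁ en₂ n₁-n₂ split-n et t-n₁ (t-n₂ (into-T ∘↣ ι₁))
        ebn : b ∪ n ↣ X′
        ebn = glue (λ _ → ∪⁻) eb en b-n
        t-bn : Disjoint et ebn
        t-bn = Disjoint-glue (λ _ → ∪⁻) eb en b-n et t-b t-n
        all : X ↣ X′
        all = glue splitX et ebn t-bn
        et-target : ∀ {x y} → graph et [ x , y ] → y ε t′
        et-target = inclusion-target t′⊂X′ (into-T ∘↣ ι₁)
        eb-target : ∀ {x y} → graph eb [ x , y ] → y ε P′
        eb-target p with copair⁻ eb₁ eb₂ b₁-b₂ (proj₂ (proj₂ (∘-graph⁻ (copair eb₁ eb₂ b₁-b₂) split-b p)))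
        ... | inj₁ (_ , _ , q) = t′⊂P′ _ (inclusion-target t′⊂X′ (into-T ∘↣ (ι₂ ∘↣ ι₁)) q)
        ... | inj₂ (_ , _ , q) = b′⊂P′ _ (inclusion-target b′⊂X′ into-B q)
        en-target : ∀ {x y} → graph en [ x , y ] → y ε Q′
        en-target p with copair⁻ en₁ en₂ n₁-n₂ (proj₂ (proj₂ (∘-graph⁻ (copair en₁ en₂ n₁-n₂) split-n p)))
        ... | inj₁ (_ , _ , q) = t′⊂Q′ _ (inclusion-target t′⊂X′ (into-T ∘↣ (ι₂ ∘↣ ι₂)) q)
        ... | inj₂ (_ , _ , q) = n′⊂Q′ _ (inclusion-target n′⊂X′ into-N q)
        cases : ∀ {x y} → graph all [ x , y ] → graph et [ x , y ] ⊎ graph eb [ x , y ] ⊎ graph en [ x , y ]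
        cases p with glue⁻ splitX et ebn t-bn p
        ... | inj₁ q = inj₁ q
        ... | inj₂ q = inj₂ (glue⁻ (λ _ → ∪⁻) eb en b-n q)
        Image : V → V → Set ℓ
        Image x y = graph et [ x , y ] ⊎ graph eb [ x , y ] ⊎ graph en [ x , y ]
        in-P : ∀ {x y} → x ε P → Image x y → y ε P′
        in-P x∈ (inj₁ q) = t′⊂P′ _ (et-target q)
        in-P x∈ (inj₂ (inj₁ q)) = eb-target q
        in-P x∈ (inj₂ (inj₂ q)) = ⊥-elim (proj₂ (sep⁻ (source en q)) x∈)
        in-Q : ∀ {x y} → x ε Q → Image x y → y ε Q′
        in-Q x∈ (inj₁ q) = t′⊂Q′ _ (et-target q)
        in-Q x∈ (inj₂ (inj₁ q)) = ⊥-elim (proj₂ (sep⁻ (source eb q)) x∈)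
        in-Q x∈ (inj₂ (inj₂ q)) = en-target q
        maps-P : Maps (_↣_.matching all) P P′
        maps-P x x∈ = let (y , p) = total all (P⊂X x x∈) in y , in-P x∈ (cases p) , p
        maps-Q : Maps (_↣_.matching all) Q Q′
        maps-Q x x∈ = let (y , p) = total all (Q⊂X x x∈) in y , in-Q x∈ (cases p) , p

    -- Splitting `P`, `Q` and `X` into parts turns the four embeddings into the hypotheses of
    -- `assignment`. Conversely, a point of `t` has a single partner, which lies in both `P′` and
    -- `Q′`.
    subset-criterion : (Σ (Matching X X′) λ θ → Maps θ P P′ × Maps θ Q Q′)
      ⇔ ((X ↣ X′) × (P ↣ P′) × (Q ↣ Q′) × (t ↣ t′))
    subset-criterion = to , from
      where
      to : (Σ (Matching X X′) λ θ → Maps θ P P′ × Maps θ Q Q′) → (X ↣ X′) × (P ↣ P′) × (Q ↣ Q′) × (t ↣ t′)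
      to (θ , p , q) = restrict θ x , restrict θ p , restrict θ q , restrict θ (Maps-∩ {θ} p q)
        where
        x : Maps θ X X′
        x u u∈ with X⁻ u∈
        ... | inj₁ u∈P = let (y , y∈ , r) = p u u∈P in y , P′⊂X′ y y∈ , r
        ... | inj₂ u∈Q = let (y , y∈ , r) = q u u∈Q in y , Q′⊂X′ y y∈ , r
      from : (X ↣ X′) × (P ↣ P′) × (Q ↣ Q′) × (t ↣ t′) → Σ (Matching X X′) λ θ → Maps θ P P′ × Maps θ Q Q′
      from (fX , fP , fQ , ft) = _↣_.matching all , maps-P , maps-Q
        where
        bn⊂X : b ∪ n ⊂ X
        bn⊂X x p with ∪⁻ p
        ... | inj₁ q = b⊂X x q
        ... | inj₂ q = n⊂X x q
        t∥bn : Apart t (b ∪ n)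
        t∥bn x p q with ∪⁻ q
        ... | inj₁ r = t∥b x p r
        ... | inj₂ r = t∥n x p r
        𝒜 : Assignment t b n t′ b′ n′
        𝒜 = assignment ft
          (cover splitP′ ∘↣ fP ∘↣ merge t⊂P b⊂P t∥b)
          (cover splitQ′ ∘↣ fQ ∘↣ merge t⊂Q n⊂Q t∥n)
          ((↣-refl ⊕↣ cover (λ _ → ∪⁻)) ∘↣ cover splitX′ ∘↣ fX
            ∘↣ merge t⊂X bn⊂X t∥bn ∘↣ (↣-refl ⊕↣ merge (λ _ → ∪⁺ˡ) (λ _ → ∪⁺ʳ) b∥n))
        open Assigned 𝒜

    -- This is the negation of what makes `≼` false. A matching may leave points outside `P`
    -- unmatched, so any injection of `P` already is one.
    possible-subset-criterion : (Σ (Matching X X′) λ θ → Maps θ P Q′) ⇔ (P ↣ Q′)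
    possible-subset-criterion = (λ (θ , p) → restrict θ p)
      , λ f → widen P⊂X Q′⊂X′ (_↣_.matching f) , λ x x∈ → let (y , p) = total f x∈ in y , target f p , p

  module _ (P Q P′ Q′ : V) where
    open Parts P Q
    open Parts P′ Q′ using () renaming
      (n to n′; t⊂Q to t′⊂Q′; n⊂Q to n′⊂Q′; t∥n to t′∥n′; splitQ to splitQ′)

    -- An injection of `P` into `Q′` might use up `n′` for points of `t`; `overflow` redistributes
    -- it so that `b` stays within `n′`.
    b-into-n : P ↣ Q′ → b ↣ n′ → Σ (P ↣ Q′) λ h → ∀ {x y} → graph h [ x , y ] → x ε b → y ε n′
    b-into-n f g = h , traced
      where
      open Overflow (overflow g (cover splitQ′ ∘↣ f ∘↣ merge t⊂P b⊂P t∥b))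
      et₁ : t₁ ↣ Q′
      et₁ = inclusion t′⊂Q′ ∘↣ into-T
      et₂ : t₂ ↣ Q′
      et₂ = inclusion n′⊂Q′ ∘↣ (into-N ∘↣ ι₁)
      t₁-t₂ : Disjoint et₁ et₂
      t₁-t₂ = apart-disjoint t′⊂Q′ n′⊂Q′ into-T (into-N ∘↣ ι₁) t′∥n′
      et : t ↣ Q′
      et = copair et₁ et₂ t₁-t₂ ∘↣ split-t
      eb : b ↣ Q′
      eb = inclusion n′⊂Q′ ∘↣ (into-N ∘↣ ι₂)
      et-eb : Disjoint et eb
      et-eb p q = Disjoint-copair∘ et₁ et₂ t₁-t₂ split-t eb
        (λ x y → apart-disjoint t′⊂Q′ n′⊂Q′ into-T (into-N ∘↣ ι₂) t′∥n′ y x)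
        (λ x y → ∘-disjoint (into-N ∘↣ ι₁) (into-N ∘↣ ι₂) (inclusion n′⊂Q′) (∘-disjoint ι₁ ι₂ into-N ι-disjoint) y x)
        q p
      h : P ↣ Q′
      h = glue splitP et eb et-eb
      traced : ∀ {x y} → graph h [ x , y ] → x ε b → y ε n′
      traced p x∈ with glue⁻ splitP et eb et-eb p
      ... | inj₁ q = ⊥-elim (t∥b _ (source et q) x∈)
      ... | inj₂ q = inclusion-target n′⊂Q′ (into-N ∘↣ ι₂) q

  module _ (P Q P′ Q′ : V) where
    open Parts P Q
    open Parts P′ Q′ using () renaming
      (X to X′; t to t′; b to b′; n to n′; P⊂X to P′⊂X′; Q⊂X to Q′⊂X′; t⊂P to t′⊂P′; t⊂Q to t′⊂Q′;
       b⊂P to b′⊂P′; n⊂Q to n′⊂Q′; t⊂X to t′⊂X′; b⊂X to b′⊂X′; n⊂X to n′⊂X′; t∥b to t′∥b′;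
       t∥n to t′∥n′; b∥n to b′∥n′; splitP to splitP′; splitQ to splitQ′)

    -- The two injections joined by `bernstein` are first arranged to send `b` into `n′` and `b′`
    -- into `n`. A point of `P` may be matched by the injection from `P′`, and its partner must
    -- still lie in `Q′`: it cannot come from `b′`, which is sent outside `P`.
    possible-equality-criterion :
      (Σ (Matching X X′) λ θ → Maps P Q P′ Q′ θ P Q′ × Covers P Q P′ Q′ θ Q P′)
      ⇔ ((P ↣ Q′) × (P′ ↣ Q) × (b ↣ n′) × (b′ ↣ n))
    possible-equality-criterion = to , from
      where
      to : _ → _
      to (θ , m , c) = restrict θ m , restrict θ⁻ c⁻ , restrict θ mb , restrict θ⁻ cb
        where
        θ⁻ : Matching X′ X
        θ⁻ = converse θ
        c⁻ : ∀ y → y ε P′ → Σ V λ x → x ε Q × Matching.graph θ⁻ [ y , x ]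
        c⁻ y y∈ = let (x , x∈ , r) = c y y∈ in x , x∈ , converse⁺ θ r
        mb : ∀ x → x ε b → Σ V λ y → y ε n′ × Matching.graph θ [ x , y ]
        mb x x∈ with m x (b⊂P x x∈)
        ... | y , y∈ , r = y , sep⁺ y∈ y∉ , r
          where
          y∉ : ¬ y ε P′
          -- A point of `P′` has a partner in `Q`; by injectivity that partner is `x`, which lies
          -- outside `Q`.
          y∉ y∈P′ with c y y∈P′
          ... | x′ , x′∈ , r′ with Matching.injective θ r r′
          ...   | refl = proj₂ (sep⁻ x∈) x′∈
        cb : ∀ y → y ε b′ → Σ V λ x → x ε n × Matching.graph θ⁻ [ y , x ]
        cb y y∈ with c y (b′⊂P′ y y∈)
        ... | x , x∈ , r = x , sep⁺ x∈ x∉ , converse⁺ θ r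
          where
          x∉ : ¬ x ε P
          x∉ x∈P with m x x∈P
          ... | y′ , y′∈ , r′ with Matching.functional θ r r′
          ...   | refl = proj₂ (sep⁻ y∈) y′∈
      from : (P ↣ Q′) × (P′ ↣ Q) × (b ↣ n′) × (b′ ↣ n) →
        Σ (Matching X X′) λ θ → Maps P Q P′ Q′ θ P Q′ × Covers P Q P′ Q′ θ Q P′
      from (f , f′ , g , g′) with b-into-n P Q P′ Q′ f g | b-into-n P′ Q′ P Q f′ g′
      ... | h , h-traced | k , k-traced with bernstein P⊂X P′⊂X′ Q⊂X Q′⊂X′ h k
      ...   | θ , left , right , narrow = θ , maps , covers
        where
        maps : ∀ x → x ε P → Σ V λ y → y ε Q′ × Matching.graph θ [ x , y ]
        maps x x∈ with left x x∈
        ... | y , r with narrow r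
        ...   | inj₁ p = y , target h p , r
        ...   | inj₂ p with splitP′ y (source k p)
        ...     | inj₁ y∈t′ = y , t′⊂Q′ y y∈t′ , r
        ...     | inj₂ y∈b′ = ⊥-elim (proj₂ (sep⁻ (k-traced p y∈b′)) x∈)
        covers : ∀ y → y ε P′ → Σ V λ x → x ε Q × Matching.graph θ [ x , y ]
        covers y y∈ with right y y∈
        ... | x , r with narrow r
        ...   | inj₂ p = x , target k p , r
        ...   | inj₁ p with splitP x (source h p)
        ...     | inj₁ x∈t = x , t⊂Q x x∈t , r
        ...     | inj₂ x∈b = ⊥-elim (proj₂ (sep⁻ (h-traced p x∈b)) y∈)

    -- The conditions in both directions make matched points agree on membership in the first and in
    -- the second set, so the matching preserves and reflects all three parts.
    equality-criterion :
      (Σ (Matching X X′) λ θ → (Maps P Q P′ Q′ θ P P′ × Maps P Q P′ Q′ θ Q Q′)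
                             × (Covers P Q P′ Q′ θ P P′ × Covers P Q P′ Q′ θ Q Q′))
      ⇔ (Bijection t t′ × Bijection b b′ × Bijection n n′)
    equality-criterion = to , from
      where
      to : _ → _
      to (θ , (mP , mQ) , (cP , cQ)) = bijection mt ct , bijection mb cb , bijection mn cn
        where
        _∼_ : V → V → Set ℓ
        x ∼ y = Matching.graph θ [ x , y ]
        P⇒ : ∀ {x y} → x ∼ y → x ε P → y ε P′
        P⇒ r x∈ with mP _ x∈
        ... | y′ , y′∈ , r′ = subst (_ε P′) (Matching.functional θ r′ r) y′∈
        Q⇒ : ∀ {x y} → x ∼ y → x ε Q → y ε Q′
        Q⇒ r x∈ with mQ _ x∈
        ... | y′ , y′∈ , r′ = subst (_ε Q′) (Matching.functional θ r′ r) y′∈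
        P⇐ : ∀ {x y} → x ∼ y → y ε P′ → x ε P
        P⇐ r y∈ with cP _ y∈
        ... | x′ , x′∈ , r′ = subst (_ε P) (Matching.injective θ r′ r) x′∈
        Q⇐ : ∀ {x y} → x ∼ y → y ε Q′ → x ε Q
        Q⇐ r y∈ with cQ _ y∈
        ... | x′ , x′∈ , r′ = subst (_ε Q) (Matching.injective θ r′ r) x′∈
        bijection : ∀ {A B} → Maps P Q P′ Q′ θ A B → Covers P Q P′ Q′ θ A B → Bijection A B
        bijection m c = restrict θ m , λ y y∈ → let (x , x∈ , r) = c y y∈ in
          x , restrict⁺ θ m x∈ y∈ r
        mt : Maps P Q P′ Q′ θ t t′
        mt x x∈ = let (y , y∈ , r) = mP x (t⊂P x x∈) in y , sep⁺ y∈ (Q⇒ r (t⊂Q x x∈)) , r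
        ct : Covers P Q P′ Q′ θ t t′
        ct y y∈ = let (x , x∈ , r) = cP y (t′⊂P′ y y∈) in x , sep⁺ x∈ (Q⇐ r (t′⊂Q′ y y∈)) , r
        mb : Maps P Q P′ Q′ θ b b′
        mb x x∈ = let (y , y∈ , r) = mP x (b⊂P x x∈) in y , sep⁺ y∈ (λ q → proj₂ (sep⁻ x∈) (Q⇐ r q)) , r
        cb : Covers P Q P′ Q′ θ b b′
        cb y y∈ = let (x , x∈ , r) = cP y (b′⊂P′ y y∈) in x , sep⁺ x∈ (λ q → proj₂ (sep⁻ y∈) (Q⇒ r q)) , r
        mn : Maps P Q P′ Q′ θ n n′
        mn x x∈ = let (y , y∈ , r) = mQ x (n⊂Q x x∈) in y , sep⁺ y∈ (λ q → proj₂ (sep⁻ x∈) (P⇐ r q)) , r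
        cn : Covers P Q P′ Q′ θ n n′
        cn y y∈ = let (x , x∈ , r) = cQ y (n′⊂Q′ y y∈) in x , sep⁺ x∈ (λ q → proj₂ (sep⁻ y∈) (P⇒ r q)) , r
      from : Bijection t t′ × Bijection b b′ × Bijection n n′ →
        Σ (Matching X X′) λ θ → (Maps P Q P′ Q′ θ P P′ × Maps P Q P′ Q′ θ Q Q′)
                             × (Covers P Q P′ Q′ θ P P′ × Covers P Q P′ Q′ θ Q Q′)
      from ((ft , ot) , (fb , ob) , (fn , on)) = _↣_.matching all , (maps-P , maps-Q) , (covers-P , covers-Q)
        where
        et : t ↣ X′
        et = inclusion t′⊂X′ ∘↣ ft
        eb : b ↣ X′
        eb = inclusion b′⊂X′ ∘↣ fb
        en : n ↣ X′
        en = inclusion n′⊂X′ ∘↣ fn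
        b-n : Disjoint eb en
        b-n = apart-disjoint b′⊂X′ n′⊂X′ fb fn b′∥n′
        ebn : b ∪ n ↣ X′
        ebn = glue (λ _ → ∪⁻) eb en b-n
        t-bn : Disjoint et ebn
        t-bn = Disjoint-glue (λ _ → ∪⁻) eb en b-n et
          (apart-disjoint t′⊂X′ b′⊂X′ ft fb t′∥b′) (apart-disjoint t′⊂X′ n′⊂X′ ft fn t′∥n′)
        all : X ↣ X′
        all = glue splitX et ebn t-bn
        cases : ∀ {x y} → graph all [ x , y ] → graph ft [ x , y ] ⊎ graph fb [ x , y ] ⊎ graph fn [ x , y ]
        cases p with glue⁻ splitX et ebn t-bn p
        ... | inj₁ q = inj₁ (inclusion∘⁻ t′⊂X′ ft q)
        ... | inj₂ q with glue⁻ (λ _ → ∪⁻) eb en b-n q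
        ...   | inj₁ r = inj₂ (inj₁ (inclusion∘⁻ b′⊂X′ fb r))
        ...   | inj₂ r = inj₂ (inj₂ (inclusion∘⁻ n′⊂X′ fn r))
        maps-P : Maps P Q P′ Q′ (_↣_.matching all) P P′
        maps-P x x∈ with total all (P⊂X x x∈)
        ... | y , p with cases p
        ...   | inj₁ q = y , t′⊂P′ y (target ft q) , p
        ...   | inj₂ (inj₁ q) = y , b′⊂P′ y (target fb q) , p
        ...   | inj₂ (inj₂ q) = ⊥-elim (proj₂ (sep⁻ (source fn q)) x∈)
        maps-Q : Maps P Q P′ Q′ (_↣_.matching all) Q Q′
        maps-Q x x∈ with total all (Q⊂X x x∈)
        ... | y , p with cases p
        ...   | inj₁ q = y , t′⊂Q′ y (target ft q) , p
        ...   | inj₂ (inj₁ q) = ⊥-elim (proj₂ (sep⁻ (source fb q)) x∈)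
        ...   | inj₂ (inj₂ q) = y , n′⊂Q′ y (target fn q) , p
        t-graph : ∀ {x y} → graph ft [ x , y ] → graph all [ x , y ]
        t-graph p with total all (t⊂X _ (source ft p))
        ... | y , q with cases q
        ...   | inj₁ r = subst (λ v → graph all [ _ , v ]) (functional ft r p) q
        ...   | inj₂ (inj₁ r) = ⊥-elim (t∥b _ (source ft p) (source fb r))
        ...   | inj₂ (inj₂ r) = ⊥-elim (t∥n _ (source ft p) (source fn r))
        b-graph : ∀ {x y} → graph fb [ x , y ] → graph all [ x , y ]
        b-graph p with total all (b⊂X _ (source fb p))
        ... | y , q with cases q
        ...   | inj₁ r = ⊥-elim (t∥b _ (source ft r) (source fb p))
        ...   | inj₂ (inj₁ r) = subst (λ v → graph all [ _ , v ]) (functional fb r p) q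
        ...   | inj₂ (inj₂ r) = ⊥-elim (b∥n _ (source fb p) (source fn r))
        n-graph : ∀ {x y} → graph fn [ x , y ] → graph all [ x , y ]
        n-graph p with total all (n⊂X _ (source fn p))
        ... | y , q with cases q
        ...   | inj₁ r = ⊥-elim (t∥n _ (source ft r) (source fn p))
        ...   | inj₂ (inj₁ r) = ⊥-elim (b∥n _ (source fb r) (source fn p))
        ...   | inj₂ (inj₂ r) = subst (λ v → graph all [ _ , v ]) (functional fn r p) q
        covers-P : Covers P Q P′ Q′ (_↣_.matching all) P P′
        covers-P y y∈ with splitP′ y y∈
        ... | inj₁ y∈t = let (x , p) = ot y y∈t in x , t⊂P x (source ft p) , t-graph p
        ... | inj₂ y∈b = let (x , p) = ob y y∈b in x , b⊂P x (source fb p) , b-graph p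
        covers-Q : Covers P Q P′ Q′ (_↣_.matching all) Q Q′
        covers-Q y y∈ with splitQ′ y y∈
        ... | inj₁ y∈t = let (x , p) = ot y y∈t in x , t⊂Q x (source ft p) , t-graph p
        ... | inj₂ y∈n = let (x , p) = on y y∈n in x , n⊂Q x (source fn p) , n-graph p

-- Countings and the matchings they induce

module Countings {ℓ : Level} (𝒮 : Structure ℓ) (zfc : ZFC 𝒮) where
  open Structure 𝒮
  open Language 𝒮
  open ZFC zfc
  open SetTheory 𝒮 zfc
  open _↣_ using (graph; source; target; functional; injective; total)

  record IsCounting (f X : V) : Set ℓ where
    field
      cla    : Cla f
      pairs  : ∀ p → p ε f → Σ V λ x → Σ V λ y → p ≡ pair x y
      fun    : ∀ x y y′ → f [ x , y ] → f [ x , y′ ] → y ≡ y′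
      inj    : ∀ x x′ y → f [ x , y ] → f [ x′ , y ] → x ≡ x′
      domain : ∀ x → x ε X ⇔ (Σ V λ y → f [ x , y ])

  Linked : V → V → V → V → Set ℓ
  Linked f g x y = Σ V λ z → f [ x , z ] × g [ y , z ]

  matched : ∀ {f g X Y} → IsCounting f X → IsCounting g Y →
    Σ (Matching X Y) λ θ → ∀ x y → Matching.graph θ [ x , y ] ⇔ Linked f g x y
  matched {f} {g} F G = matchingBy (∃′ (# f [ x₁ , x₀ ]′ ∧′ # g [ x₂ , x₀ ]′))
    (λ { _ _ _ (z , p , q) (z′ , p′ , q′) → G.inj _ _ _ q (subst (λ v → g [ _ , v ]) (F.fun _ _ _ p′ p) q′) })
    (λ { _ _ _ (z , p , q) (z′ , p′ , q′) → F.inj _ _ _ p (subst (λ v → f [ _ , v ]) (G.fun _ _ _ q′ q) p′) })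
    , λ x y → (λ r → proj₂ (proj₂ (rel⁻ r)))
            , λ (z , p , q) → rel⁺ (proj₂ (F.domain x) (z , p)) (proj₂ (G.domain y) (z , q)) (z , p , q)
    where
    module F = IsCounting F
    module G = IsCounting G

  -- The graph of an injection may be non-classical and contain elements that are not pairs.
  -- Separating its pairs again removes both defects.
  counted : ∀ {A B} (f : A ↣ B) → IsCounting (rel A B (# graph f [ x₀ , x₁ ]′)) A
  counted f = record
    { cla = rel-Cla
    ; pairs = λ p → rel-pair
    ; fun = λ x y y′ p q → functional f (proj₂ (proj₂ (rel⁻ p))) (proj₂ (proj₂ (rel⁻ q)))
    ; inj = λ x x′ y p q → injective f (proj₂ (proj₂ (rel⁻ p))) (proj₂ (proj₂ (rel⁻ q)))
    ; domain = λ x → (λ a → let (y , p) = total f a in y , rel⁺ a (target f p) p) , λ (y , p) → proj₁ (rel⁻ p) }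

  -- The countings send y to itself, and x to its partner if it has one and outside
  -- Y otherwise.
  realised : ∀ {X Y} (θ : Matching X Y) → Σ V λ f → Σ V λ g → IsCounting f X × IsCounting g Y
    × (∀ x y → Linked f g x y ⇔ Matching.graph θ [ x , y ])
  realised {X} {Y} θ = f , g , counted φ , counted (ι₂ {X} {Y}) , λ x y → to , from
    where
    h : V
    h = Matching.graph θ
    P : V → V → Set ℓ
    P x z = (Σ V λ y → h [ x , y ] × z ≡ inr y) ⊎ (¬ (Σ V λ y → h [ x , y ]) × z ≡ inl x)
    tot : ∀ {x} → x ε X → Σ V λ z → z ε X ⊕ Y × P x z
    tot {x} x∈ with em {Σ V λ y → h [ x , y ]}
    ... | yes (y , p) = inr y , inr∈ (Matching.target θ p) , inj₁ (y , p , refl)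
    ... | no none = inl x , inl∈ x∈ , inj₂ (none , refl)
    fun : ∀ {x z z′} → P x z → P x z′ → z ≡ z′
    fun (inj₁ (y , p , refl)) (inj₁ (y′ , p′ , refl)) = cong inr (Matching.functional θ p p′)
    fun (inj₁ (y , p , _)) (inj₂ (none , _)) = ⊥-elim (none (y , p))
    fun (inj₂ (none , _)) (inj₁ (y , p , _)) = ⊥-elim (none (y , p))
    fun (inj₂ (_ , refl)) (inj₂ (_ , refl)) = refl
    inj : ∀ {x x′ z} → P x z → P x′ z → x ≡ x′
    inj (inj₁ (y , p , refl)) (inj₁ (y′ , p′ , e)) with inr-injective e
    ... | refl = Matching.injective θ p p′
    inj (inj₁ (y , p , refl)) (inj₂ (_ , e)) = ⊥-elim (inl≢inr (sym e))
    inj (inj₂ (_ , refl)) (inj₁ (y , p , e)) = ⊥-elim (inl≢inr e)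
    inj (inj₂ (_ , refl)) (inj₂ (_ , e)) = inl-injective e
    φ : X ↣ X ⊕ Y
    φ = injectionBy ((∃′ (# h [ x₁ , x₀ ]′ ∧′ x₂ ≡⟨ # i , x₀ ⟩′)) ∨′ ((¬′ (∃′ # h [ x₁ , x₀ ]′)) ∧′ x₁ ≡⟨ # o , x₀ ⟩′))
      tot (λ _ _ _ → fun) (λ _ _ _ → inj)
    f g : V
    f = rel X (X ⊕ Y) (# graph φ [ x₀ , x₁ ]′)
    g = rel Y (X ⊕ Y) (# graph ι₂ [ x₀ , x₁ ]′)
    to : ∀ {x y} → Linked f g x y → h [ x , y ]
    to (z , p , q) = partner (proj₂ (proj₂ (rel⁻ (proj₂ (proj₂ (rel⁻ p)))))) (ι₂⁻ (proj₂ (proj₂ (rel⁻ q))))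
      where
      partner : ∀ {x y z} → P x z → z ≡ inr y → h [ x , y ]
      partner (inj₁ (y , p , refl)) e = subst (λ v → h [ _ , v ]) (inr-injective e) p
      partner (inj₂ (_ , refl)) e = ⊥-elim (inl≢inr e)
    from : ∀ {x y} → h [ x , y ] → Linked f g x y
    from {x} {y} p = inr y , rel⁺ x∈ y∈′ (rel⁺ x∈ y∈′ (inj₁ (y , p , refl))) , rel⁺ y∈ y∈′ g∋
      where
      x∈ : x ε X
      x∈ = Matching.source θ p
      y∈ : y ε Y
      y∈ = Matching.target θ p
      y∈′ : inr y ε X ⊕ Y
      y∈′ = inr∈ y∈
      g∋ : graph ι₂ [ y , inr y ]
      g∋ = let (z , q) = total (ι₂ {X} {Y}) y∈ in subst (λ v → graph ι₂ [ y , v ]) (ι₂⁻ q) q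

open import Defs

-- Renaming of variables in BS4

module Renaming {ℓ : Level} (𝔐 : Model ℓ) where
  open Model 𝔐 renaming (Carrier to M)

  Agrees : ∀ {m n} → (Fin m → Fin n) → Vec M n → Vec M m → Set ℓ
  Agrees r ρ σ = ∀ i → lookup ρ (r i) ≡ lookup σ i

  lift-agrees : ∀ {m n} {r : Fin m → Fin n} {ρ σ} a → Agrees r ρ σ → Agrees (lift r) (a ∷ ρ) (a ∷ σ)
  lift-agrees a e zero    = refl
  lift-agrees a e (suc i) = e i

  mutual
    ren-T : ∀ {m n} (φ : Formula m) {r : Fin m → Fin n} {ρ σ} → Agrees r ρ σ → T 𝔐 (ren r φ) ρ ⇔ T 𝔐 φ σ
    ren-T (x ∈ y)   e rewrite e x | e y = ⇔-refl
    ren-T (x ≐ y)   e rewrite e x | e y = ⇔-refl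
    ren-T ⊥ᶠ        e = ⇔-refl
    ren-T (∼ φ)     e = ren-F φ e
    ren-T (φ ∧ ψ)   e = ren-T φ e ⇔-× ren-T ψ e
    ren-T (φ ∨ ψ)   e = ren-T φ e ⇔-⊎ ren-T ψ e
    ren-T (φ ⟶ ψ)  e = ren-T φ e ⇔-→ ren-T ψ e
    ren-T (φ ⟷ ψ)  e = (ren-T φ e ⇔-→ ren-T ψ e) ⇔-× (ren-T ψ e ⇔-→ ren-T φ e)
    ren-T (∀ᶠ φ)    e = ⇔-Π λ a → ren-T φ (lift-agrees a e)
    ren-T (∃ᶠ φ)    e = ⇔-Σ λ a → ren-T φ (lift-agrees a e)

    ren-F : ∀ {m n} (φ : Formula m) {r : Fin m → Fin n} {ρ σ} → Agrees r ρ σ → F 𝔐 (ren r φ) ρ ⇔ F 𝔐 φ σ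
    ren-F (x ∈ y)   e rewrite e x | e y = ⇔-refl
    ren-F (x ≐ y)   e rewrite e x | e y = ⇔-refl
    ren-F ⊥ᶠ        e = ⇔-refl
    ren-F (∼ φ)     e = ren-T φ e
    ren-F (φ ∧ ψ)   e = ren-F φ e ⇔-⊎ ren-F ψ e
    ren-F (φ ∨ ψ)   e = ren-F φ e ⇔-× ren-F ψ e
    ren-F (φ ⟶ ψ)  e = ren-T φ e ⇔-× ren-F ψ e
    ren-F (φ ⟷ ψ)  e = (ren-T φ e ⇔-× ren-F ψ e) ⇔-⊎ (ren-F φ e ⇔-× ren-T ψ e)
    ren-F (∀ᶠ φ)    e = ⇔-Σ λ a → ren-F φ (lift-agrees a e)
    ren-F (∃ᶠ φ)    e = ⇔-Π λ a → ren-F φ (lift-agrees a e)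

  open-T : ∀ {n} (φ : Formula n) → T 𝔐 (close φ) [] → ∀ ρ → T 𝔐 φ ρ
  open-T {zero}  φ t []      = t
  open-T {suc n} φ t (a ∷ ρ) = open-T (∀ᶠ φ) t ρ a

-- Classical set theory inside a model of BZFC

module Foundations {ℓ : Level} (em : ExcludedMiddle ℓ) (𝔐 : Model ℓ) (axiom : ∀ ψ → BZFC ψ → T 𝔐 ψ []) where
  open Model 𝔐 renaming (Carrier to M)
  open Renaming 𝔐

  byContradiction : {P : Set ℓ} → ¬ ¬ P → P
  byContradiction = em⇒dne em

  de-Morgan : {P Q : Set ℓ} → ((¬ P) ⊎ (¬ Q)) ⇔ (¬ (P × Q))
  de-Morgan {P} {Q} = (λ { (inj₁ n) (p , _) → n p ; (inj₂ n) (_ , q) → n q }) , from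
    where
    from : ¬ (P × Q) → (¬ P) ⊎ (¬ Q)
    from n with em {P}
    ... | no ¬p = inj₁ ¬p
    ... | yes p = inj₂ λ q → n (p , q)

  -- c is the set {x : φ(x)}, where φ is true of P and false of N.
  Is : M → (M → Set ℓ) → (M → Set ℓ) → Set ℓ
  Is c P N = ∀ x → (x ∈⁺ c ⇔ P x) × (x ∈⁻ c ⇔ N x)

  ⟦_⟧⁺ ⟦_⟧⁻ : ∀ {n} → Class n → Vec M n → M → Set ℓ
  ⟦ φ ⟧⁺ ρ x = T 𝔐 φ (x ∷ ρ)
  ⟦ φ ⟧⁻ ρ x = F 𝔐 φ (x ∷ ρ)

  extensional : ∀ {a b} → (∀ x → (x ∈⁺ a ⇔ x ∈⁺ b) × (x ∈⁻ a ⇔ x ∈⁻ b)) → a ≡ b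
  extensional {a} {b} = proj₂ (proj₁ (axiom _ extensionality a b))

  Is-unique : ∀ {c d P N} → Is c P N → Is d P N → c ≡ d
  Is-unique p q = extensional λ x →
    ⇔-trans (proj₁ (p x)) (⇔-sym (proj₁ (q x))) , ⇔-trans (proj₂ (p x)) (⇔-sym (proj₂ (q x)))

  Cl : M → Set ℓ
  Cl c = ∀ x → x ∈⁺ c ⇔ (¬ x ∈⁻ c)

  Cl⁻ : ∀ {n} (i : Fin n) ρ → T 𝔐 (Classical i) ρ → Cl (lookup ρ i)
  Cl⁻ i ρ t x = (λ p q → ⊥-elim (lower (proj₁ (t x) (p , tt) q))) , λ p → proj₁ (proj₂ (t x) λ q → ⊥-elim (p q))

  Cl⁺ : ∀ {n} (i : Fin n) ρ → Cl (lookup ρ i) → T 𝔐 (Classical i) ρ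
  Cl⁺ i ρ c x = (λ (p , _) q → ⊥-elim (proj₁ (c x) p q)) , λ p → proj₂ (c x) (λ q → lower (p q)) , tt

  Cl-∉ : ∀ {c x} → Cl c → ¬ x ∈⁺ c → x ∈⁻ c
  Cl-∉ {x = x} cl p = byContradiction λ q → p (proj₂ (cl x) q)

  Cl-ext : ∀ {a b} → Cl a → Cl b → (∀ x → x ∈⁺ a ⇔ x ∈⁺ b) → a ≡ b
  Cl-ext ca cb e = extensional λ x → e x ,
    (λ p → Cl-∉ cb λ q → proj₁ (ca x) (proj₂ (e x) q) p) , (λ p → Cl-∉ ca λ q → proj₁ (cb x) (proj₁ (e x) q) p)

  abstract
    compr : ∀ {n} (φ : Class n) ρ A →
      Σ M λ B → Is B (λ x → x ∈⁺ A × ⟦ φ ⟧⁺ ρ x) (λ x → x ∈⁻ A ⊎ ⟦ φ ⟧⁻ ρ x)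
    compr φ ρ A with open-T _ (axiom _ (comprehension (wk φ))) ρ A
    ... | B , e = B , λ x →
      ⇔-trans (proj₁ (e x)) (⇔-refl ⇔-× ⇔-trans (ren-T (wk φ) {ρ = x ∷ B ∷ A ∷ ρ} {σ = x ∷ A ∷ ρ} (agree₁ x))
                                                (ren-T φ {ρ = x ∷ A ∷ ρ} {σ = x ∷ ρ} (agree₂ x)))
      , ⇔-trans (proj₂ (e x)) (⇔-refl ⇔-⊎ ⇔-trans (ren-F (wk φ) {ρ = x ∷ B ∷ A ∷ ρ} {σ = x ∷ A ∷ ρ} (agree₁ x))
                                                (ren-F φ {ρ = x ∷ A ∷ ρ} {σ = x ∷ ρ} (agree₂ x)))
      where
      agree₁ : ∀ x → Agrees (lift suc) (x ∷ B ∷ A ∷ ρ) (x ∷ A ∷ ρ)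
      agree₁ x = λ { zero → refl ; (suc i) → refl }
      agree₂ : ∀ x → Agrees (lift suc) (x ∷ A ∷ ρ) (x ∷ ρ)
      agree₂ x = λ { zero → refl ; (suc i) → refl }

    -- Comprehension intersects the class with `C`, which adds falsity wherever membership in `C` is
    -- false. The two conditions ensure that neither truth nor falsity changes.
    bounded : ∀ {n} (φ : Class n) ρ C → (∀ x → ⟦ φ ⟧⁺ ρ x → x ∈⁺ C) → (∀ x → x ∈⁻ C → ⟦ φ ⟧⁻ ρ x) →
      Σ M λ B → Is B (⟦ φ ⟧⁺ ρ) (⟦ φ ⟧⁻ ρ)
    bounded φ ρ C pos neg with compr φ ρ C
    ... | B , e = B , λ x → ⇔-trans (proj₁ (e x)) (proj₂ , λ p → pos x p , p)
                          , ⇔-trans (proj₂ (e x)) ((λ { (inj₁ p) → neg x p ; (inj₂ p) → p }) , inj₂)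

    superset : ∀ A → Σ M λ C → Cl C × (∀ x → x ∈⁺ A → x ∈⁺ C) × (∀ x → x ∈⁻ C → x ∈⁻ A)
    superset A with axiom _ classicalSuperset A
    ... | C , cl , sub = C , Cl⁻ v₀ (C ∷ A ∷ []) cl , (λ x → proj₁ (sub x)) , (λ x → proj₂ (sub x))

    -- Intersecting with `A` directly would inherit its non-classical membership. Instead the whole
    -- condition, `x ∈ A` included, is put under `!` and cut out of a classical superset.
    separate : ∀ {n} (φ : Class n) ρ A → Σ M λ B → Cl B × (∀ x → x ∈⁺ B ⇔ (x ∈⁺ A × ⟦ φ ⟧⁺ ρ x))
    separate φ ρ A with superset A
    ... | C , cl , A⊆C , _ with compr (!ᶠ (v₀ ∈ v₁ ∧ wk φ)) (A ∷ ρ) C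
    ...   | B , e = B , (λ x → to x , from x) , mem
      where
      wk-φ : ∀ x → T 𝔐 (wk φ) (x ∷ A ∷ ρ) ⇔ T 𝔐 φ (x ∷ ρ)
      wk-φ x = ren-T φ {ρ = x ∷ A ∷ ρ} λ { zero → refl ; (suc i) → refl }
      mem : ∀ x → x ∈⁺ B ⇔ (x ∈⁺ A × ⟦ φ ⟧⁺ ρ x)
      mem x = ⇔-trans (proj₁ (e x))
        ((λ { (_ , (a , p) , _) → a , proj₁ (wk-φ x) p }) , λ { (a , p) → A⊆C x a , (a , proj₂ (wk-φ x) p) , tt })
      to : ∀ x → x ∈⁺ B → ¬ x ∈⁻ B
      to x p q with proj₁ (proj₂ (e x)) q
      ... | inj₁ r = proj₁ (cl x) (A⊆C x (proj₁ (proj₁ (mem x) p))) r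
      ... | inj₂ r = ⊥-elim (lower (r (let (a , b) = proj₁ (mem x) p in a , proj₂ (wk-φ x) b)))
      from : ∀ x → ¬ x ∈⁻ B → x ∈⁺ B
      from x p = byContradiction λ q →
        p (proj₂ (proj₂ (e x)) (inj₂ λ (a , b) → ⊥-elim (q (proj₂ (mem x) (a , proj₁ (wk-φ x) b)))))

  _⁺ : M → M
  A ⁺ = proj₁ (separate (v₀ ≐ v₀) [] A)

  ⁺-Cl : ∀ A → Cl (A ⁺)
  ⁺-Cl A = proj₁ (proj₂ (separate (v₀ ≐ v₀) [] A))

  ∈-⁺ : ∀ {A x} → x ∈⁺ A ⁺ ⇔ x ∈⁺ A
  ∈-⁺ {A} {x} = ⇔-trans (proj₂ (proj₂ (separate (v₀ ≐ v₀) [] A)) x) (proj₁ , λ p → p , refl)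

  replace : ∀ {n} (φ : Formula (suc (suc n))) ρ A →
    (∀ x → x ∈⁺ A → ∀ y y′ → T 𝔐 φ (x ∷ y ∷ ρ) → T 𝔐 φ (x ∷ y′ ∷ ρ) → y ≡ y′) →
    Σ M λ B → Cl B × (∀ y → y ∈⁺ B ⇔ (Σ M λ x → x ∈⁺ A × T 𝔐 φ (x ∷ y ∷ ρ)))
  replace {n} φ ρ A single = B ⁺ , ⁺-Cl B , λ y → ⇔-trans ∈-⁺ (mem y)
    where
    -- The formula of the scheme may mention the set itself, whose variable comes third; `s` skips
    -- it.
    s : Fin (suc (suc n)) → Fin (suc (suc (suc n)))
    s zero          = zero
    s (suc zero)    = suc zero
    s (suc (suc i)) = ↑₃ i
    A′ : M
    A′ = A ⁺
    shrink : ∀ x y → T 𝔐 (ren s φ) (x ∷ y ∷ A′ ∷ ρ) ⇔ T 𝔐 φ (x ∷ y ∷ ρ)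
    shrink x y = ren-T φ {ρ = x ∷ y ∷ A′ ∷ ρ} λ { zero → refl ; (suc zero) → refl ; (suc (suc i)) → refl }
    result : Σ M λ B → ∀ y → _
    result = open-T _ (axiom _ (replacement (ren s φ))) ρ A′
      ( Cl⁺ v₀ (A′ ∷ ρ) (⁺-Cl A)
      , λ x x∈ y y′ (p , q) → single x (proj₁ ∈-⁺ x∈) y y′
          (proj₁ (shrink x y) (proj₁ (ren-T (ren s φ) {σ = x ∷ y ∷ A′ ∷ ρ}
              λ { zero → refl ; (suc zero) → refl ; (suc (suc i)) → refl }) p))
          (proj₁ (shrink x y′) (proj₁ (ren-T (ren s φ) {σ = x ∷ y′ ∷ A′ ∷ ρ}
              λ { zero → refl ; (suc zero) → refl ; (suc (suc i)) → refl }) q))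
        , tt )
    B : M
    B = proj₁ result
    mem : ∀ y → y ∈⁺ B ⇔ (Σ M λ x → x ∈⁺ A × T 𝔐 φ (x ∷ y ∷ ρ))
    mem y = ⇔-trans (proj₁ (proj₂ result y)) (⇔-Σ λ x → ∈-⁺ ⇔-× ⇔-trans (proj₁ , (_, tt))
      (⇔-trans (ren-T (ren s φ at v₀ , v₁ above ↑₂) {σ = x ∷ y ∷ A′ ∷ ρ}
            λ { zero → refl ; (suc zero) → refl ; (suc (suc i)) → refl })
        (⇔-trans (ren-T (ren s φ) {σ = x ∷ y ∷ A′ ∷ ρ}
            λ { zero → refl ; (suc zero) → refl ; (suc (suc i)) → refl }) (shrink x y))))

  abstract
    bigcup : ∀ A → Σ M λ U → Cl U × (∀ x → x ∈⁺ U ⇔ (Σ M λ y → x ∈⁺ y × y ∈⁺ A))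
    bigcup A with axiom _ union A
    ... | U , e = U ⁺ , ⁺-Cl U , λ x → ⇔-trans ∈-⁺ (proj₁ (e x))

  Upair : M → M → M → Set ℓ
  Upair c a b = T 𝔐 (v₀ ≗ Pair v₁ v₂) (c ∷ a ∷ b ∷ [])

  upair∃ : ∀ a b → Σ M λ c → Upair c a b
  upair∃ a b = axiom _ pairing a b

  abstract
    upair : M → M → M
    upair a b = proj₁ (upair∃ a b)

    upair-is : ∀ a b → Upair (upair a b) a b
    upair-is a b = proj₂ (upair∃ a b)

  Upair-unique : ∀ {c d a b} → Upair c a b → Upair d a b → c ≡ d
  Upair-unique = Is-unique

  ∈-upair : ∀ {a b} x → x ∈⁺ upair a b ⇔ (x ≡ a ⊎ x ≡ b)
  ∈-upair {a} {b} x = ⇔-trans (proj₁ (upair-is a b x)) ((proj₁ , (_, tt)) ⇔-⊎ (proj₁ , (_, tt)))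

  Empty : M → Set ℓ
  Empty c = T 𝔐 (v₀ ≗ ∅) (c ∷ [])

  empty∃ : Σ M Empty
  empty∃ with separate ⊥ᶠ [] inhabited
  ... | E , cl , e = E , λ x → ((λ p → ⊥-elim (lower (proj₂ (proj₁ (e x) p)))) , λ p → ⊥-elim (lower p))
                             , ((λ _ → tt) , λ _ → Cl-∉ cl λ p → lower (proj₂ (proj₁ (e x) p)))

  abstract
    ∅ᴹ : M
    ∅ᴹ = proj₁ empty∃

    ∅-is : Empty ∅ᴹ
    ∅-is = proj₂ empty∃

  ∉-∅ : ∀ x → ¬ x ∈⁺ ∅ᴹ
  ∉-∅ x p = lower (proj₁ (proj₁ (∅-is x)) p)

  abstract
    union₂ : ∀ A B → Σ M λ C → Cl C × (∀ x → x ∈⁺ C ⇔ (x ∈⁺ A ⊎ x ∈⁺ B))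
    union₂ A B with bigcup (upair A B)
    ... | C , cl , e = C , cl , λ x → ⇔-trans (e x)
      ((λ (y , p , q) → to p (proj₁ (∈-upair y) q))
      , λ { (inj₁ p) → A , p , proj₂ (∈-upair A) (inj₁ refl) ; (inj₂ p) → B , p , proj₂ (∈-upair B) (inj₂ refl) })
      where
      to : ∀ {x y} → x ∈⁺ y → y ≡ A ⊎ y ≡ B → x ∈⁺ A ⊎ x ∈⁺ B
      to p (inj₁ refl) = inj₁ p
      to p (inj₂ refl) = inj₂ p

  tag₀ tag₁ : M → M
  tag₀ u = upair (upair u u) ∅ᴹ
  tag₁ u = upair (upair u u) (upair u u)

  IsTag₀ IsTag₁ : M → M → Set ℓ
  IsTag₀ w u = T 𝔐 (Tag₀ v₀ v₁) (w ∷ u ∷ [])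
  IsTag₁ w u = T 𝔐 (Tag₁ v₀ v₁) (w ∷ u ∷ [])

  is-tag₀ : ∀ {w u} → IsTag₀ w u ⇔ w ≡ tag₀ u
  is-tag₀ {w} {u} = to , λ { refl → upair u u , upair-is u u , ∅ᴹ , ∅-is , upair-is _ _ }
    where
    to : IsTag₀ w u → w ≡ tag₀ u
    to (s , s-is , e , e-is , w-is) with Upair-unique s-is (upair-is u u) | Is-unique e-is ∅-is
    ... | refl | refl = Upair-unique w-is (upair-is _ _)

  is-tag₁ : ∀ {w u} → IsTag₁ w u ⇔ w ≡ tag₁ u
  is-tag₁ {w} {u} = to , λ { refl → upair u u , upair-is u u , upair-is _ _ }
    where
    to : IsTag₁ w u → w ≡ tag₁ u
    to (s , s-is , w-is) with Upair-unique s-is (upair-is u u)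
    ... | refl = Upair-unique w-is (upair-is _ _)

  singleton-injective : ∀ {u v} → upair u u ≡ upair v v → u ≡ v
  singleton-injective {u} {v} e with proj₁ (∈-upair {v} {v} u) (subst (u ∈⁺_) e (proj₂ (∈-upair u) (inj₁ refl)))
  ... | inj₁ p = p
  ... | inj₂ p = p

  singleton≢∅ : ∀ {u} → ¬ upair u u ≡ ∅ᴹ
  singleton≢∅ {u} e = ∉-∅ u (subst (u ∈⁺_) e (proj₂ (∈-upair u) (inj₁ refl)))

  tag₀-injective : ∀ {u v} → tag₀ u ≡ tag₀ v → u ≡ v
  tag₀-injective {u} {v} e
    with proj₁ (∈-upair {upair v v} {∅ᴹ} (upair u u)) (subst (upair u u ∈⁺_) e (proj₂ (∈-upair _) (inj₁ refl)))
  ... | inj₁ p = singleton-injective p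
  ... | inj₂ p = ⊥-elim (singleton≢∅ p)

  tag₁-injective : ∀ {u v} → tag₁ u ≡ tag₁ v → u ≡ v
  tag₁-injective e = singleton-injective (singleton-injective e)

  tag₀≢tag₁ : ∀ {u v} → ¬ tag₀ u ≡ tag₁ v
  tag₀≢tag₁ {u} {v} e with proj₁ (∈-upair {upair v v} {upair v v} ∅ᴹ) (subst (∅ᴹ ∈⁺_) e (proj₂ (∈-upair _) (inj₂ refl)))
  ... | inj₁ p = singleton≢∅ (sym p)
  ... | inj₂ p = singleton≢∅ (sym p)

  IsPair : M → M → M → Set ℓ
  IsPair p x y = T 𝔐 (v₀ ≗ OrdPair v₁ v₂) (p ∷ x ∷ y ∷ [])

  -- The bound has to contain every point at which the class is not false, whether or not it is true
  -- there. Tagging classical supersets of `x` and `y` achieves this.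
  pair∃ : ∀ x y → Σ M λ p → IsPair p x y
  pair∃ x y = bounded (OrdPair v₀ v₁) (x ∷ y ∷ []) C pos neg
    where
    tags₀ : Σ M λ B → Cl B × (∀ w → w ∈⁺ B ⇔ (Σ M λ u → u ∈⁺ proj₁ (superset x) × IsTag₀ w u))
    tags₀ = replace (Tag₀ v₁ v₀) [] (proj₁ (superset x))
      λ u _ w w′ p q → trans (proj₁ is-tag₀ p) (sym (proj₁ is-tag₀ q))
    tags₁ : Σ M λ B → Cl B × (∀ w → w ∈⁺ B ⇔ (Σ M λ u → u ∈⁺ proj₁ (superset y) × IsTag₁ w u))
    tags₁ = replace (Tag₁ v₁ v₀) [] (proj₁ (superset y))
      λ u _ w w′ p q → trans (proj₁ is-tag₁ p) (sym (proj₁ is-tag₁ q))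
    both : Σ M λ C → Cl C × (∀ w → w ∈⁺ C ⇔ (w ∈⁺ proj₁ tags₀ ⊎ w ∈⁺ proj₁ tags₁))
    both = union₂ (proj₁ tags₀) (proj₁ tags₁)
    C : M
    C = proj₁ both
    reach₀ : ∀ {w u} → IsTag₀ w u → u ∈⁺ proj₁ (superset x) → w ∈⁺ C
    reach₀ {w} t m = proj₂ (proj₂ (proj₂ both) w) (inj₁ (proj₂ (proj₂ (proj₂ tags₀) w) (_ , m , t)))
    reach₁ : ∀ {w u} → IsTag₁ w u → u ∈⁺ proj₁ (superset y) → w ∈⁺ C
    reach₁ {w} t m = proj₂ (proj₂ (proj₂ both) w) (inj₂ (proj₂ (proj₂ (proj₂ tags₁) w) (_ , m , t)))
    outside : ∀ {a u} → ¬ u ∈⁺ proj₁ (superset a) → u ∈⁻ a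
    outside {a} {u} p = proj₂ (proj₂ (proj₂ (superset a))) u (Cl-∉ (proj₁ (proj₂ (superset a))) p)
    pos : ∀ w → ⟦ OrdPair v₀ v₁ ⟧⁺ (x ∷ y ∷ []) w → w ∈⁺ C
    pos w (inj₁ (u , t , m)) = reach₀ t (proj₁ (proj₂ (proj₂ (superset x))) u m)
    pos w (inj₂ (u , t , m)) = reach₁ t (proj₁ (proj₂ (proj₂ (superset y))) u m)
    neg : ∀ w → w ∈⁻ C → ⟦ OrdPair v₀ v₁ ⟧⁻ (x ∷ y ∷ []) w
    neg w w∉ = (λ u t → outside {x} λ m → proj₁ (proj₁ (proj₂ both) w) (reach₀ t m) w∉)
             , (λ u t → outside {y} λ m → proj₁ (proj₁ (proj₂ both) w) (reach₁ t m) w∉)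

  abstract
    pairᴹ : M → M → M
    pairᴹ x y = proj₁ (pair∃ x y)

    pair-is : ∀ x y → IsPair (pairᴹ x y) x y
    pair-is x y = proj₂ (pair∃ x y)

  is-pair : ∀ {p x y} → IsPair p x y ⇔ p ≡ pairᴹ x y
  is-pair {p} {x} {y} = (λ i → Is-unique i (pair-is x y)) , λ { refl → pair-is x y }

  private
    first⁺ : ∀ {x y} u → u ∈⁺ x ⇔ tag₀ u ∈⁺ pairᴹ x y
    first⁺ {x} {y} u = (λ m → proj₂ (proj₁ (pair-is x y (tag₀ u))) (inj₁ (u , proj₂ is-tag₀ refl , m)))
      , λ m → from (proj₁ (proj₁ (pair-is x y (tag₀ u))) m)
      where
      from : ⟦ OrdPair v₀ v₁ ⟧⁺ (x ∷ y ∷ []) (tag₀ u) → u ∈⁺ x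
      from (inj₁ (v , t , m)) = subst (_∈⁺ x) (sym (tag₀-injective (proj₁ is-tag₀ t))) m
      from (inj₂ (v , t , m)) = ⊥-elim (tag₀≢tag₁ (proj₁ is-tag₁ t))

    first⁻ : ∀ {x y} u → u ∈⁻ x ⇔ tag₀ u ∈⁻ pairᴹ x y
    first⁻ {x} {y} u = (λ m → proj₂ (proj₂ (pair-is x y (tag₀ u)))
        ( (λ v t → subst (_∈⁻ x) (tag₀-injective (proj₁ is-tag₀ t)) m)
        , λ v t → ⊥-elim (tag₀≢tag₁ (proj₁ is-tag₁ t))))
      , λ m → proj₁ (proj₁ (proj₂ (pair-is x y (tag₀ u))) m) u (proj₂ is-tag₀ refl)

    second⁺ : ∀ {x y} u → u ∈⁺ y ⇔ tag₁ u ∈⁺ pairᴹ x y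
    second⁺ {x} {y} u = (λ m → proj₂ (proj₁ (pair-is x y (tag₁ u))) (inj₂ (u , proj₂ is-tag₁ refl , m)))
      , λ m → from (proj₁ (proj₁ (pair-is x y (tag₁ u))) m)
      where
      from : ⟦ OrdPair v₀ v₁ ⟧⁺ (x ∷ y ∷ []) (tag₁ u) → u ∈⁺ y
      from (inj₁ (v , t , m)) = ⊥-elim (tag₀≢tag₁ (sym (proj₁ is-tag₀ t)))
      from (inj₂ (v , t , m)) = subst (_∈⁺ y) (sym (tag₁-injective (proj₁ is-tag₁ t))) m

    second⁻ : ∀ {x y} u → u ∈⁻ y ⇔ tag₁ u ∈⁻ pairᴹ x y
    second⁻ {x} {y} u = (λ m → proj₂ (proj₂ (pair-is x y (tag₁ u)))
        ( (λ v t → ⊥-elim (tag₀≢tag₁ (sym (proj₁ is-tag₀ t))))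
        , λ v t → subst (_∈⁻ y) (tag₁-injective (proj₁ is-tag₁ t)) m))
      , λ m → proj₂ (proj₁ (proj₂ (pair-is x y (tag₁ u))) m) u (proj₂ is-tag₁ refl)

  -- Tagged elements recover both the truth and the falsity of membership in each component, as
  -- extensionality requires for components that may be non-classical.
  pairᴹ-injective : ∀ {a b c d} → pairᴹ a b ≡ pairᴹ c d → a ≡ c × b ≡ d
  pairᴹ-injective {a} {b} {c} {d} e =
    extensional (λ u → via (_∈⁺ a) (_∈⁺ c) (tag₀ u ∈⁺_) (first⁺ u) (first⁺ u)
                     , via (_∈⁻ a) (_∈⁻ c) (tag₀ u ∈⁻_) (first⁻ u) (first⁻ u)) ,
    extensional (λ u → via (_∈⁺ b) (_∈⁺ d) (tag₁ u ∈⁺_) (second⁺ u) (second⁺ u)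
                     , via (_∈⁻ b) (_∈⁻ d) (tag₁ u ∈⁻_) (second⁻ u) (second⁻ u))
    where
    via : ∀ {u} (P Q R : M → Set ℓ) → P u ⇔ R (pairᴹ a b) → Q u ⇔ R (pairᴹ c d) → P u ⇔ Q u
    via P Q R p q = ⇔-trans p (⇔-trans (subst R e , subst R (sym e)) (⇔-sym q))

  abstract
    is-OrdPair : ∀ {n} (i j k : Fin n) ρ → T 𝔐 (i ≗ OrdPair j k) ρ ⇔ lookup ρ i ≡ pairᴹ (lookup ρ j) (lookup ρ k)
    is-OrdPair i j k ρ = is-pair

  private
    Row : Formula 3
    Row = Classical v₁ ∧ (∀ᶠ (v₀ ∈ v₂ ⟷ (∃ᶠ (v₀ ∈ suc (suc v₂) ∧ v₁ ≗ OrdPair v₂ v₀))))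

    IsRow : M → M → M → Set ℓ
    IsRow B x Q = Cl Q × (∀ p → p ∈⁺ Q ⇔ (Σ M λ y → y ∈⁺ B × p ≡ pairᴹ x y))

    abstract
      is-Row : ∀ {B x Q} → T 𝔐 Row (x ∷ Q ∷ B ∷ []) ⇔ IsRow B x Q
      is-Row {B} {x} {Q} = (Cl⁻ v₁ (x ∷ Q ∷ B ∷ []) , Cl⁺ v₁ (x ∷ Q ∷ B ∷ [])) ⇔-×
        ⇔-Π λ p → (_⇔-→_ ⇔-refl (inner p)) ⇔-× (inner p ⇔-→ ⇔-refl)
        where
        inner : ∀ p → T 𝔐 (∃ᶠ (v₀ ∈ suc (suc v₂) ∧ v₁ ≗ OrdPair v₂ v₀)) (p ∷ x ∷ Q ∷ B ∷ [])
          ⇔ (Σ M λ y → y ∈⁺ B × p ≡ pairᴹ x y)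
        inner p = ⇔-Σ {B = λ y → y ∈⁺ B × T 𝔐 (v₁ ≗ OrdPair v₂ v₀) (y ∷ p ∷ x ∷ Q ∷ B ∷ [])}
                           {C = λ y → y ∈⁺ B × p ≡ pairᴹ x y}
          λ y → ⇔-refl ⇔-× is-OrdPair v₁ v₂ v₀ (y ∷ p ∷ x ∷ Q ∷ B ∷ [])

  abstract
    -- Replacement over `B` gives the row of pairs with first component `x`, replacement over `A`
    -- the set of rows, and their union the product. The second use needs rows described by a
    -- formula, namely `Row`.
    product : ∀ A B → Σ M λ C → Cl C × (∀ p → p ∈⁺ C ⇔ (Σ M λ x → Σ M λ y → x ∈⁺ A × y ∈⁺ B × p ≡ pairᴹ x y))
    product A B = C , proj₁ (proj₂ whole) , λ p → ⇔-trans (proj₂ (proj₂ whole) p) (to , from)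
      where
      pairs : ∀ x → Σ M λ Q → Cl Q × (∀ p → p ∈⁺ Q ⇔ (Σ M λ y → y ∈⁺ B × T 𝔐 (v₁ ≗ OrdPair v₂ v₀) (y ∷ p ∷ x ∷ [])))
      pairs x = replace (v₁ ≗ OrdPair v₂ v₀) (x ∷ []) B λ y _ p p′ i j →
        trans (proj₁ (is-OrdPair v₁ v₂ v₀ (y ∷ p ∷ x ∷ [])) i) (sym (proj₁ (is-OrdPair v₁ v₂ v₀ (y ∷ p′ ∷ x ∷ [])) j))
      row : ∀ x → Σ M λ Q → IsRow B x Q
      row x = proj₁ (pairs x) , proj₁ (proj₂ (pairs x)) , λ p → ⇔-trans (proj₂ (proj₂ (pairs x)) p)
        (⇔-Σ {B = λ y → y ∈⁺ B × T 𝔐 (v₁ ≗ OrdPair v₂ v₀) (y ∷ p ∷ x ∷ [])} {C = λ y → y ∈⁺ B × p ≡ pairᴹ x y}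
          λ y → ⇔-refl ⇔-× is-OrdPair v₁ v₂ v₀ (y ∷ p ∷ x ∷ []))
      single : ∀ x Q Q′ → IsRow B x Q → IsRow B x Q′ → Q ≡ Q′
      single x Q Q′ (cl , e) (cl′ , e′) = Cl-ext cl cl′ λ p → ⇔-trans (e p) (⇔-sym (e′ p))
      rows : Σ M λ R → Cl R × (∀ Q → Q ∈⁺ R ⇔ (Σ M λ x → x ∈⁺ A × T 𝔐 Row (x ∷ Q ∷ B ∷ [])))
      rows = replace Row (B ∷ []) A λ x _ Q Q′ p q →
        single x Q Q′ (proj₁ (is-Row {B} {x} {Q}) p) (proj₁ (is-Row {B} {x} {Q′}) q)
      whole : Σ M λ C → Cl C × (∀ p → p ∈⁺ C ⇔ (Σ M λ Q → p ∈⁺ Q × Q ∈⁺ proj₁ rows))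
      whole = bigcup (proj₁ rows)
      C : M
      C = proj₁ whole
      to : ∀ {p} → (Σ M λ Q → p ∈⁺ Q × Q ∈⁺ proj₁ rows) → Σ M λ x → Σ M λ y → x ∈⁺ A × y ∈⁺ B × p ≡ pairᴹ x y
      to {p} (Q , p∈ , Q∈) =
        let (x , x∈ , r) = proj₁ (proj₂ (proj₂ rows) Q) Q∈
            (y , y∈ , i) = proj₁ (proj₂ (proj₁ (is-Row {B} {x} {Q}) r) p) p∈
        in x , y , x∈ , y∈ , i
      from : ∀ {p} → (Σ M λ x → Σ M λ y → x ∈⁺ A × y ∈⁺ B × p ≡ pairᴹ x y) → Σ M λ Q → p ∈⁺ Q × Q ∈⁺ proj₁ rows
      from {p} (x , y , x∈ , y∈ , e) = proj₁ (row x) , proj₂ (proj₂ (proj₂ (row x)) p) (y , y∈ , e)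
        , proj₂ (proj₂ (proj₂ rows) _) (x , x∈ , proj₂ (is-Row {B} {x} {proj₁ (row x)}) (proj₂ (row x)))

  structure : Structure ℓ
  structure = record { V = M ; _ε_ = _∈⁺_ ; Cla = Cl ; pair = pairᴹ }

  open Language structure

  record Definable {n : ℕ} (P : Vec M n → Set ℓ) : Set ℓ where
    constructor definable
    field
      {arity} : ℕ
      params  : Vec M arity
      formula : Formula (n + arity)
      correct : ∀ ρ → T 𝔐 formula (ρ ++ params) ⇔ P ρ

  -- The parameters of a compound formula are those of its parts, concatenated.
  inˡ : ∀ n {k} l → Fin (n + k) → Fin (n + (k + l))
  inˡ zero    l i = i ↑ˡ l
  inˡ (suc n) l   = lift (inˡ n l)

  inʳ : ∀ n k {l} → Fin (n + l) → Fin (n + (k + l))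
  inʳ zero    k i = k ↑ʳ i
  inʳ (suc n) k   = lift (inʳ n k)

  inˡ-agrees : ∀ {n k l} (ρ : Vec M n) (ps : Vec M k) (qs : Vec M l) → Agrees (inˡ n l) (ρ ++ (ps ++ qs)) (ρ ++ ps)
  inˡ-agrees []      ps qs i       = lookup-++ˡ ps qs i
  inˡ-agrees (a ∷ ρ) ps qs zero    = refl
  inˡ-agrees (a ∷ ρ) ps qs (suc i) = inˡ-agrees ρ ps qs i

  inʳ-agrees : ∀ {n k l} (ρ : Vec M n) (ps : Vec M k) (qs : Vec M l) → Agrees (inʳ n k) (ρ ++ (ps ++ qs)) (ρ ++ qs)
  inʳ-agrees []      ps qs i       = lookup-++ʳ ps qs i
  inʳ-agrees (a ∷ ρ) ps qs zero    = refl
  inʳ-agrees (a ∷ ρ) ps qs (suc i) = inʳ-agrees ρ ps qs i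

  combine : ∀ {n} {P Q : Vec M n → Set ℓ} (R : Vec M n → Set ℓ) (_⋆_ : ∀ {m} → Formula m → Formula m → Formula m) →
    (∀ {m} (φ ψ : Formula m) σ ρ → T 𝔐 φ σ ⇔ P ρ → T 𝔐 ψ σ ⇔ Q ρ → T 𝔐 (φ ⋆ ψ) σ ⇔ R ρ) →
    Definable P → Definable Q → Definable R
  combine {n} R _⋆_ c (definable {k} ps φ φ-ok) (definable {l} qs ψ ψ-ok) =
    definable (ps ++ qs) (ren (inˡ n l) φ ⋆ ren (inʳ n k) ψ) λ ρ → c _ _ _ ρ
      (⇔-trans (ren-T φ (inˡ-agrees ρ ps qs)) (φ-ok ρ)) (⇔-trans (ren-T ψ (inʳ-agrees ρ ps qs)) (ψ-ok ρ))

  record Located {n : ℕ} (t : Tm n) : Set ℓ where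
    constructor located
    field
      {arity} : ℕ
      params  : Vec M arity
      index   : Fin (n + arity)
      correct : ∀ ρ → lookup (ρ ++ params) index ≡ value ρ t

  locate : ∀ {n} (t : Tm n) → Located t
  locate (var i) = located [] (i ↑ˡ 0) λ ρ → lookup-++ˡ ρ [] i
  locate {n} (# c) = located (c ∷ []) (n ↑ʳ zero) λ ρ → lookup-++ʳ ρ (c ∷ []) zero

  atom₂ : ∀ {n} (s t : Tm n) (P : M → M → Set ℓ) (φ : ∀ {m} → Fin m → Fin m → Formula m) →
    (∀ {m} (i j : Fin m) σ → T 𝔐 (φ i j) σ ⇔ P (lookup σ i) (lookup σ j)) →
    Definable λ ρ → P (value ρ s) (value ρ t)
  atom₂ {n} s t P φ c with locate s | locate t
  ... | located {k} ps i i-ok | located {l} qs j j-ok =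
    definable (ps ++ qs) (φ (inˡ n l i) (inʳ n k j)) λ ρ → ⇔-trans (c _ _ _)
      (move (trans (inˡ-agrees ρ ps qs i) (i-ok ρ)) (trans (inʳ-agrees ρ ps qs j) (j-ok ρ)))
    where
    move : ∀ {a a′ b b′} → a ≡ a′ → b ≡ b′ → P a b ⇔ P a′ b′
    move refl refl = ⇔-refl

  atom₃ : ∀ {n} (s t u : Tm n) (P : M → M → M → Set ℓ) (φ : ∀ {m} → Fin m → Fin m → Fin m → Formula m) →
    (∀ {m} (i j h : Fin m) σ → T 𝔐 (φ i j h) σ ⇔ P (lookup σ i) (lookup σ j) (lookup σ h)) →
    Definable λ ρ → P (value ρ s) (value ρ t) (value ρ u)
  atom₃ {n} s t u P φ c with locate s | locate t | locate u
  ... | located {k} ps i i-ok | located {l} qs j j-ok | located {m} rs h h-ok =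
    definable (ps ++ (qs ++ rs)) (φ (inˡ n (l + m) i) (inʳ n k (inˡ n m j)) (inʳ n k (inʳ n l h)))
      λ ρ → ⇔-trans (c _ _ _ _)
      (move (trans (inˡ-agrees ρ ps (qs ++ rs) i) (i-ok ρ))
            (trans (inʳ-agrees ρ ps (qs ++ rs) _) (trans (inˡ-agrees ρ qs rs j) (j-ok ρ)))
            (trans (inʳ-agrees ρ ps (qs ++ rs) _) (trans (inʳ-agrees ρ qs rs h) (h-ok ρ))))
    where
    move : ∀ {a a′ b b′ d d′} → a ≡ a′ → b ≡ b′ → d ≡ d′ → P a b d ⇔ P a′ b′ d′
    move refl refl refl = ⇔-refl

  ∈-pair : ∀ {n} (i j h : Fin n) ρ → T 𝔐 (⟪ i , j ⟫∈ h) ρ ⇔ pairᴹ (lookup ρ i) (lookup ρ j) ∈⁺ lookup ρ h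
  ∈-pair i j h ρ = (λ (p , is , m) → subst (_∈⁺ lookup ρ h) (proj₁ is-pair is) m)
                 , λ m → pairᴹ (lookup ρ i) (lookup ρ j) , pair-is _ _ , m

  pick : ∀ {m n} k → Vec (Fin n) m → Fin (m + k) → Fin (n + k)
  pick {n = n} k []       i       = n ↑ʳ i
  pick         k (j ∷ js) zero    = j ↑ˡ k
  pick         k (j ∷ js) (suc i) = pick k js i

  pick-agrees : ∀ {m n k} (js : Vec (Fin n) m) (ρ : Vec M n) (ps : Vec M k) →
    Agrees (pick k js) (ρ ++ ps) (map (lookup ρ) js ++ ps)
  pick-agrees []       ρ ps i       = lookup-++ʳ ρ ps i
  pick-agrees (j ∷ js) ρ ps zero    = lookup-++ˡ ρ ps j
  pick-agrees (j ∷ js) ρ ps (suc i) = pick-agrees js ρ ps i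

  -- Only truth is matched, since `separate` reads nothing else: `¬′` becomes `¬ᶠ`, which is true
  -- exactly when its argument is not true. Constants become parameters appended to the context.
  translate : ∀ {n} (φ : Fm n) → Definable ⟦ φ ⟧
  translate (s ε′ t)        = atom₂ s t _∈⁺_ _∈_ λ i j σ → ⇔-refl
  translate (s ≡′ t)        = atom₂ s t _≡_ _≐_ λ i j σ → ⇔-refl
  translate (s ≡⟨ t , u ⟩′) = atom₃ s t u (λ p x y → p ≡ pairᴹ x y) (λ i j h → i ≗ OrdPair j h) is-OrdPair
  translate (s [ t , u ]′)  = atom₃ s t u (λ r x y → pairᴹ x y ∈⁺ r) (λ i j h → ⟪ j , h ⟫∈ i) λ i j h σ → ∈-pair j h i σ
  translate (Cla′ s)        with locate s
  ... | located ps i i-ok = definable ps (Classical i) λ ρ →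
    ⇔-trans (Cl⁻ i (ρ ++ ps) , Cl⁺ i (ρ ++ ps)) (subst Cl (i-ok ρ) , subst Cl (sym (i-ok ρ)))
  translate (¬′ φ)          with translate φ
  ... | definable ps f ok = definable ps (¬ᶠ f) λ ρ →
    (λ h p → lower (h (proj₂ (ok ρ) p))) , λ h p → ⊥-elim (h (proj₁ (ok ρ) p))
  translate (φ ∧′ ψ)        = combine _ _∧_ (λ _ _ _ _ → _⇔-×_) (translate φ) (translate ψ)
  translate (φ ∨′ ψ)        = combine _ _∨_ (λ _ _ _ _ → _⇔-⊎_) (translate φ) (translate ψ)
  translate (φ ⇒′ ψ)        = combine _ _⟶_ (λ _ _ _ _ → _⇔-→_) (translate φ) (translate ψ)
  translate (∀′ φ)          with translate φ
  ... | definable ps f ok = definable ps (∀ᶠ f) λ ρ → ⇔-Π λ a → ok (a ∷ ρ)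
  translate (∃′ φ)          with translate φ
  ... | definable ps f ok = definable ps (∃ᶠ f) λ ρ → ⇔-Σ λ a → ok (a ∷ ρ)
  translate (φ ⟨ js ⟩′)     with translate φ
  ... | definable {k} ps f ok = definable ps (ren (pick k js) f) λ ρ →
    ⇔-trans (ren-T f (pick-agrees js ρ ps)) (ok (map (lookup ρ) js))

  abstract
    separationᴹ : ∀ A (φ : Fm 1) → Σ M λ B → Cl B × (∀ x → x ∈⁺ B ⇔ (x ∈⁺ A × ⟦ φ ⟧ (x ∷ [])))
    separationᴹ A φ with translate φ
    ... | definable ps f ok with separate f ps A
    ...   | B , cl , e = B , cl , λ x → ⇔-trans (e x) (⇔-refl ⇔-× ok (x ∷ []))

  relationᴹ : ∀ A B (φ : Fm 2) → Σ M λ R → Cl R × (∀ p → p ∈⁺ R → Σ M λ x → Σ M λ y → p ≡ pairᴹ x y)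
    × (∀ x y → pairᴹ x y ∈⁺ R ⇔ (x ∈⁺ A × y ∈⁺ B × ⟦ φ ⟧ (x ∷ y ∷ [])))
  relationᴹ A B φ = R , proj₁ (proj₂ cut) , (λ p p∈ → let (x , y , i , _) = proj₂ (proj₁ (e p) p∈) in x , y , i)
    , λ x y → to , from
    where
    graphᶠ : Fm 1
    graphᶠ = ∃′ ∃′ (x₂ ≡⟨ x₁ , x₀ ⟩′ ∧′ φ ⟨ suc zero ∷ zero ∷ [] ⟩′)
    cut : Σ M λ R → Cl R × (∀ p → p ∈⁺ R ⇔ (p ∈⁺ proj₁ (product A B) × ⟦ graphᶠ ⟧ (p ∷ [])))
    cut = separationᴹ (proj₁ (product A B)) graphᶠ
    R : M
    R = proj₁ cut
    e : ∀ p → p ∈⁺ R ⇔ (p ∈⁺ proj₁ (product A B) × ⟦ graphᶠ ⟧ (p ∷ []))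
    e = proj₂ (proj₂ cut)
    ∈× : ∀ p → p ∈⁺ proj₁ (product A B) ⇔ (Σ M λ x → Σ M λ y → x ∈⁺ A × y ∈⁺ B × p ≡ pairᴹ x y)
    ∈× = proj₂ (proj₂ (product A B))
    match : ∀ {x y x′ y′} → (Σ M λ u → Σ M λ v → u ∈⁺ A × v ∈⁺ B × pairᴹ x y ≡ pairᴹ u v) →
      x ≡ x′ × y ≡ y′ → ⟦ φ ⟧ (x′ ∷ y′ ∷ []) → x ∈⁺ A × y ∈⁺ B × ⟦ φ ⟧ (x ∷ y ∷ [])
    match (u , v , u∈ , v∈ , j) (refl , refl) p =
      subst (_∈⁺ A) (sym (proj₁ (pairᴹ-injective j))) u∈ , subst (_∈⁺ B) (sym (proj₂ (pairᴹ-injective j))) v∈ , p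
    to : ∀ {x y} → pairᴹ x y ∈⁺ R → x ∈⁺ A × y ∈⁺ B × ⟦ φ ⟧ (x ∷ y ∷ [])
    to m = let (m′ , _ , _ , i , p) = proj₁ (e _) m in match (proj₁ (∈× _) m′) (pairᴹ-injective i) p
    from : ∀ {x y} → x ∈⁺ A × y ∈⁺ B × ⟦ φ ⟧ (x ∷ y ∷ []) → pairᴹ x y ∈⁺ R
    from {x} {y} (x∈ , y∈ , p) = proj₂ (e (pairᴹ x y)) (proj₂ (∈× _) (x , y , x∈ , y∈ , refl) , x , y , refl , p)

  -- The axiom asks for true inclusion, which also transfers falsity backwards; between classical
  -- sets this is the contrapositive of the positive half. Non-classical subsets are separated away.
  powerᴹ : ∀ A → Σ M λ P → ∀ x → x ∈⁺ P ⇔ (Cl x × (∀ z → z ∈⁺ x → z ∈⁺ A))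
  powerᴹ A with axiom _ powerSet (A ⁺)
  ... | P , e with separate (Classical v₀) [] P
  ...   | P′ , _ , e′ = P′ , λ x → (λ m → Cl⁻ v₀ (x ∷ []) (proj₂ (proj₁ (e′ x) m))
            , λ z z∈ → proj₁ ∈-⁺ (proj₁ (proj₁ (proj₁ (proj₁ (e x)) (proj₁ (proj₁ (e′ x) m))) z) z∈))
        , λ (cl , sub) → proj₂ (e′ x) (proj₂ (proj₁ (e x))
            ((λ z → (λ z∈ → proj₂ ∈-⁺ (sub z z∈))
                  , λ z∉ → Cl-∉ cl λ z∈ → proj₁ (⁺-Cl A z) (proj₂ ∈-⁺ (sub z z∈)) z∉) , tt)
            , Cl⁺ v₀ (x ∷ []) cl)

  choiceᴹ : ∀ A → Cl A → (∀ x → x ∈⁺ A → Σ M λ y → y ∈⁺ x) →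
    Σ M λ c → (∀ x → x ∈⁺ A → Σ M λ y → pairᴹ x y ∈⁺ c × y ∈⁺ x)
            × (∀ x y y′ → pairᴹ x y ∈⁺ c → pairᴹ x y′ ∈⁺ c → y ≡ y′)
  choiceᴹ A cl nonempty with axiom _ choice A (Cl⁺ v₀ (A ∷ []) cl , nonempty)
  ... | c , (_ , _ , fun) , _ , sel = c
    , (λ x x∈ → let (y , p , y∈) = sel x x∈ in y , proj₁ (∈-pair v₀ v₁ v₂ (x ∷ y ∷ c ∷ [])) p , y∈)
    , λ x y y′ p q → proj₁ (fun x y y′
        (proj₂ (∈-pair v₀ v₁ v₂ (x ∷ y ∷ c ∷ [])) p , proj₂ (∈-pair v₀ v₁ v₂ (x ∷ y′ ∷ c ∷ [])) q))

  abstract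
    zfc : ZFC structure
    zfc = record
      { em = em ; ext = Cl-ext ; pair-injective = pairᴹ-injective
      ; separation = separationᴹ ; relation = relationᴹ
      ; empty = ∅ᴹ , ∉-∅
      ; unordered = λ a b → upair a b , ∈-upair
      ; cup = λ A B → proj₁ (union₂ A B) , proj₂ (proj₂ (union₂ A B))
      ; power = powerᴹ ; choice = choiceᴹ }

-- Truth and falsity of the cardinal relations

module Cardinality {ℓ : Level} (em : ExcludedMiddle ℓ) (𝔐 : Model ℓ) (axiom : ∀ ψ → BZFC ψ → T 𝔐 ψ []) where
  open Model 𝔐 renaming (Carrier to M)
  open Renaming 𝔐
  open Foundations em 𝔐 axiom
  open SetTheory structure zfc using (Matching; _↣_; inclusion; sep-Cla; sep⁺; sep⁻; ∪⁺ˡ; ∪⁺ʳ; ∪⁻; ↣-refl)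
  open Matchings structure zfc
  open Countings structure zfc

  is-wk : ∀ {n} (φ : Class n) ρ c → T 𝔐 (v₀ ≗ wk φ) (c ∷ ρ) ⇔ Is c (⟦ φ ⟧⁺ ρ) (⟦ φ ⟧⁻ ρ)
  is-wk φ ρ c = ⇔-Π λ x → ⇔-cong (ren-T φ (agree x)) ⇔-× ⇔-cong (ren-F φ (agree x))
    where
    agree : ∀ x → Agrees (lift suc) (x ∷ c ∷ ρ) (x ∷ ρ)
    agree x = λ { zero → refl ; (suc i) → refl }

  is-wk² : ∀ {n} (φ : Class n) ρ c d → T 𝔐 (v₀ ≗ wk (wk φ)) (d ∷ c ∷ ρ) ⇔ Is d (⟦ φ ⟧⁺ ρ) (⟦ φ ⟧⁻ ρ)
  is-wk² φ ρ c d = ⇔-trans (is-wk (wk φ) (c ∷ ρ) d)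
    (⇔-Π λ x → ⇔-cong (ren-T φ (agree x)) ⇔-× ⇔-cong (ren-F φ (agree x)))
    where
    agree : ∀ x → Agrees (lift suc) (x ∷ c ∷ ρ) (x ∷ ρ)
    agree x = λ { zero → refl ; (suc i) → refl }

  at-T : ∀ {n} (φ ψ : Class n) (R : Relation) ρ {c d} → Is c (⟦ φ ⟧⁺ ρ) (⟦ φ ⟧⁻ ρ) → Is d (⟦ ψ ⟧⁺ ρ) (⟦ ψ ⟧⁻ ρ) →
    T 𝔐 (φ ⟨ R ⟩ ψ) ρ ⇔ T 𝔐 (R {suc (suc n)} v₁ v₀) (d ∷ c ∷ ρ)
  at-T {n} φ ψ R ρ {c} {d} c-is d-is = to , λ t → c , proj₂ (is-wk φ ρ c) c-is , d , proj₂ (is-wk² ψ ρ c d) d-is , t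
    where
    to : T 𝔐 (φ ⟨ R ⟩ ψ) ρ → T 𝔐 (R {suc (suc n)} v₁ v₀) (d ∷ c ∷ ρ)
    to (c′ , c′-is , d′ , d′-is , t)
      with Is-unique (proj₁ (is-wk φ ρ c′) c′-is) c-is | Is-unique (proj₁ (is-wk² ψ ρ c′ d′) d′-is) d-is
    ... | refl | refl = t

  -- Falsity quantifies over all sets described by the abstracts, and extensionality leaves one of
  -- each.
  at-F : ∀ {n} (φ ψ : Class n) (R : Relation) ρ {c d} → Is c (⟦ φ ⟧⁺ ρ) (⟦ φ ⟧⁻ ρ) → Is d (⟦ ψ ⟧⁺ ρ) (⟦ ψ ⟧⁻ ρ) →
    F 𝔐 (φ ⟨ R ⟩ ψ) ρ ⇔ F 𝔐 (R {suc (suc n)} v₁ v₀) (d ∷ c ∷ ρ)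
  at-F {n} φ ψ R ρ {c} {d} c-is d-is = (λ t → t c (proj₂ (is-wk φ ρ c) c-is) d (proj₂ (is-wk² ψ ρ c d) d-is)) , from
    where
    from : F 𝔐 (R {suc (suc n)} v₁ v₀) (d ∷ c ∷ ρ) → F 𝔐 (φ ⟨ R ⟩ ψ) ρ
    from t c′ c′-is d′ d′-is
      with Is-unique (proj₁ (is-wk φ ρ c′) c′-is) c-is | Is-unique (proj₁ (is-wk² ψ ρ c′ d′) d′-is) d-is
    ... | refl | refl = t

  Cl-Is : ∀ {c} {P N : M → Set ℓ} → Cl c → (∀ x → x ∈⁺ c ⇔ P x) → (∀ x → N x ⇔ (¬ P x)) → Is c P N
  Cl-Is cl p n x = p x , (λ q → proj₂ (n x) λ r → proj₁ (cl x) (proj₂ (p x) r) q)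
                       , λ q → Cl-∉ cl λ r → proj₁ (n x) q (proj₁ (p x) r)

  -- The paper's A! and A?
  _! _¿ : M → M
  a ! = a ⁺
  a ¿ = proj₁ (separate (?ᶠ (v₀ ∈ v₁)) (a ∷ []) (proj₁ (superset a)))

  !-Cl : ∀ a → Cl (a !)
  !-Cl = ⁺-Cl

  ¿-Cl : ∀ a → Cl (a ¿)
  ¿-Cl a = proj₁ (proj₂ (separate (?ᶠ (v₀ ∈ v₁)) (a ∷ []) (proj₁ (superset a))))

  -- Points whose membership in `a` is neither true nor false are missing from `a` but not from its
  -- classical superset: outside that, membership in `a` is false.
  ∈-¿ : ∀ {a x} → x ∈⁺ a ¿ ⇔ (¬ x ∈⁻ a)
  ∈-¿ {a} {x} = ⇔-trans (proj₂ (proj₂ (separate (?ᶠ (v₀ ∈ v₁)) (a ∷ []) (proj₁ (superset a)))) x)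
    ( (λ (_ , p) q → lower (p q))
    , λ p → proj₂ (proj₁ (proj₂ (superset a)) x) (λ q → p (proj₂ (proj₂ (proj₂ (superset a))) x q))
          , λ q → ⊥-elim (p q))

  module A (a : M) = Parts (a !) (a ¿)

  rlmᴹ : M → M
  rlmᴹ a = A.X a

  ∈-rlm : ∀ {a x} → x ∈⁺ rlmᴹ a ⇔ (x ∈⁺ a ⊎ ¬ x ∈⁻ a)
  ∈-rlm {a} {x} = ⇔-trans (A.X⁻ a , λ { (inj₁ p) → A.P⊂X a x p ; (inj₂ p) → A.Q⊂X a x p }) (∈-⁺ ⇔-⊎ ∈-¿)

  module _ {n : ℕ} (i : Fin n) (ρ : Vec M n) where
    private
      a : M
      a = lookup ρ i

    is-! : Is (a !) (⟦ i ^! ⟧⁺ ρ) (⟦ i ^! ⟧⁻ ρ)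
    is-! = Cl-Is (!-Cl a) (λ x → ⇔-trans ∈-⁺ ((_, tt) , proj₁))
      λ x → (λ p (q , _) → lower (p q)) , λ p q → ⊥-elim (p (q , tt))

    is-? : Is (a ¿) (⟦ i ^? ⟧⁺ ρ) (⟦ i ^? ⟧⁻ ρ)
    is-? = Cl-Is (¿-Cl a) (λ x → ⇔-trans ∈-¿ ((λ p q → ⊥-elim (p q)) , λ p q → lower (p q)))
      λ x → (λ (p , _) q → lower (q p)) , λ p → byContradiction (λ q → p λ r → ⊥-elim (q (r , tt)))

    is-rlm : Is (rlmᴹ a) (⟦ rlm i ⟧⁺ ρ) (⟦ rlm i ⟧⁻ ρ)
    is-rlm = Cl-Is sep-Cla
      (λ x → ⇔-trans (∈-rlm {a}) (((_, tt) , proj₁) ⇔-⊎ ((λ p q → ⊥-elim (p q)) , λ p q → lower (p q))))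
      λ x → (λ { (p , _) (inj₁ (q , _)) → lower (p q) ; (_ , (p , _)) (inj₂ q) → lower (q p) })
          , λ p → (λ q → ⊥-elim (p (inj₁ (q , tt)))) , byContradiction (λ q → p (inj₂ λ r → ⊥-elim (q (r , tt))))

    is-𝐭 : Is (A.t a) (⟦ i 𝐭 ⟧⁺ ρ) (⟦ i 𝐭 ⟧⁻ ρ)
    is-𝐭 = Cl-Is sep-Cla
      (λ x → (λ m → let (p , q) = sep⁻ m in (proj₁ ∈-⁺ p , tt) , λ r → ⊥-elim (proj₁ ∈-¿ q r))
           , λ ((p , _) , q) → sep⁺ (proj₂ ∈-⁺ p) (proj₂ ∈-¿ λ r → lower (q r)))
      λ x → (λ { (inj₁ p) ((q , _) , _) → lower (p q) ; (inj₂ (p , _)) (_ , q) → lower (q p) })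
          , λ p → byContradiction λ q → p ((byContradiction (λ r → q (inj₁ λ s → ⊥-elim (r (s , tt)))))
              , λ s → ⊥-elim (q (inj₂ (s , tt))))

    is-𝐛 : Is (A.b a) (⟦ i 𝐛 ⟧⁺ ρ) (⟦ i 𝐛 ⟧⁻ ρ)
    is-𝐛 = Cl-Is sep-Cla
      (λ x → (λ m → let (p , q) = sep⁻ m in (proj₁ ∈-⁺ p , tt) , byContradiction (λ r → q (proj₂ ∈-¿ λ s → r (s , tt))))
           , λ ((p , _) , (q , _)) → sep⁺ (proj₂ ∈-⁺ p) λ r → proj₁ ∈-¿ r q)
      λ x → (λ { (inj₁ p) ((q , _) , _) → lower (p q) ; (inj₂ p) (_ , (q , _)) → lower (p q) })
          , λ p → byContradiction λ q → p ((byContradiction (λ r → q (inj₁ λ s → ⊥-elim (r (s , tt)))))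
              , byContradiction (λ r → q (inj₂ λ s → ⊥-elim (r (s , tt)))))

    is-𝐧 : Is (A.n a) (⟦ i 𝐧 ⟧⁺ ρ) (⟦ i 𝐧 ⟧⁻ ρ)
    is-𝐧 = Cl-Is sep-Cla
      (λ x → (λ m → let (p , q) = sep⁻ m in (λ r → ⊥-elim (proj₁ ∈-¿ p r)) , λ r → ⊥-elim (q (proj₂ ∈-⁺ r)))
           , λ (p , q) → sep⁺ (proj₂ ∈-¿ λ r → lower (p r)) λ r → lower (q (proj₁ ∈-⁺ r)))
      λ x → (λ { (inj₁ (p , _)) (q , _) → lower (q p) ; (inj₂ (p , _)) (_ , q) → lower (q p) })
          , λ p → byContradiction λ q → p ((λ r → ⊥-elim (q (inj₁ (r , tt)))) , λ r → ⊥-elim (q (inj₂ (r , tt))))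

  _at_is_ : M → M → M → Set ℓ
  f at x is y = pairᴹ x y ∈⁺ f

  ∉-pair : ∀ {n} (i j k : Fin n) ρ → Cl (lookup ρ k) → F 𝔐 (⟪ i , j ⟫∈ k) ρ ⇔ (¬ lookup ρ k at lookup ρ i is lookup ρ j)
  ∉-pair i j k ρ cl =
    (λ p q → proj₁ (cl _) q (p _ (proj₂ (is-OrdPair v₀ (suc i) (suc j) (pairᴹ (lookup ρ i) (lookup ρ j) ∷ ρ)) refl)))
    , λ p w w-is → Cl-∉ cl λ q → p (subst (_∈⁺ lookup ρ k) (proj₁ (is-OrdPair v₀ (suc i) (suc j) (w ∷ ρ)) w-is) q)

  module _ {n : ℕ} (k i : Fin n) (ρ : Vec M n) where
    private
      f a : M
      f = lookup ρ k
      a = lookup ρ i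

      domᴹ : M → Set ℓ
      domᴹ x = Σ M λ y → f at x is y

    is-dom : ∀ {d} → Cl f → Cl d → (∀ x → x ∈⁺ d ⇔ domᴹ x) → Is d (⟦ dom k ⟧⁺ ρ) (⟦ dom k ⟧⁻ ρ)
    is-dom clf cld e = Cl-Is cld
      (λ x → ⇔-trans (e x) (⇔-sym (dom⁺ x)))
      λ x → (λ p q → let (y , r) = proj₁ (dom⁺ x) q in proj₁ (∉-pair v₁ v₀ (↑₂ k) (y ∷ x ∷ ρ) clf) (p y) r)
          , λ p y → proj₂ (∉-pair v₁ v₀ (↑₂ k) (y ∷ x ∷ ρ) clf) λ r → p (proj₂ (dom⁺ x) (y , r))
      where
      dom⁺ : ∀ x → ⟦ dom k ⟧⁺ ρ x ⇔ domᴹ x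
      dom⁺ x = ⇔-Σ {B = λ y → T 𝔐 (⟪ v₁ , v₀ ⟫∈ ↑₂ k) (y ∷ x ∷ ρ)} {C = λ y → f at x is y}
        λ y → ∈-pair v₁ v₀ (↑₂ k) (y ∷ x ∷ ρ)

    abstract
      counting⁺ : IsCounting f (rlmᴹ a) → T 𝔐 (Counting k i) ρ
      counting⁺ c = ((Cl⁺ k ρ cla
          , (λ p p∈ → let (x , y , e) = pairs p p∈ in x , y , proj₂ (is-OrdPair v₂ v₁ v₀ (y ∷ x ∷ p ∷ ρ)) e)
          , λ x y y′ (p , q) → fun x y y′
              (proj₁ (∈-pair v₂ v₁ (↑₃ k) (y′ ∷ y ∷ x ∷ ρ)) p) (proj₁ (∈-pair v₂ v₀ (↑₃ k) (y′ ∷ y ∷ x ∷ ρ)) q) , tt)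
        , λ x x′ y (p , q) → inj x x′ y
              (proj₁ (∈-pair v₂ v₀ (↑₃ k) (y ∷ x′ ∷ x ∷ ρ)) p) (proj₁ (∈-pair v₁ v₀ (↑₃ k) (y ∷ x′ ∷ x ∷ ρ)) q) , tt)
        , proj₂ (at-T (dom k) (rlm i) _≐_ ρ (is-dom cla sep-Cla domain) (is-rlm i ρ)) refl
        where open IsCounting c

      counting⁻ : T 𝔐 (Counting k i) ρ → IsCounting f (rlmᴹ a)
      counting⁻ (((clf , ps , fn) , ij) , (d , d-is , r , r-is , e)) = record
        { cla = Cl⁻ k ρ clf
        ; pairs = λ p p∈ → let (x , y , is) = ps p p∈ in x , y , proj₁ (is-OrdPair v₂ v₁ v₀ (y ∷ x ∷ p ∷ ρ)) is
        ; fun = λ x y y′ p q → proj₁ (fn x y y′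
            (proj₂ (∈-pair v₂ v₁ (↑₃ k) (y′ ∷ y ∷ x ∷ ρ)) p , proj₂ (∈-pair v₂ v₀ (↑₃ k) (y′ ∷ y ∷ x ∷ ρ)) q))
        ; inj = λ x x′ y p q → proj₁ (ij x x′ y
            (proj₂ (∈-pair v₂ v₀ (↑₃ k) (y ∷ x′ ∷ x ∷ ρ)) p , proj₂ (∈-pair v₁ v₀ (↑₃ k) (y ∷ x′ ∷ x ∷ ρ)) q))
        ; domain = λ x → ⇔-trans (subst (λ u → x ∈⁺ rlmᴹ a ⇔ x ∈⁺ u) rlm≡d ⇔-refl)
            (⇔-trans (proj₁ (proj₁ (is-wk (dom k) ρ d) d-is x))
              (⇔-Σ {B = λ y → T 𝔐 (⟪ v₁ , v₀ ⟫∈ ↑₂ k) (y ∷ x ∷ ρ)} {C = λ y → f at x is y}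
                λ y → ∈-pair v₁ v₀ (↑₂ k) (y ∷ x ∷ ρ)))
        }
        where
        rlm≡d : rlmᴹ a ≡ d
        rlm≡d = trans (Is-unique (is-rlm i ρ) (proj₁ (is-wk² (rlm i) ρ d r) r-is)) (sym e)

    IsImage : M → Set ℓ
    IsImage c = Is c (λ z → Σ M λ x → (f at x is z) × x ∈⁺ a) (λ z → ∀ x → f at x is z → x ∈⁻ a)

    abstract
      image : Cl f → Σ M λ c → Is c (⟦ k [ i ] ⟧⁺ ρ) (⟦ k [ i ] ⟧⁻ ρ) × IsImage c
      image clf = proj₁ im , proj₂ im ,
        λ z → ⇔-trans (proj₁ (proj₂ im z)) (pos z) , ⇔-trans (proj₂ (proj₂ im z)) (neg z)
        where
        IsValue : Formula 2
        IsValue = ∃ᶠ (v₁ ≗ OrdPair v₀ v₂)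
        value⁻ : ∀ p z → T 𝔐 IsValue (p ∷ z ∷ []) → Σ M λ x → p ≡ pairᴹ x z
        value⁻ p z (x , is) = x , proj₁ (is-OrdPair v₁ v₀ v₂ (x ∷ p ∷ z ∷ [])) is
        value⁺ : ∀ x z → T 𝔐 IsValue (pairᴹ x z ∷ z ∷ [])
        value⁺ x z = x , proj₂ (is-OrdPair v₁ v₀ v₂ (x ∷ pairᴹ x z ∷ z ∷ [])) refl
        range : Σ M λ C → Cl C × (∀ z → z ∈⁺ C ⇔ (Σ M λ p → p ∈⁺ f × T 𝔐 IsValue (p ∷ z ∷ [])))
        range = replace IsValue [] f λ p _ z z′ t t′ → let (x , e) = value⁻ p z t ; (x′ , e′) = value⁻ p z′ t′ in
          proj₂ (pairᴹ-injective (trans (sym e) e′))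
        in-range : ∀ {x z} → f at x is z → z ∈⁺ proj₁ range
        in-range {x} {z} p = proj₂ (proj₂ (proj₂ range) z) (_ , p , value⁺ x z)
        pos : ∀ z → ⟦ k [ i ] ⟧⁺ ρ z ⇔ (Σ M λ x → (f at x is z) × x ∈⁺ a)
        pos z = ⇔-Σ {B = λ x → T 𝔐 (⟪ v₀ , v₁ ⟫∈ ↑₂ k) (x ∷ z ∷ ρ) × x ∈⁺ a} {C = λ x → (f at x is z) × x ∈⁺ a}
          λ x → ∈-pair v₀ v₁ (↑₂ k) (x ∷ z ∷ ρ) ⇔-× ⇔-refl
        neg : ∀ z → ⟦ k [ i ] ⟧⁻ ρ z ⇔ (∀ x → f at x is z → x ∈⁻ a)
        neg z = ⇔-Π {B = λ x → T 𝔐 (⟪ v₀ , v₁ ⟫∈ ↑₂ k) (x ∷ z ∷ ρ) → x ∈⁻ a} {C = λ x → f at x is z → x ∈⁻ a}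
          λ x → ∈-pair v₀ v₁ (↑₂ k) (x ∷ z ∷ ρ) ⇔-→ ⇔-refl
        im : Σ M λ c → Is c (⟦ k [ i ] ⟧⁺ ρ) (⟦ k [ i ] ⟧⁻ ρ)
        im = bounded (k [ i ]) ρ (proj₁ range)
          (λ z t → let (_ , p , _) = proj₁ (pos z) t in in-range p)
          -- Off the range no `x` is sent to `z`, so the falsity condition holds vacuously.
          (λ z z∉ → proj₂ (neg z) λ x p → ⊥-elim (proj₁ (proj₁ (proj₂ range) z) (in-range p) z∉))

  LinkMaps : M → M → M → M → Set ℓ
  LinkMaps f g A B = ∀ x → x ∈⁺ A → Σ M λ y → y ∈⁺ B × Linked f g x y

  module _ {f g a b c d : M} (cf : IsCounting f (rlmᴹ a)) (cg : IsCounting g (rlmᴹ b))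
    (c-is : ∀ z → (z ∈⁺ c ⇔ (Σ M λ x → (f at x is z) × x ∈⁺ a)) × (z ∈⁻ c ⇔ (∀ x → f at x is z → x ∈⁻ a)))
    (d-is : ∀ z → (z ∈⁺ d ⇔ (Σ M λ x → (g at x is z) × x ∈⁺ b)) × (z ∈⁻ d ⇔ (∀ x → g at x is z → x ∈⁻ b))) where

    -- The positive half of inclusion concerns the sets `!`; the half about falsity, read
    -- contrapositively, concerns the sets `¿`.
    image-⊆ : (∀ z → (z ∈⁺ c → z ∈⁺ d) × (z ∈⁻ d → z ∈⁻ c)) ⇔ (LinkMaps f g (a !) (b !) × LinkMaps f g (a ¿) (b ¿))
    image-⊆ = (λ s → to! s , to? s) , λ (p , q) z → from! p z , from? q z
      where
      module F = IsCounting cf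
      to! : (∀ z → (z ∈⁺ c → z ∈⁺ d) × (z ∈⁻ d → z ∈⁻ c)) → LinkMaps f g (a !) (b !)
      to! s x x∈ =
        let (z , p) = proj₁ (F.domain x) (proj₂ (∈-rlm {a}) (inj₁ (proj₁ ∈-⁺ x∈)))
            (y , q , y∈) = proj₁ (proj₁ (d-is z)) (proj₁ (s z) (proj₂ (proj₁ (c-is z)) (x , p , proj₁ ∈-⁺ x∈)))
        in y , proj₂ ∈-⁺ y∈ , z , p , q
      to? : (∀ z → (z ∈⁺ c → z ∈⁺ d) × (z ∈⁻ d → z ∈⁻ c)) → LinkMaps f g (a ¿) (b ¿)
      to? s x x∈ = byContradiction λ none →
        let (z , p) = proj₁ (F.domain x) (proj₂ (∈-rlm {a}) (inj₂ (proj₁ ∈-¿ x∈)))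
        in proj₁ ∈-¿ x∈ (proj₁ (proj₂ (c-is z)) (proj₂ (s z) (proj₂ (proj₂ (d-is z))
             λ y q → byContradiction λ y∉ → none (y , proj₂ ∈-¿ y∉ , z , p , q))) x p)
      from! : LinkMaps f g (a !) (b !) → ∀ z → z ∈⁺ c → z ∈⁺ d
      from! m z z∈ =
        let (x , p , x∈) = proj₁ (proj₁ (c-is z)) z∈
            (y , y∈ , z′ , p′ , q) = m x (proj₂ ∈-⁺ x∈)
        in proj₂ (proj₁ (d-is z)) (y , subst (λ v → g at y is v) (F.fun x z′ z p′ p) q , proj₁ ∈-⁺ y∈)
      from? : LinkMaps f g (a ¿) (b ¿) → ∀ z → z ∈⁻ d → z ∈⁻ c
      from? m z z∉ = proj₂ (proj₂ (c-is z)) λ x p → byContradiction λ x∉ →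
        let (y , y∈ , z′ , p′ , q) = m x (proj₂ ∈-¿ x∉)
        in proj₁ ∈-¿ y∈ (proj₁ (proj₂ (d-is z)) z∉ y (subst (λ v → g at y is v) (F.fun x z′ z p′ p) q))

    -- A counterexample is truly in one image and falsely in the other, so it comes from a point of
    -- `a !` with no link to `b ¿`.
    image-⊈ : (Σ M λ z → z ∈⁺ c × z ∈⁻ d) ⇔ (¬ LinkMaps f g (a !) (b ¿))
    image-⊈ = to , from
      where
      module F = IsCounting cf
      to : (Σ M λ z → z ∈⁺ c × z ∈⁻ d) → ¬ LinkMaps f g (a !) (b ¿)
      to (z , z∈ , z∉) m =
        let (x , p , x∈) = proj₁ (proj₁ (c-is z)) z∈
            (y , y∈ , z′ , p′ , q) = m x (proj₂ ∈-⁺ x∈)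
        in proj₁ ∈-¿ y∈ (proj₁ (proj₂ (d-is z)) z∉ y (subst (λ v → g at y is v) (F.fun x z′ z p′ p) q))
      from : ¬ LinkMaps f g (a !) (b ¿) → Σ M λ z → z ∈⁺ c × z ∈⁻ d
      from ¬m = byContradiction λ none → ¬m λ x x∈ → byContradiction λ unmatched →
        let (z , p) = proj₁ (F.domain x) (proj₂ (∈-rlm {a}) (inj₁ (proj₁ ∈-⁺ x∈)))
        in none (z , proj₂ (proj₁ (c-is z)) (x , p , proj₁ ∈-⁺ x∈)
             , proj₂ (proj₂ (d-is z)) λ y q → byContradiction λ y∉ → unmatched (y , proj₂ ∈-¿ y∉ , z , p , q))

  unequal : ∀ {c d} → c =⁻ d ⇔ ((Σ M λ z → z ∈⁺ c × z ∈⁻ d) ⊎ (Σ M λ z → z ∈⁺ d × z ∈⁻ c))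
  unequal {c} {d} = ⇔-trans (proj₂ (axiom _ extensionality c d)) (to , from)
    where
    to : _ → (Σ M λ z → z ∈⁺ c × z ∈⁻ d) ⊎ (Σ M λ z → z ∈⁺ d × z ∈⁻ c)
    -- A false `⟺` has four disjuncts, two for each biconditional; those for `∼` repeat the others.
    to (z , inj₁ (inj₁ (p , q))) = inj₁ (z , p , q)
    to (z , inj₁ (inj₂ (q , p))) = inj₂ (z , p , q)
    to (z , inj₂ (inj₁ (q , p))) = inj₂ (z , p , q)
    to (z , inj₂ (inj₂ (p , q))) = inj₁ (z , p , q)
    from : (Σ M λ z → z ∈⁺ c × z ∈⁻ d) ⊎ (Σ M λ z → z ∈⁺ d × z ∈⁻ c) → _
    from (inj₁ (z , p , q)) = z , inj₁ (inj₁ (p , q))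
    from (inj₂ (z , p , q)) = z , inj₁ (inj₂ (q , p))

  module _ {n : ℕ} (i j : Fin n) (ρ : Vec M n) where
    private
      a b : M
      a = lookup ρ i
      b = lookup ρ j

      Θ : Set ℓ
      Θ = Matching (rlmᴹ a) (rlmᴹ b)

      _maps_to_ _covers_from_ : Θ → M → M → Set ℓ
      θ maps x to y = Maps (a !) (a ¿) (b !) (b ¿) θ x y
      θ covers y from x = Covers (a !) (a ¿) (b !) (b ¿) θ x y

      module Images {f g : M} (cf : IsCounting f (rlmᴹ a)) (cg : IsCounting g (rlmᴹ b)) where
        σ : Vec M (suc (suc n))
        σ = g ∷ f ∷ ρ

        imf = image v₁ (↑₂ i) σ (IsCounting.cla cf)
        img = image v₀ (↑₂ j) σ (IsCounting.cla cg)
        c d : M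
        c = proj₁ imf
        d = proj₁ img

        abstract
          ⊆-T : T 𝔐 (v₁ [ ↑₂ i ] ⟨ _⊆_ ⟩ v₀ [ ↑₂ j ]) σ ⇔ (LinkMaps f g (a !) (b !) × LinkMaps f g (a ¿) (b ¿))
          ⊆-T = ⇔-trans (at-T (v₁ [ ↑₂ i ]) (v₀ [ ↑₂ j ]) _⊆_ σ (proj₁ (proj₂ imf)) (proj₁ (proj₂ img)))
            (image-⊆ cf cg (proj₂ (proj₂ imf)) (proj₂ (proj₂ img)))

          ⊆-F : F 𝔐 (v₁ [ ↑₂ i ] ⟨ _⊆_ ⟩ v₀ [ ↑₂ j ]) σ ⇔ (¬ LinkMaps f g (a !) (b ¿))
          ⊆-F = ⇔-trans (at-F (v₁ [ ↑₂ i ]) (v₀ [ ↑₂ j ]) _⊆_ σ (proj₁ (proj₂ imf)) (proj₁ (proj₂ img)))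
            (⇔-trans (⇔-Σ λ z → (λ { (inj₁ p) → p ; (inj₂ (q , p)) → p , q }) , inj₁)
              (image-⊈ cf cg (proj₂ (proj₂ imf)) (proj₂ (proj₂ img))))

          ≐-T : T 𝔐 (v₁ [ ↑₂ i ] ⟨ _≐_ ⟩ v₀ [ ↑₂ j ]) σ
            ⇔ ((LinkMaps f g (a !) (b !) × LinkMaps f g (a ¿) (b ¿))
            × (LinkMaps g f (b !) (a !) × LinkMaps g f (b ¿) (a ¿)))
          ≐-T = ⇔-trans (at-T (v₁ [ ↑₂ i ]) (v₀ [ ↑₂ j ]) _≐_ σ (proj₁ (proj₂ imf)) (proj₁ (proj₂ img)))
            (⇔-trans both (image-⊆ cf cg (proj₂ (proj₂ imf)) (proj₂ (proj₂ img))
              ⇔-× image-⊆ cg cf (proj₂ (proj₂ img)) (proj₂ (proj₂ imf))))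
            where
            both : c ≡ d ⇔ ((∀ z → (z ∈⁺ c → z ∈⁺ d) × (z ∈⁻ d → z ∈⁻ c))
              × (∀ z → (z ∈⁺ d → z ∈⁺ c) × (z ∈⁻ c → z ∈⁻ d)))
            both = (λ e → (λ z → subst (z ∈⁺_) e , subst (z ∈⁻_) (sym e))
                 , λ z → subst (z ∈⁺_) (sym e) , subst (z ∈⁻_) e)
              , λ (s , t) → extensional λ z → (proj₁ (s z) , proj₁ (t z)) , (proj₂ (t z) , proj₂ (s z))

          ≐-F : F 𝔐 (v₁ [ ↑₂ i ] ⟨ _≐_ ⟩ v₀ [ ↑₂ j ]) σ ⇔ (¬ (LinkMaps f g (a !) (b ¿) × LinkMaps g f (b !) (a ¿)))
          ≐-F = ⇔-trans (at-F (v₁ [ ↑₂ i ]) (v₀ [ ↑₂ j ]) _≐_ σ (proj₁ (proj₂ imf)) (proj₁ (proj₂ img)))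
            (⇔-trans unequal (⇔-trans
              (image-⊈ cf cg (proj₂ (proj₂ imf)) (proj₂ (proj₂ img))
              ⇔-⊎ image-⊈ cg cf (proj₂ (proj₂ img)) (proj₂ (proj₂ imf)))
              de-Morgan))

      forward : ∀ {f g} (θ : Θ) → (∀ x y → Linked f g x y ⇔ pairᴹ x y ∈⁺ Matching.graph θ) → ∀ {x y} →
        LinkMaps f g x y ⇔ θ maps x to y
      forward θ e = (λ m x x∈ → let (y , y∈ , l) = m x x∈ in y , y∈ , proj₁ (e x y) l)
                  , (λ m x x∈ → let (y , y∈ , l) = m x x∈ in y , y∈ , proj₂ (e x y) l)

      backward : ∀ {f g} (θ : Θ) → (∀ x y → Linked f g x y ⇔ pairᴹ x y ∈⁺ Matching.graph θ) → ∀ {x y} →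
        LinkMaps g f y x ⇔ θ covers y from x
      backward θ e = (λ m y y∈ → let (x , x∈ , z , q , p) = m y y∈ in x , x∈ , proj₁ (e x y) (z , p , q))
                   , (λ m y y∈ → let (x , x∈ , l) = m y y∈ ; (z , p , q) = proj₂ (e x y) l in x , x∈ , z , q , p)

      matched′ : ∀ {f g} → IsCounting f (rlmᴹ a) → IsCounting g (rlmᴹ b) →
        Σ Θ λ θ → ∀ x y → Linked f g x y ⇔ pairᴹ x y ∈⁺ Matching.graph θ
      matched′ cf cg = let (θ , e) = matched cf cg in θ , λ x y → ⇔-sym (e x y)

    -- `Some` and `None` are the truth and the falsity of the definitions of `≼` and `≅`: since `&`
    -- depends only on the truth of its left argument, falsity still quantifies over true countings.
    -- `K` is a condition on countings and `L` its form for the induced matching.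
    module _ (R : Relation) (K : M → M → Set ℓ) (L : Θ → Set ℓ)
      (K⇔L : ∀ {f g} (θ : Θ) → (∀ x y → Linked f g x y ⇔ pairᴹ x y ∈⁺ Matching.graph θ) → K f g ⇔ L θ) where

      Some None : Set ℓ
      Some = Σ M λ f → T 𝔐 (Counting v₀ (suc i)) (f ∷ ρ) × Σ M λ g → T 𝔐 (Counting v₀ (↑₂ j)) (g ∷ f ∷ ρ)
        × T 𝔐 (v₁ [ ↑₂ i ] ⟨ R ⟩ v₀ [ ↑₂ j ]) (g ∷ f ∷ ρ)
      None = ∀ f → T 𝔐 (Counting v₀ (suc i)) (f ∷ ρ) → ∀ g → T 𝔐 (Counting v₀ (↑₂ j)) (g ∷ f ∷ ρ)
        → F 𝔐 (v₁ [ ↑₂ i ] ⟨ R ⟩ v₀ [ ↑₂ j ]) (g ∷ f ∷ ρ)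

      some-countings :
        (∀ {f g} → IsCounting f (rlmᴹ a) → IsCounting g (rlmᴹ b) →
          T 𝔐 (v₁ [ ↑₂ i ] ⟨ R ⟩ v₀ [ ↑₂ j ]) (g ∷ f ∷ ρ) ⇔ K f g) →
        Some ⇔ Σ Θ L
      some-countings T⇔K = to , from
        where
        to : Some → Σ Θ L
        to (f , cf , g , cg , t) =
          let cf′ = counting⁻ v₀ (suc i) (f ∷ ρ) cf
              cg′ = counting⁻ v₀ (↑₂ j) (g ∷ f ∷ ρ) cg
              (θ , e) = matched′ cf′ cg′
          in θ , proj₁ (K⇔L θ e) (proj₁ (T⇔K cf′ cg′) t)
        from : Σ Θ L → Some
        from (θ , l) =
          let (f , g , cf , cg , e) = realised θ
          in f , counting⁺ v₀ (suc i) (f ∷ ρ) cf , g , counting⁺ v₀ (↑₂ j) (g ∷ f ∷ ρ) cg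
           , proj₂ (T⇔K cf cg) (proj₂ (K⇔L θ e) l)

      no-countings :
        (∀ {f g} → IsCounting f (rlmᴹ a) → IsCounting g (rlmᴹ b) →
          F 𝔐 (v₁ [ ↑₂ i ] ⟨ R ⟩ v₀ [ ↑₂ j ]) (g ∷ f ∷ ρ) ⇔ (¬ K f g)) →
        None ⇔ (¬ Σ Θ L)
      no-countings F⇔¬K = to , from
        where
        to : None → ¬ Σ Θ L
        to t (θ , l) =
          let (f , g , cf , cg , e) = realised θ
          in proj₁ (F⇔¬K cf cg) (t f (counting⁺ v₀ (suc i) (f ∷ ρ) cf) g (counting⁺ v₀ (↑₂ j) (g ∷ f ∷ ρ) cg))
               (proj₂ (K⇔L θ e) l)
        from : ¬ Σ Θ L → None
        from none f cf g cg =
          let cf′ = counting⁻ v₀ (suc i) (f ∷ ρ) cf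
              cg′ = counting⁻ v₀ (↑₂ j) (g ∷ f ∷ ρ) cg
              (θ , e) = matched′ cf′ cg′
          in proj₂ (F⇔¬K cf′ cg′) λ k → none (θ , proj₁ (K⇔L θ e) k)

    abstract
      ≼-T : T 𝔐 (i ≼ j) ρ ⇔ (Σ Θ λ θ → (θ maps a ! to (b !)) × (θ maps a ¿ to (b ¿)))
      ≼-T = some-countings _⊆_ _ _ (λ θ e → forward θ e ⇔-× forward θ e) Images.⊆-T

      ≼-F : F 𝔐 (i ≼ j) ρ ⇔ (¬ Σ Θ λ θ → θ maps a ! to (b ¿))
      ≼-F = no-countings _⊆_ _ _ (λ θ e → forward θ e) Images.⊆-F

      ≅-T : T 𝔐 (i ≅ j) ρ ⇔ (Σ Θ λ θ → ((θ maps a ! to (b !)) × (θ maps a ¿ to (b ¿)))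
                                     × ((θ covers b ! from (a !)) × (θ covers b ¿ from (a ¿))))
      ≅-T = some-countings _≐_ _ _
        (λ θ e → (forward θ e ⇔-× forward θ e) ⇔-× (backward θ e ⇔-× backward θ e)) Images.≐-T

      ≅-F : F 𝔐 (i ≅ j) ρ ⇔ (¬ Σ Θ λ θ → (θ maps a ! to (b ¿)) × (θ covers b ! from (a ¿)))
      ≅-F = no-countings _≐_ _ _ (λ θ e → forward θ e ⇔-× backward θ e) Images.≐-F

  module _ {c : M} (cl : Cl c) where

    classical-! : c ! ≡ c
    classical-! = Cl-ext (!-Cl c) cl λ x → ∈-⁺

    classical-¿ : c ¿ ≡ c
    classical-¿ = Cl-ext (¿-Cl c) cl λ x → ⇔-trans ∈-¿ (⇔-sym (cl x))

    classical-t : A.t c ≡ c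
    classical-t = Cl-ext sep-Cla cl λ x → (λ m → proj₁ ∈-⁺ (proj₁ (sep⁻ m)))
      , λ m → sep⁺ (proj₂ ∈-⁺ m) (proj₂ ∈-¿ (proj₁ (cl x) m))

    classical-b : ∀ {x} → ¬ x ∈⁺ A.b c
    classical-b m = let (p , q) = sep⁻ m in q (proj₂ ∈-¿ (proj₁ (cl _) (proj₁ ∈-⁺ p)))

    classical-n : ∀ {x} → ¬ x ∈⁺ A.n c
    classical-n m = let (p , q) = sep⁻ m in q (proj₂ ∈-⁺ (proj₂ (cl _) (proj₁ ∈-¿ p)))

  module _ {n : ℕ} (φ ψ : Class n) (ρ : Vec M n) {c d : M} (clc : Cl c) (cld : Cl d)
    (c-is : Is c (⟦ φ ⟧⁺ ρ) (⟦ φ ⟧⁻ ρ)) (d-is : Is d (⟦ ψ ⟧⁺ ρ) (⟦ ψ ⟧⁻ ρ)) where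

    classical-≼-T : T 𝔐 (φ ⟨ _≼_ ⟩ ψ) ρ ⇔ (c ↣ d)
    classical-≼-T = ⇔-trans (at-T φ ψ _≼_ ρ c-is d-is) (⇔-trans (≼-T v₁ v₀ (d ∷ c ∷ ρ))
      ( (λ (θ , m , _) → subst (_↣ d) (classical-! clc) (subst (c ! ↣_) (classical-! cld) (restrict θ m)))
      , λ f → widen (λ x p → A.P⊂X c x (proj₂ ∈-⁺ p)) (λ x p → A.P⊂X d x (proj₂ ∈-⁺ p)) (_↣_.matching f)
            , (λ x x∈ → let (y , p) = _↣_.total f (proj₁ ∈-⁺ x∈) in y , proj₂ ∈-⁺ (_↣_.target f p) , p)
            , λ x x∈ → let (y , p) = _↣_.total f (proj₂ (clc x) (proj₁ ∈-¿ x∈))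
                       in y , proj₂ ∈-¿ (proj₁ (cld y) (_↣_.target f p)) , p))

    classical-≼-F : F 𝔐 (φ ⟨ _≼_ ⟩ ψ) ρ ⇔ (¬ (c ↣ d))
    classical-≼-F = ⇔-trans (at-F φ ψ _≼_ ρ c-is d-is) (⇔-trans (≼-F v₁ v₀ (d ∷ c ∷ ρ))
      (⇔-¬ (⇔-trans (possible-subset-criterion (c !) (c ¿) (d !) (d ¿))
        ( (λ f → subst (_↣ d) (classical-! clc) (subst (c ! ↣_) (classical-¿ cld) f))
        , (λ f → subst (_↣ (d ¿)) (sym (classical-! clc)) (subst (c ↣_) (sym (classical-¿ cld)) f))))))

    -- A classical set coincides with its `𝐭` part, while the other two parts are empty and admit
    -- the empty bijection.
    classical-≅-T : T 𝔐 (φ ⟨ _≅_ ⟩ ψ) ρ ⇔ Bijection c d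
    classical-≅-T = ⇔-trans (at-T φ ψ _≅_ ρ c-is d-is) (⇔-trans (≅-T v₁ v₀ (d ∷ c ∷ ρ))
      (⇔-trans (equality-criterion (c !) (c ¿) (d !) (d ¿))
        ( (λ (f , _) → subst (λ u → Bijection u d) (classical-t clc) (subst (Bijection (A.t c)) (classical-t cld) f))
        , (λ f → subst (λ u → Bijection u (A.t d)) (sym (classical-t clc))
                 (subst (Bijection c) (sym (classical-t cld)) f)
               , vacuous (classical-b clc) (classical-b cld) , vacuous (classical-n clc) (classical-n cld)))))
      where
      vacuous : ∀ {x y} → (∀ {u} → ¬ u ∈⁺ x) → (∀ {u} → ¬ u ∈⁺ y) → Bijection x y
      vacuous p q = inclusion (λ u m → ⊥-elim (p m)) , λ u m → ⊥-elim (q m)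

-- Checking T of the theorem's sentence against T of Body would unfold both; it is
-- cheaper to check that the formulas agree and to transfer along that equality.
sentence : Sentence
sentence = (∀ᶠ ∀ᶠ
    ( (v₁ ≼ v₀ ⟷ (rlm v₁ ⟨ _≼_ ⟩ rlm v₀) ∧ (v₁ ^! ⟨ _≼_ ⟩ v₀ ^!) ∧ (v₁ ^? ⟨ _≼_ ⟩ v₀ ^?) ∧ (v₁ 𝐭 ⟨ _≼_ ⟩ v₀ 𝐭))
    ∧ (∼ (v₁ ≼ v₀) ⟷ ∼ (v₁ ^! ⟨ _≼_ ⟩ v₀ ^?))
    ∧ (v₁ ≅ v₀ ⟷ (v₁ 𝐭 ⟨ _≅_ ⟩ v₀ 𝐭) ∧ (v₁ 𝐛 ⟨ _≅_ ⟩ v₀ 𝐛) ∧ (v₁ 𝐧 ⟨ _≅_ ⟩ v₀ 𝐧))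
    ∧ (∼ (v₁ ≅ v₀) ⟷ ∼ (v₁ ^! ⟨ _≼_ ⟩ v₀ ^?) ∨ ∼ (v₀ ^! ⟨ _≼_ ⟩ v₁ ^?) ∨ ∼ (v₁ 𝐛 ⟨ _≼_ ⟩ v₀ 𝐧) ∨ ∼ (v₀ 𝐛 ⟨ _≼_ ⟩ v₁ 𝐧))))

Body : ∀ {n} → Fin n → Fin n → Formula n
Body i j = ( (i ≼ j ⟷ (rlm i ⟨ _≼_ ⟩ rlm j) ∧ (i ^! ⟨ _≼_ ⟩ j ^!) ∧ (i ^? ⟨ _≼_ ⟩ j ^?) ∧ (i 𝐭 ⟨ _≼_ ⟩ j 𝐭))
    ∧ (∼ (i ≼ j) ⟷ ∼ (i ^! ⟨ _≼_ ⟩ j ^?))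
    ∧ (i ≅ j ⟷ (i 𝐭 ⟨ _≅_ ⟩ j 𝐭) ∧ (i 𝐛 ⟨ _≅_ ⟩ j 𝐛) ∧ (i 𝐧 ⟨ _≅_ ⟩ j 𝐧))
    ∧ (∼ (i ≅ j) ⟷ ∼ (i ^! ⟨ _≼_ ⟩ j ^?) ∨ ∼ (j ^! ⟨ _≼_ ⟩ i ^?) ∨ ∼ (i 𝐛 ⟨ _≼_ ⟩ j 𝐧) ∨ ∼ (j 𝐛 ⟨ _≼_ ⟩ i 𝐧)))

-- The four equivalences

module Theorem {ℓ : Level} (em : ExcludedMiddle ℓ) (𝔐 : Model ℓ) (axiom : ∀ ψ → BZFC ψ → T 𝔐 ψ []) 
  {n : ℕ} (i j : Fin n) (ρ : Vec (Model.Carrier 𝔐) n) where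
  open Cardinality em 𝔐 axiom
  open Foundations em 𝔐 axiom using (structure; zfc; de-Morgan)
  open SetTheory structure zfc using (_↣_; sep-Cla)
  open Matchings structure zfc
  private
    a b : Model.Carrier 𝔐
    a = lookup ρ i
    b = lookup ρ j

  sides₁ : T 𝔐 ((rlm i ⟨ _≼_ ⟩ rlm j) ∧ (i ^! ⟨ _≼_ ⟩ j ^!) ∧ (i ^? ⟨ _≼_ ⟩ j ^?) ∧ (i 𝐭 ⟨ _≼_ ⟩ j 𝐭)) ρ
    ⇔ ((A.X a ↣ A.X b) × (a ! ↣ b !) × (a ¿ ↣ b ¿) × (A.t a ↣ A.t b))
  sides₁ = classical-≼-T (rlm i) (rlm j) ρ sep-Cla sep-Cla (is-rlm i ρ) (is-rlm j ρ)
    ⇔-× (classical-≼-T (i ^!) (j ^!) ρ (!-Cl a) (!-Cl b) (is-! i ρ) (is-! j ρ)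
    ⇔-× (classical-≼-T (i ^?) (j ^?) ρ (¿-Cl a) (¿-Cl b) (is-? i ρ) (is-? j ρ)
    ⇔-× classical-≼-T (i 𝐭) (j 𝐭) ρ sep-Cla sep-Cla (is-𝐭 i ρ) (is-𝐭 j ρ)))
  part₁ : T 𝔐 (i ≼ j ⟷ (rlm i ⟨ _≼_ ⟩ rlm j) ∧ (i ^! ⟨ _≼_ ⟩ j ^!) ∧ (i ^? ⟨ _≼_ ⟩ j ^?) ∧ (i 𝐭 ⟨ _≼_ ⟩ j 𝐭)) ρ
  part₁ = ⇔-trans (≼-T i j ρ) (⇔-trans (subset-criterion (a !) (a ¿) (b !) (b ¿)) (⇔-sym sides₁))
  part₂ : T 𝔐 (∼ (i ≼ j) ⟷ ∼ (i ^! ⟨ _≼_ ⟩ j ^?)) ρ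
  part₂ = ⇔-trans (≼-F i j ρ) (⇔-trans (⇔-¬ (possible-subset-criterion (a !) (a ¿) (b !) (b ¿)))
    (⇔-sym (classical-≼-F (i ^!) (j ^?) ρ (!-Cl a) (¿-Cl b) (is-! i ρ) (is-? j ρ))))
  sides₃ : T 𝔐 ((i 𝐭 ⟨ _≅_ ⟩ j 𝐭) ∧ (i 𝐛 ⟨ _≅_ ⟩ j 𝐛) ∧ (i 𝐧 ⟨ _≅_ ⟩ j 𝐧)) ρ
    ⇔ (Bijection (A.t a) (A.t b) × Bijection (A.b a) (A.b b) × Bijection (A.n a) (A.n b))
  sides₃ = classical-≅-T (i 𝐭) (j 𝐭) ρ sep-Cla sep-Cla (is-𝐭 i ρ) (is-𝐭 j ρ)
    ⇔-× (classical-≅-T (i 𝐛) (j 𝐛) ρ sep-Cla sep-Cla (is-𝐛 i ρ) (is-𝐛 j ρ)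
    ⇔-× classical-≅-T (i 𝐧) (j 𝐧) ρ sep-Cla sep-Cla (is-𝐧 i ρ) (is-𝐧 j ρ))
  part₃ : T 𝔐 (i ≅ j ⟷ (i 𝐭 ⟨ _≅_ ⟩ j 𝐭) ∧ (i 𝐛 ⟨ _≅_ ⟩ j 𝐛) ∧ (i 𝐧 ⟨ _≅_ ⟩ j 𝐧)) ρ
  part₃ = ⇔-trans (≅-T i j ρ) (⇔-trans (equality-criterion (a !) (a ¿) (b !) (b ¿)) (⇔-sym sides₃))
  sides₄ : T 𝔐 (∼ (i ^! ⟨ _≼_ ⟩ j ^?) ∨ ∼ (j ^! ⟨ _≼_ ⟩ i ^?) ∨ ∼ (i 𝐛 ⟨ _≼_ ⟩ j 𝐧) ∨ ∼ (j 𝐛 ⟨ _≼_ ⟩ i 𝐧)) ρ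
    ⇔ ((¬ (a ! ↣ b ¿)) ⊎ (¬ (b ! ↣ a ¿)) ⊎ (¬ (A.b a ↣ A.n b)) ⊎ (¬ (A.b b ↣ A.n a)))
  sides₄ = classical-≼-F (i ^!) (j ^?) ρ (!-Cl a) (¿-Cl b) (is-! i ρ) (is-? j ρ)
    ⇔-⊎ (classical-≼-F (j ^!) (i ^?) ρ (!-Cl b) (¿-Cl a) (is-! j ρ) (is-? i ρ)
    ⇔-⊎ (classical-≼-F (i 𝐛) (j 𝐧) ρ sep-Cla sep-Cla (is-𝐛 i ρ) (is-𝐧 j ρ)
    ⇔-⊎ classical-≼-F (j 𝐛) (i 𝐧) ρ sep-Cla sep-Cla (is-𝐛 j ρ) (is-𝐧 i ρ)))
  -- The criterion yields the negation of a conjunction of four embeddings; excluded middle turns it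
  -- into the disjunction of the claim.
  negated : ((¬ (a ! ↣ b ¿)) ⊎ (¬ (b ! ↣ a ¿)) ⊎ (¬ (A.b a ↣ A.n b)) ⊎ (¬ (A.b b ↣ A.n a)))
    ⇔ (¬ ((a ! ↣ b ¿) × (b ! ↣ a ¿) × (A.b a ↣ A.n b) × (A.b b ↣ A.n a)))
  negated = ⇔-trans (⇔-refl ⇔-⊎ ⇔-trans (⇔-refl ⇔-⊎ de-Morgan) de-Morgan) de-Morgan
  part₄ : T 𝔐 (∼ (i ≅ j) ⟷ ∼ (i ^! ⟨ _≼_ ⟩ j ^?) ∨ ∼ (j ^! ⟨ _≼_ ⟩ i ^?) ∨ ∼ (i 𝐛 ⟨ _≼_ ⟩ j 𝐧) ∨ ∼ (j 𝐛 ⟨ _≼_ ⟩ i 𝐧)) ρ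
  part₄ = ⇔-trans (≅-F i j ρ) (⇔-trans (⇔-¬ (possible-equality-criterion (a !) (a ¿) (b !) (b ¿)))
    (⇔-trans (⇔-sym negated) (⇔-sym sides₄)))

  claim : T 𝔐 (Body i j) ρ
  claim = part₁ , part₂ , part₃ , part₄

transfer : ∀ {ℓ n} → ExcludedMiddle ℓ → (𝔐 : Model ℓ) → (∀ ψ → BZFC ψ → T 𝔐 ψ []) → (φ : Formula n) →
  ∀ᶠ ∀ᶠ Body v₁ v₀ ≡ φ → ∀ ρ → T 𝔐 φ ρ
transfer em 𝔐 axiom _ refl ρ a b = Theorem.claim em 𝔐 axiom v₁ v₀ (b ∷ a ∷ ρ)

theorem4p5 : ∀ {ℓ} → ExcludedMiddle ℓ → BZFC ⊨[ ℓ ] (∀ᶠ ∀ᶠ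
    ( (v₁ ≼ v₀ ⟷ (rlm v₁ ⟨ _≼_ ⟩ rlm v₀) ∧ (v₁ ^! ⟨ _≼_ ⟩ v₀ ^!) ∧ (v₁ ^? ⟨ _≼_ ⟩ v₀ ^?) ∧ (v₁ 𝐭 ⟨ _≼_ ⟩ v₀ 𝐭))
    ∧ (∼ (v₁ ≼ v₀) ⟷ ∼ (v₁ ^! ⟨ _≼_ ⟩ v₀ ^?))
    ∧ (v₁ ≅ v₀ ⟷ (v₁ 𝐭 ⟨ _≅_ ⟩ v₀ 𝐭) ∧ (v₁ 𝐛 ⟨ _≅_ ⟩ v₀ 𝐛) ∧ (v₁ 𝐧 ⟨ _≅_ ⟩ v₀ 𝐧))
    ∧ (∼ (v₁ ≅ v₀) ⟷ ∼ (v₁ ^! ⟨ _≼_ ⟩ v₀ ^?) ∨ ∼ (v₀ ^! ⟨ _≼_ ⟩ v₁ ^?) ∨ ∼ (v₁ 𝐛 ⟨ _≼_ ⟩ v₀ 𝐧) ∨ ∼ (v₀ 𝐛 ⟨ _≼_ ⟩ v₁ 𝐧))))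
theorem4p5 em 𝔐 axiom = transfer em 𝔐 axiom sentence refl []
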